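{- Given a fractional laminar cut family $\mathcal{C}$ feasible for the MCP on a graph $G$ with integral edge capacities $c_e$, the algorithm Round-2 produces an integral family of cuts $\mathcal{A}$ that is feasible for the MCP on $G$ with edge capacities $c_e+3$.
   Context: MCP (multiway cut packing): an undirected graph $G=(V,E)$ with positive integral edge capacities $c_e$, and $k$ sets of terminals $S_1,\dots,S_k$ (commodities); each terminal $i$ resides at a vertex $r_i\in V$, and distinct terminals of the same commodity reside at different vertices. A cut is a set $C$ with $\emptyset\subsetneq C\subsetneq V$; $\delta(C)$ is the set of edges with exactly one endpoint in $C$. Two cuts $C_1,C_2$ cross if $C_1\cap C_2$, $C_1\setminus C_2$, $C_2\setminus C_1$ are all non-empty. A collection of cuts is laminar if no two of its members cross. A fractional laminar cut family $\mathcal{C}$ for a terminal set $T$ with weight function $w$ is a laminar collection of cuts, each cut being associated with a unique terminal of $T$ (the same vertex set may occur several times), such that, writing $\mathcal{C}_i$ for the cuts associated with $i$, every $C\in\mathcal{C}_i$ contains $r_i$, and $\sum_{C\in\mathcal{C}_i}w(C)=1$ for every $i\in T$. Its load on $e$ is $\ell_e^{\mathcal{C}}=\sum_{C\in\mathcal{C}:\,e\in\delta(C)}w(C)$. The family is feasible for the MCP with edge capacities $c'_e$ if (1) $T=\bigcup_{a\in[k]}S_a$; (2) for all $a\in[k]$ and $i\ne j$ in $S_a$, either $r_j\notin\bigcup_{C\in\mathcal{C}_i}C$ or $r_i\notin\bigcup_{C\in\mathcal{C}_j}C$; (3) $\ell_e^{\mathcal{C}}\le c'_e$ for every $e\in E$.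 An integral family $\mathcal{A}=\{A_i\}_{i\in T}$ (one cut per terminal in $T=\bigcup_a S_a$) is feasible for the MCP with edge capacities $c'_e$ if $r_i\in A_i$ for every $i\in T$; for all $a\in[k]$ and $i\ne j$ in $S_a$, either $r_j\notin A_i$ or $r_i\notin A_j$; and $\ell_e^{\mathcal{A}}=|\{i\in T: e\in\delta(A_i)\}|\le c'_e$ for every $e\in E$. During the algorithm $\ell_e^{\mathcal{A}}$ counts the cuts currently in $\mathcal{A}$. Notation (always for the current $\mathcal{C}$): $K_v$ is the set of cuts in $\mathcal{C}$ containing $v$; the depth of $v$ is $\sum_{C\in K_v}w(C)$; the depth of a terminal is that of its vertex. $K_v^1$ is the set of innermost cuts of $K_v$ of total weight exactly $1$: if $K_v=\{L_1\subseteq\cdots\subseteq L_l\}$ and $\sum_{a<l'}w(L_a)<1\le\sum_{a\le l'}w(L_a)$, it consists of $L_1,\dots,L_{l'}$, with $L_{l'}$ taken only to the extent $1-\sum_{a<l'}w(L_a)$ of its weight (a cut may be split into two copies with weights summing to the original weight). $O_i$ is the largest (outermost) cut in $\mathcal{C}_i$. Terminal $i$ dominates $j$ in the cut-inclusion order, $i>_{CI}j$, if $O_i\subset O_j$ (if $O_i=O_j$ ties are broken arbitrarily but consistently). Inclusion invariant: whenever $i>_{CI}j$, $C_i\in\mathcal{C}_i$, $C_j\in\mathcal{C}_j$ and $r_i,r_j\in C_i\cap C_j$, we have $C_i\subseteq C_j$. Algorithm Round-2. Input: $G$, $c_e$, $T$ and the fractional laminar cut family $\mathcal{C}$. Output: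 a collection $\mathcal{A}$ of cuts, one for each terminal in $T$. (1) Preprocess $\mathcal{C}$, by reassigning cuts among terminals, so that it satisfies the inclusion invariant (each new $O_i$ being the same as or a subset of the original one). (2) Set $T'=T$, $\mathcal{A}=\emptyset$, $Y=Z=\emptyset$, $M(v)=\{v\}$ for all $v\in V$ (meta-node of $v$). (3) While there are terminals in $T'$: (a) among the unassigned terminals of maximum depth let $i\in T'$ be one that is undominated in the cut-inclusion order; let $E_i=Y\cap\delta(M(r_i))$. (b) If $E_i=\emptyset$, let $A_i=M(r_i)$. (c) If $E_i\ne\emptyset$, let $U_i$ be the set of endpoints of edges of $E_i$ lying in $M(r_i)$. If $r_i\in U_i$, abort and return error. Otherwise let $u_i$ be the vertex of $U_i$ that entered $M(r_i)$ first during the execution, and set $A_i$ to be the meta-node of $r_i$ just prior to the iteration where $M(u_i)$ becomes equal to $M(r_i)$. (d) Add $A_i$ to $\mathcal{A}$; remove $\mathcal{C}_i$ from $\mathcal{C}$ and $i$ from $T'$; for every $j\in T'$ and $C\in K_{r_i}^1\cap\mathcal{C}_j$ (with $K_{r_i}^1$ taken before this removal) replace $C$ by $C\setminus M(r_i)$. (e) If for some edge $e$, $\ell_e^{\mathcal{A}}=c_e+2$ and $\ell_e^{\mathcal{C}}>0$, add $e$ to $Y$. If there is an edge $e=(u,v)$ with $\ell_e^{\mathcal{C}}=0$, merge $M(u)$ and $M(v)$. Add all edges $e$ with $\ell_e^{\mathcal{C}}=0$ to $Z$ and remove them from $Y$. (f) Recompute the depths of vertices and terminals. Ownership of cuts by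 terminals remains unchanged as cuts are modified; containment relations between cuts, and hence the inclusion invariant, continue to hold throughout, and throughout the execution $\mathcal{C}$ is kept a fractional laminar family for the terminals $T'$.
   Formalization: The weights w(C) of the cuts in the fractional laminar cut family are taken to be rational numbers rather than arbitrary real numbers. -}

module Defs where

open import Data.Bool.Base using (if_then_else_; _xor_)
import Data.Bool.Properties as Bool
open import Data.Fin.Base using (Fin)
import Data.Fin.Properties as Fin
open import Data.Fin.Subset using
  (Subset; ⁅_⁆; ⊥; _∈_; _∉_; _⊆_; _⊂_; _∩_; _∪_; _─_; _-_; ⋃; Nonempty; Empty)
open import Data.Fin.Subset.Properties using (_∈?_)
open import Data.Integer.Base using (+_)
open import Data.List.Base using
  (List; []; _∷_; _++_; map; filter; foldr; foldl; length; allFin)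
open import Data.List.Membership.Propositional using () renaming (_∈_ to _∈ˡ_)
open import Data.List.Relation.Binary.Permutation.Propositional using (_↭_)
open import Data.List.Relation.Unary.AllPairs using (AllPairs)
open import Data.Maybe.Base using (Maybe; just; nothing)
import Data.Maybe.Relation.Unary.Any as Maybe
open import Data.Nat.Base as ℕ using (ℕ; suc)
import Data.Nat.Properties as ℕ
open import Data.Product.Base using (∃; ∃₂; _×_; _,_; proj₁; proj₂)
open import Data.Rational.Base as ℚ using (ℚ; 0ℚ; 1ℚ)
import Data.Rational.Properties as ℚ
open import Data.Sum.Base using (_⊎_)
open import Data.Vec.Base using (lookup; tabulate)
import Data.Vec.Functional as Functional
import Data.Vec.Properties as Vec
open import Function.Bundles using (_⇔_)
open import Function.Definitions using (Injective)
open import Relation.Binary.PropositionalEquality using (_≡_; _≢_)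
open import Relation.Nullary using (¬_; does; _×-dec_; ¬?)

-- Terminals are names, so terminals of different commodities may reside at
-- the same vertex.  Edges are named too: parallel edges are allowed, and so
-- are loops, which lie in no δ(X).
record MCP : Set where
  field
    #V #E #T k : ℕ
    ends       : Fin #E → Fin #V × Fin #V
    cap        : Fin #E → ℕ
    cap>0      : ∀ e → 0 ℕ.< cap e
    S          : Fin k → Subset #T
    r          : Fin #T → Fin #V
    r-distinct : ∀ a {i j} → i ∈ S a → j ∈ S a → i ≢ j → r i ≢ r j

module _ (G : MCP) where
  open MCP G

  Vertex Edge Terminal : Set
  Vertex   = Fin #V
  Edge     = Fin #E
  Terminal = Fin #T

  IsCut : Subset #V → Set
  IsCut X = Nonempty X × ∃ λ v → v ∉ X

  δ : Subset #V → Subset #E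
  δ X = tabulate λ e → lookup X (proj₁ (ends e)) xor lookup X (proj₂ (ends e))

  Cross : Subset #V → Subset #V → Set
  Cross X Y = Nonempty (X ∩ Y) × Nonempty (X ─ Y) × Nonempty (Y ─ X)

  -- A copy of a vertex set, associated with a terminal.
  record Cut : Set where
    constructor cut
    field
      owner  : Terminal
      side   : Subset #V
      weight : ℚ
  open Cut public

  Family : Set
  Family = List Cut

  totalWeight : Family → ℚ
  totalWeight 𝒞 = foldr ℚ._+_ 0ℚ (map weight 𝒞)

  ownedBy : Terminal → Family → Family
  ownedBy i = filter λ C → owner C Fin.≟ i

  -- K_v
  containing : Vertex → Family → Family
  containing v = filter λ C → v ∈? side C

  depth : Family → Vertex → ℚ
  depth 𝒞 v = totalWeight (containing v 𝒞)

  load : Family → Edge → ℚ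
  load 𝒞 e = totalWeight (filter (λ C → e ∈? δ (side C)) 𝒞)

  -- Weights of 0 are admitted here; preprocessing discards such cuts.
  record IsFractionalLaminar (T : Subset #T) (𝒞 : Family) : Set where
    field
      owner∈T   : ∀ {C} → C ∈ˡ 𝒞 → owner C ∈ T
      isCut     : ∀ {C} → C ∈ˡ 𝒞 → IsCut (side C)
      r∈side    : ∀ {C} → C ∈ˡ 𝒞 → r (owner C) ∈ side C
      weight≥0  : ∀ {C} → C ∈ˡ 𝒞 → 0ℚ ℚ.≤ weight C
      laminar   : ∀ {C D} → C ∈ˡ 𝒞 → D ∈ˡ 𝒞 → ¬ Cross (side C) (side D)
      weightSum : ∀ {i} → i ∈ T → totalWeight (ownedBy i 𝒞) ≡ 1ℚ

  record FractionallyFeasible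
         (T : Subset #T) (𝒞 : Family) (c′ : Edge → ℕ) : Set where
    field
      fractionalLaminar : IsFractionalLaminar T 𝒞
      terminals         : ∀ i → i ∈ T ⇔ ∃ λ a → i ∈ S a
      separated         : ∀ a {i j} → i ∈ S a → j ∈ S a → i ≢ j →
                          r j ∉ ⋃ (map side (ownedBy i 𝒞)) ⊎
                          r i ∉ ⋃ (map side (ownedBy j 𝒞))
      capacity          : ∀ e → load 𝒞 e ℚ.≤ + c′ e ℚ./ 1

  -- Terminals without a cut are mapped to nothing.
  IntegralFamily : Set
  IntegralFamily = Terminal → Maybe (Subset #V)

  integralLoad : IntegralFamily → Edge → ℕ
  integralLoad 𝒜 e =
    length (filter (λ i → Maybe.dec (λ X → e ∈? δ X) (𝒜 i)) (allFin #T))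

  record IntegrallyFeasible (c′ : Edge → ℕ) (𝒜 : IntegralFamily) : Set where
    field
      terminals : ∀ i → (∃ λ X → 𝒜 i ≡ just X) ⇔ (∃ λ a → i ∈ S a)
      isCut     : ∀ {i X} → 𝒜 i ≡ just X → IsCut X
      r∈side    : ∀ {i X} → 𝒜 i ≡ just X → r i ∈ X
      separated : ∀ a {i j X Y} → i ∈ S a → j ∈ S a → i ≢ j →
                  𝒜 i ≡ just X → 𝒜 j ≡ just Y → r j ∉ X ⊎ r i ∉ Y
      capacity  : ∀ e → integralLoad 𝒜 e ℕ.≤ c′ e

  -- P = O_i
  Outermost : Family → Terminal → Subset #V → Set
  Outermost 𝒞 i P =
    (∃ λ C → C ∈ˡ ownedBy i 𝒞 × side C ≡ P) ×
    (∀ {C} → C ∈ˡ ownedBy i 𝒞 → side C ⊆ P)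

  -- i >CI j, for the current family.  Ties O_i = O_j are decided by an
  -- injective ranking of the terminals that is fixed for the whole execution.
  Dominates : (rank : Terminal → ℕ) → Family → Terminal → Terminal → Set
  Dominates rank 𝒞 i j = ∃₂ λ P Q →
    Outermost 𝒞 i P × Outermost 𝒞 j Q ×
    (P ⊂ Q ⊎ (P ≡ Q × rank i ℕ.< rank j))

  InclusionInvariant : (rank : Terminal → ℕ) → Family → Set
  InclusionInvariant rank 𝒞 = ∀ {C D} → C ∈ˡ 𝒞 → D ∈ˡ 𝒞 →
    Dominates rank 𝒞 (owner C) (owner D) →
    r (owner C) ∈ side C ∩ side D → r (owner D) ∈ side C ∩ side D →
    side C ⊆ side D

  weightOf : Family → Subset #V → ℚ
  weightOf 𝒞 X =
    totalWeight (filter (λ C → Vec.≡-dec Bool._≟_ (side C) X) 𝒞)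

  -- 𝒞⁰ is a possible result of preprocessing 𝒞.
  record Preprocessed (T : Subset #T) (𝒞 𝒞⁰ : Family)
                      (rank : Terminal → ℕ) : Set where
    field
      fractionalLaminar : IsFractionalLaminar T 𝒞⁰
      weight>0          : ∀ {C} → C ∈ˡ 𝒞⁰ → 0ℚ ℚ.< weight C
      -- Only the ownership changes; copies may be split or joined.
      reassigned        : ∀ X → weightOf 𝒞⁰ X ≡ weightOf 𝒞 X
      shrinks           : ∀ {i P Q} → i ∈ T →
                          Outermost 𝒞⁰ i P → Outermost 𝒞 i Q → P ⊆ Q
      inclusion         : InclusionInvariant rank 𝒞⁰
      rank-injective    : Injective _≡_ _≡_ rank
      -- Consistency of the tie-breaking: O_i ⊂ O_j may turn into O_i = O_j
      -- when cuts shrink, and the tie must then still favour i.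
      rank-consistent   : ∀ {i j P Q} → i ∈ T → j ∈ T →
                          Outermost 𝒞⁰ i P → Outermost 𝒞⁰ j Q →
                          P ⊂ Q → rank i ℕ.< rank j

  record State : Set where
    field
      𝒞      : Family
      T′     : Subset #T
      𝒜      : IntegralFamily
      Y Z    : Subset #E
      now    : ℕ
      -- metaAt t v is the meta-node of v after t iterations; only the values
      -- for t ≤ now are meaningful.
      metaAt : ℕ → Vertex → Subset #V

    M : Vertex → Subset #V
    M = metaAt now

  initial : Subset #T → Family → State
  initial T 𝒞⁰ = record
    { 𝒞 = 𝒞⁰ ; T′ = T ; 𝒜 = λ _ → nothing ; Y = ⊥ ; Z = ⊥
    ; now = 0 ; metaAt = λ _ v → ⁅ v ⁆ }

  mergeEdge : (Vertex → Subset #V) → Edge → Vertex → Subset #V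
  mergeEdge M e w = if does (w ∈? U) then U else M w
    where U = M (proj₁ (ends e)) ∪ M (proj₂ (ends e))

  -- The chain L₁ ⊆ ⋯ ⊆ L_l of cuts containing v.  Copies of the same vertex
  -- set are listed in the cut-inclusion order of their owners, as otherwise
  -- shrinking the first ones only would break the inclusion invariant.
  IsChain : (rank : Terminal → ℕ) → Family → Vertex → List Cut → Set
  IsChain rank 𝒞 v L =
    L ↭ containing v 𝒞 ×
    AllPairs (λ C D → side C ⊆ side D ×
                (side C ≡ side D → ¬ Dominates rank 𝒞 (owner D) (owner C))) L

  -- shrink N b L replaces C by C ∖ N for the cuts C of the initial part of L
  -- of total weight b, splitting the last of these cuts if need be.
  shrink : Subset #V → ℚ → List Cut → List Cut
  shrink N b []               = []
  shrink N b (cut j X w ∷ L) =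
    if does (b ℚ.≤? 0ℚ) then cut j X w ∷ L else
    if does (w ℚ.≤? b)  then cut j (X ─ N) w ∷ shrink N (b ℚ.- w) L else
    cut j (X ─ N) b ∷ cut j X (w ℚ.- b) ∷ L

  module _ (s : State) where
    open State s

    E : Terminal → Subset #E
    E i = Y ∩ δ (M (r i))

    -- u ∈ U_i
    U : Terminal → Vertex → Set
    U i u = u ∈ M (r i) ×
            ∃ λ e → e ∈ E i × (u ≡ proj₁ (ends e) ⊎ u ≡ proj₂ (ends e))

    -- u entered the meta-node of v in iteration t.
    EnteredIn : ℕ → Vertex → Vertex → Set
    EnteredIn t u v = t ℕ.≤ now × metaAt t u ≡ metaAt t v ×
                      (∀ {t′} → t′ ℕ.< t → metaAt t′ u ≢ metaAt t′ v)

    -- u = u_i, entering in iteration t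
    FirstEntered : Terminal → ℕ → Vertex → Set
    FirstEntered i t u =
      U i u × EnteredIn t u (r i) ×
      (∀ {u′ t′} → U i u′ → EnteredIn t′ u′ (r i) → t ℕ.≤ t′)

    data NewCut (i : Terminal) : Subset #V → Set where
      whole   : Empty (E i) → NewCut i (M (r i))
      earlier : ∀ {t u} → Nonempty (E i) → ¬ U i (r i) →
                FirstEntered i (suc t) u → NewCut i (metaAt t (r i))

    MaxDepth : Terminal → Set
    MaxDepth i = i ∈ T′ ×
      (∀ {j} → j ∈ T′ → depth 𝒞 (r j) ℚ.≤ depth 𝒞 (r i))

    Selectable : (rank : Terminal → ℕ) → Terminal → Set
    Selectable rank i =
      MaxDepth i × (∀ {j} → MaxDepth j → ¬ Dominates rank 𝒞 j i)

    update : Terminal → Subset #V → List Cut → State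
    update i A L = record
      { 𝒞 = 𝒞′ ; T′ = T′ - i ; 𝒜 = 𝒜′
      ; Y = (Y ∪ critical) ─ zeroLoad ; Z = Z ∪ zeroLoad
      ; now = suc now
      ; metaAt = λ t → if does (t ℕ.≤? now) then metaAt t else M′ }
      where
      𝒞′ : Family
      𝒞′ = filter (λ C → ¬? (owner C Fin.≟ i))
             (filter (λ C → ¬? (r i ∈? side C)) 𝒞 ++ shrink (M (r i)) 1ℚ L)

      𝒜′ : IntegralFamily
      𝒜′ = Functional.updateAt 𝒜 i λ _ → just A

      critical zeroLoad : Subset #E
      critical = tabulate λ e →
        does ((integralLoad 𝒜′ e ℕ.≟ cap e ℕ.+ 2) ×-dec (0ℚ ℚ.<? load 𝒞′ e))
      zeroLoad = tabulate λ e → does (load 𝒞′ e ℚ.≟ 0ℚ)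

      M′ : Vertex → Subset #V
      M′ = foldl mergeEdge M (filter (_∈? zeroLoad) (allFin #E))

  data Outcome : Set where
    error    : Outcome
    continue : State → Outcome

  -- One iteration; the choices left open are i and the order of L.
  data Iteration (rank : Terminal → ℕ) (s : State) : Outcome → Set where
    abort   : ∀ {i} → Selectable s rank i → Nonempty (E s i) → U s i (r i) →
              Iteration rank s error
    proceed : ∀ {i A L} → Selectable s rank i → NewCut s i A →
              IsChain rank (State.𝒞 s) (r i) L →
              Iteration rank s (continue (update s i A L))

  -- Total correctness: from s, whatever choices are made, the loop never gets
  -- stuck, never aborts, and terminates with an output satisfying P.
  data LoopProduces (rank : Terminal → ℕ) (P : IntegralFamily → Set)
                    (s : State) : Set where
    halt : Empty (State.T′ s) → P (State.𝒜 s) → LoopProduces rank P s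
    loop : (∃ λ o → Iteration rank s o) →
           (∀ {o} → Iteration rank s o →
              ∃ λ s′ → o ≡ continue s′ × LoopProduces rank P s′) →
           LoopProduces rank P s

  Round2Produces : Subset #T → Family → (IntegralFamily → Set) → Set
  Round2Produces T 𝒞 P =
    (∃₂ λ 𝒞⁰ rank → Preprocessed T 𝒞 𝒞⁰ rank) ×
    (∀ {𝒞⁰ rank} → Preprocessed T 𝒞 𝒞⁰ rank →
       LoopProduces rank P (initial T 𝒞⁰))

{-# OPTIONS --safe #-}

-- Fix an edge uv, and let x and y be the total weights of the current cuts that contain
-- u but not v, and v but not u.  When a terminal i in M(u) ≠ M(v) is processed, its
-- maximum depth gives y ≤ x, and there are two cases.  If x ≥ 1 then x drops by 1 and y
-- does not grow, so the integral and the fractional load do not grow in total.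
-- Otherwise the iteration turns the edge: x becomes 0 and y at most y + 1 − x ≤ 1.
-- Before the first turn the two loads sum to at most c; afterwards only turns, from
-- alternating ends, can load the edge while it still carries fractional load.
--
-- K¹ contains only cuts of i and of terminals that dominate i, and the innermost cut of
-- the chain belongs to i.  Hence from the second turn on each turning terminal dominates
-- the previous one, so it cannot have been in the meta-node of its end when that
-- meta-node was last processed: it would have been processed first.  An edge with load
-- c + 2 and positive fractional load has been turned three times, so no terminal left
-- resides at its ends (no abort), and from then on it is avoided until it lies inside a
-- meta-node.  There it can be loaded once more, by some i.  A second terminal j loading
-- it would face an edge of Y at a vertex a, with j and a in M(r i) when i was processed,
-- which was just excluded.
--
-- For the preprocessing the cuts are split into copies of equal weight.  Exchanging the
-- owners of two copies C ⊂ D if the one of D has the smaller outermost cut and lies in C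
-- terminates, and yields the inclusion invariant.
module Submission where

open import Defs
open import Data.Bool.Base using (true; false; _xor_; if_then_else_)
import Data.Bool.Properties as Bool
open import Data.Empty as Empty using (⊥-elim)
open import Data.Fin.Base using (Fin; zero; suc; toℕ; fromℕ<; combine)
import Data.Fin.Properties as Fin
open import Data.Fin.Subset
  using (Subset; ⁅_⁆; outside; _∈_; _∉_; _⊆_; _⊂_; _∪_; _─_; _-_; ⋃; ∁; ∣_∣; Nonempty; Empty)
open import Data.Fin.Subset.Properties
open import Data.Integer.Base as ℤ using (+_)
import Data.Integer.Properties as ℤ
open import Data.List.Base
  using (List; []; _∷_; _++_; map; filter; foldr; foldl; length; allFin; replicate)
open import Data.List.Membership.Propositional using (lose; find) renaming (_∈_ to _∈ˡ_)
open import Data.List.Membership.Propositional.Properties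
  using (∈-filter⁺; ∈-filter⁻; ∈-++⁺ˡ; ∈-++⁺ʳ; ∈-++⁻; ∈-map⁺; ∈-map⁻; ∈-allFin; ∈-∃++)
open import Data.List.Properties
  using (filter-++; filter-all; filter-none; filter-accept; filter-reject)
open import Data.List.Relation.Binary.Permutation.Propositional as ↭ using (_↭_)
open import Data.List.Relation.Binary.Permutation.Propositional.Properties
  using (filter-↭; map⁺; shift; ∈-resp-↭)
open import Data.List.Relation.Unary.All as All using ([]; _∷_)
open import Data.List.Relation.Unary.AllPairs using (AllPairs; []; _∷_)
open import Data.List.Relation.Unary.Any using (here; there; any?)
import Data.List.Relation.Unary.Linked.Properties as Linked
open import Data.List.Relation.Unary.Unique.Propositional using (Unique)
open import Data.List.Relation.Unary.Unique.Propositional.Properties using (allFin⁺)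
import Data.List.Sort as Sort
open import Data.Maybe.Base using (just; nothing)
open import Data.Maybe.Properties using (just-injective)
import Data.Maybe.Relation.Unary.Any as Maybe
open import Data.Nat.Base as ℕ using (ℕ; zero; suc; _+_)
import Data.Nat.Coprimality as Coprime
open import Data.Nat.ListAction using (sum)
open import Data.Nat.ListAction.Properties using (sum-↭)
import Data.Nat.Properties as ℕ
import Data.Nat.Solver as ℕ-Solver
open import Data.Product.Base using (∃; ∃₂; _×_; _,_; proj₁; proj₂)
open import Data.Product.Relation.Binary.Lex.NonStrict using (×-decTotalOrder)
open import Data.Rational.Base as ℚ using (ℚ; 0ℚ; 1ℚ)
import Data.Rational.Properties as ℚ
open import Data.Rational.Solver using (module +-*-Solver)
import Data.Rational.Unnormalised.Base as ℚᵘ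
open import Data.Sum.Base using (_⊎_; inj₁; inj₂; [_,_]′)
open import Data.Vec.Base using (lookup; tabulate; []; _∷_)
import Data.Vec.Functional as Functional
import Data.Vec.Functional.Properties as Functional
import Data.Vec.Properties as Vec
open import Function.Base using (_∘_; case_of_)
open import Function.Bundles using (Equivalence; mk⇔)
open import Function.Definitions using (Injective)
open import Relation.Binary.Bundles using (DecTotalOrder)
import Relation.Binary.Construct.On as On
open import Relation.Binary.Definitions using (DecidableEquality; tri<; tri≈; tri>)
open import Relation.Binary.PropositionalEquality
open import Relation.Nullary using (¬_; Dec; yes; no; does; contradiction; ¬?; _×-dec_)
open import Relation.Nullary.Decidable using (decidable-stable; dec-true; dec-false; _⊎-dec_)
open import Relation.Unary using (Decidable)

-- Weights and times

-- The first turn costs nothing because the budget is integral: as long as an edge is unturned, its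
-- capacity exceeds the integral load by at least a positive integer that bounds the fractional
-- load, so there is room for one more cut. The second and third turn may each add 1 beyond the
-- capacity, and the loading inside a meta-node another 1, which makes 3. Domination refers to the
-- current outermost cuts, and these shrink. It stays usable across iterations because, for
-- terminals whose cuts meet, it is always the order of the fixed ranks; `Ordered` records just
-- enough for this to persist. Terminals processed at different times can then be compared by
-- numbers. The state does not record which terminals shared a meta-node when it was processed, so
-- the invariant carries this history as a relation `B`.

_≡?_ : ∀ {n} (p q : Subset n) → Dec (p ≡ q)
_≡?_ = Vec.≡-dec Bool._≟_

opaque
  fromℕ : ℕ → ℚ
  fromℕ n = + n ℚ./ 1

  fromℕ≡ : ∀ n → fromℕ n ≡ + n ℚ./ 1
  fromℕ≡ n = refl

  fromℕ-suc : ∀ n → fromℕ (suc n) ≡ fromℕ n ℚ.+ 1ℚ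
  fromℕ-suc n = sym (trans
    (cong (ℚ._+ 1ℚ) (ℚ.normalize-coprime {n} {0} (Coprime.sym (Coprime.1-coprimeTo n))))
    (cong (ℚ._/ 1) (trans (cong (ℤ._+ ℤ.1ℤ) (ℤ.*-identityʳ (+ n))) (ℤ.+-comm (+ n) ℤ.1ℤ))))

x+[y+z]≡y+[x+z] : ∀ x y z → x ℚ.+ (y ℚ.+ z) ≡ y ℚ.+ (x ℚ.+ z)
x+[y+z]≡y+[x+z] = solve 3 (λ x y z → x :+ (y :+ z) := y :+ (x :+ z)) refl
  where open +-*-Solver

module Weighted {A : Set} (w : A → ℚ) where

  Σ : List A → ℚ
  Σ xs = foldr ℚ._+_ 0ℚ (map w xs)

  μ : {P : A → Set} → Decidable P → List A → ℚ
  μ P? xs = Σ (filter P? xs)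

  Σ-++ : ∀ xs ys → Σ (xs ++ ys) ≡ Σ xs ℚ.+ Σ ys
  Σ-++ []       ys = sym (ℚ.+-identityˡ _)
  Σ-++ (x ∷ xs) ys =
    trans (cong (w x ℚ.+_) (Σ-++ xs ys)) (sym (ℚ.+-assoc (w x) (Σ xs) (Σ ys)))

  Σ-↭ : ∀ {xs ys} → xs ↭ ys → Σ xs ≡ Σ ys
  Σ-↭ ↭.refl         = refl
  Σ-↭ (↭.prep x p)   = cong (w x ℚ.+_) (Σ-↭ p)
  Σ-↭ (↭.swap {xs} {ys} x y p) = trans
    (cong (λ s → w x ℚ.+ (w y ℚ.+ s)) (Σ-↭ p))
    (x+[y+z]≡y+[x+z] (w x) (w y) (Σ ys))
  Σ-↭ (↭.trans p q)  = trans (Σ-↭ p) (Σ-↭ q)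

  NonNeg Pos : List A → Set
  NonNeg xs = ∀ {x} → x ∈ˡ xs → 0ℚ ℚ.≤ w x
  Pos xs    = ∀ {x} → x ∈ˡ xs → 0ℚ ℚ.< w x

  Pos⇒NonNeg : ∀ {xs} → Pos xs → NonNeg xs
  Pos⇒NonNeg pos x∈ = ℚ.<⇒≤ (pos x∈)

  module _ {P : A → Set} (P? : Decidable P) where

    μ-++ : ∀ xs ys → μ P? (xs ++ ys) ≡ μ P? xs ℚ.+ μ P? ys
    μ-++ xs ys =
      trans (cong Σ (filter-++ P? xs ys)) (Σ-++ (filter P? xs) (filter P? ys))

    μ-∷ : ∀ {x y xs ys} → w x ≡ w y → (P x → P y) → (P y → P x) → μ P? xs ≡ μ P? ys →
          μ P? (x ∷ xs) ≡ μ P? (y ∷ ys)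
    μ-∷ {x} {y} eq f g rest with P? x | P? y
    ... | yes _ | yes _ = cong₂ ℚ._+_ eq rest
    ... | no _  | no _  = rest
    ... | yes p | no ¬q = contradiction (f p) ¬q
    ... | no ¬p | yes q = contradiction (g q) ¬p

    μ-↭ : ∀ {xs ys} → xs ↭ ys → μ P? xs ≡ μ P? ys
    μ-↭ p = Σ-↭ (filter-↭ P? p)

    μ-none : ∀ {xs} → (∀ {x} → x ∈ˡ xs → ¬ P x) → μ P? xs ≡ 0ℚ
    μ-none none = cong Σ (filter-none P? (All.tabulate none))

    μ-all : ∀ {xs} → (∀ {x} → x ∈ˡ xs → P x) → μ P? xs ≡ Σ xs
    μ-all all = cong Σ (filter-all P? (All.tabulate all))

    μ≥0 : ∀ xs → NonNeg xs → 0ℚ ℚ.≤ μ P? xs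
    μ≥0 []       nn = ℚ.≤-refl
    μ≥0 (x ∷ xs) nn with P? x
    ... | yes _ = ℚ.+-mono-≤ (nn (here refl)) (μ≥0 xs (nn ∘ there))
    ... | no  _ = μ≥0 xs (nn ∘ there)

    μ>0 : ∀ {x xs} → Pos xs → x ∈ˡ xs → P x → 0ℚ ℚ.< μ P? xs
    μ>0 {xs = y ∷ ys} pos x∈ px with P? y | x∈
    ... | yes _  | _ =
      ℚ.+-mono-<-≤ (pos (here refl)) (μ≥0 ys (Pos⇒NonNeg pos ∘ there))
    ... | no ¬py | here refl = contradiction px ¬py
    ... | no _   | there x∈′ = μ>0 (pos ∘ there) x∈′ px

  μ≤Σ : ∀ {P : A → Set} (P? : Decidable P) xs → NonNeg xs → μ P? xs ℚ.≤ Σ xs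
  μ≤Σ P? []       nn = ℚ.≤-refl
  μ≤Σ P? (x ∷ xs) nn with ih ← μ≤Σ P? xs (nn ∘ there) | P? x
  ... | yes _ = ℚ.+-monoʳ-≤ (w x) ih
  ... | no  _ = ℚ.≤-trans ih (subst (ℚ._≤ w x ℚ.+ Σ xs) (ℚ.+-identityˡ _)
    (ℚ.+-monoˡ-≤ (Σ xs) (nn (here refl))))

  μ<Σ : ∀ {P : A → Set} (P? : Decidable P) {x xs} → Pos xs → x ∈ˡ xs → ¬ P x →
        μ P? xs ℚ.< Σ xs
  μ<Σ P? {xs = y ∷ ys} pos x∈ ¬px with P? y | x∈
  ... | yes py | here refl = contradiction py ¬px
  ... | yes _  | there x∈′ = ℚ.+-monoʳ-< (w y) (μ<Σ P? (pos ∘ there) x∈′ ¬px)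
  ... | no _   | _         = ℚ.≤-<-trans (μ≤Σ P? ys (Pos⇒NonNeg pos ∘ there))
    (subst (ℚ._< w y ℚ.+ Σ ys) (ℚ.+-identityˡ _) (ℚ.+-monoˡ-< (Σ ys) (pos (here refl))))

  μ-map : ∀ {P : A → Set} (P? : Decidable P) (f : A → A) → (∀ x → w (f x) ≡ w x) →
          ∀ xs → μ P? (map f xs) ≡ μ (P? ∘ f) xs
  μ-map P? f same []       = refl
  μ-map P? f same (x ∷ xs) with P? (f x)
  ... | yes _ = cong₂ ℚ._+_ (same x) (μ-map P? f same xs)
  ... | no  _ = μ-map P? f same xs

  μ-mono : ∀ {P Q : A → Set} (P? : Decidable P) (Q? : Decidable Q) xs → NonNeg xs →
           (∀ {x} → x ∈ˡ xs → P x → Q x) → μ P? xs ℚ.≤ μ Q? xs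
  μ-mono P? Q? []       nn imp = ℚ.≤-refl
  μ-mono P? Q? (x ∷ xs) nn imp with P? x | Q? x
  ... | yes _ | yes _ = ℚ.+-monoʳ-≤ (w x) (μ-mono P? Q? xs (nn ∘ there) (imp ∘ there))
  ... | yes p | no ¬q = contradiction (imp (here refl) p) ¬q
  ... | no _  | yes _ = ℚ.≤-trans (μ-mono P? Q? xs (nn ∘ there) (imp ∘ there))
    (subst (ℚ._≤ w x ℚ.+ μ Q? xs) (ℚ.+-identityˡ _)
      (ℚ.+-monoˡ-≤ (μ Q? xs) (nn (here refl))))
  ... | no _  | no _  = μ-mono P? Q? xs (nn ∘ there) (imp ∘ there)

  μ-⊎ : ∀ {P Q R : A → Set}
        (P? : Decidable P) (Q? : Decidable Q) (R? : Decidable R) xs →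
        (∀ {x} → x ∈ˡ xs → R x → P x ⊎ Q x) →
        (∀ {x} → x ∈ˡ xs → P x → R x) → (∀ {x} → x ∈ˡ xs → Q x → R x) →
        (∀ {x} → P x → ¬ Q x) → μ R? xs ≡ μ P? xs ℚ.+ μ Q? xs
  μ-⊎ P? Q? R? []       f g h d = refl
  μ-⊎ P? Q? R? (x ∷ xs) f g h d
    with ih ← μ-⊎ P? Q? R? xs (f ∘ there) (g ∘ there) (h ∘ there) d
       | P? x | Q? x | R? x
  ... | yes p | yes q | _     = contradiction q (d p)
  ... | yes p | no _  | no ¬r = contradiction (g (here refl) p) ¬r
  ... | no _  | yes q | no ¬r = contradiction (h (here refl) q) ¬r
  ... | no _  | no _  | no _  = ih
  ... | yes _ | no _  | yes _ =
    trans (cong (w x ℚ.+_) ih) (sym (ℚ.+-assoc (w x) (μ P? xs) (μ Q? xs)))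
  ... | no _  | yes _ | yes _ = trans (cong (w x ℚ.+_) ih)
    (x+[y+z]≡y+[x+z] (w x) (μ P? xs) (μ Q? xs))
  ... | no ¬p | no ¬q | yes r with f (here refl) r
  ...   | inj₁ p = contradiction p ¬p
  ...   | inj₂ q = contradiction q ¬q

  μ-cong : ∀ {P Q : A → Set} (P? : Decidable P) (Q? : Decidable Q) xs →
           (∀ {x} → x ∈ˡ xs → P x → Q x) → (∀ {x} → x ∈ˡ xs → Q x → P x) →
           μ P? xs ≡ μ Q? xs
  μ-cong P? Q? []       f g = refl
  μ-cong P? Q? (x ∷ xs) f g
    with ih ← μ-cong P? Q? xs (f ∘ there) (g ∘ there) | P? x | Q? x
  ... | yes _ | yes _ = cong (w x ℚ.+_) ih
  ... | no _  | no _  = ih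
  ... | yes p | no ¬q = contradiction (f (here refl) p) ¬q
  ... | no ¬p | yes q = contradiction (g (here refl) q) ¬p

  μ-filter-≤ : ∀ {P Q : A → Set} (P? : Decidable P) (Q? : Decidable Q) xs →
               NonNeg xs → μ P? (filter Q? xs) ℚ.≤ μ P? xs
  μ-filter-≤ P? Q? []       nn = ℚ.≤-refl
  μ-filter-≤ P? Q? (x ∷ xs) nn with ih ← μ-filter-≤ P? Q? xs (nn ∘ there) | Q? x
  ... | yes _ with P? x
  ...   | yes _ = ℚ.+-monoʳ-≤ (w x) ih
  ...   | no  _ = ih
  μ-filter-≤ P? Q? (x ∷ xs) nn | no _ with P? x
  ...   | no  _ = ih
  ...   | yes _ = ℚ.≤-trans ih (subst (ℚ._≤ w x ℚ.+ μ P? xs) (ℚ.+-identityˡ _)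
      (ℚ.+-monoˡ-≤ (μ P? xs) (nn (here refl))))

  μ-filter-superset : ∀ {P Q : A → Set} (P? : Decidable P) (Q? : Decidable Q) xs →
                      (∀ {x} → x ∈ˡ xs → P x → Q x) → μ P? (filter Q? xs) ≡ μ P? xs
  μ-filter-superset P? Q? []       f = refl
  μ-filter-superset P? Q? (x ∷ xs) f with ih ← μ-filter-superset P? Q? xs (f ∘ there) | Q? x
  ... | yes q with P? x
  ...   | yes _ = cong (w x ℚ.+_) ih
  ...   | no  _ = ih
  μ-filter-superset P? Q? (x ∷ xs) f | no ¬q with P? x
  ...   | yes p = contradiction (f (here refl) p) ¬q
  ...   | no  _ = ih

  μ-partition : ∀ {P Q : A → Set} (P? : Decidable P) (Q? : Decidable Q) xs →
                μ P? xs ≡ μ P? (filter (¬? ∘ Q?) xs) ℚ.+ μ P? (filter Q? xs)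
  μ-partition P? Q? []       = refl
  μ-partition P? Q? (x ∷ xs) with ih ← μ-partition P? Q? xs | Q? x
  ... | yes q with P? x
  ...   | no  _ = ih
  ...   | yes p = trans (cong (w x ℚ.+_) ih)
    (x+[y+z]≡y+[x+z] (w x) (μ P? (filter (¬? ∘ Q?) xs)) (μ P? (filter Q? xs)))
  μ-partition P? Q? (x ∷ xs) | no ¬q with P? x
  ...   | no  _ = ih
  ...   | yes p = trans (cong (w x ℚ.+_) ih) (sym (ℚ.+-assoc (w x) _ _))

  module _ {K : Set} (_≟_ : DecidableEquality K) (key : A → K) where
    private
      at? : ∀ k → Decidable (λ x → key x ≡ k)
      at? k x = key x ≟ k

      drop : K → List A → List A
      drop k = filter (¬? ∘ at? k)

    -- Induction on a list of keys covering both lists: the fibre over the first key contributes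
    -- equally on both sides, and dropping it leaves the other fibres as they were. With vertex sets
    -- as keys this turns `reassigned` into equality of loads.
    μ-fibres : ∀ {xs ys} → (∀ k → μ (at? k) xs ≡ μ (at? k) ys) →
               ∀ {Q : K → Set} (Q? : Decidable Q) → μ (Q? ∘ key) xs ≡ μ (Q? ∘ key) ys
    μ-fibres {xs} {ys} fibres {Q} Q? =
      go (map key xs ++ map key ys) xs ys (∈-++⁺ˡ ∘ ∈-map⁺ key) (∈-++⁺ʳ _ ∘ ∈-map⁺ key) fibres
      where
      split : ∀ k zs zs′ → μ (at? k) zs ≡ μ (at? k) zs′ →
              μ (Q? ∘ key) (filter (at? k) zs) ≡ μ (Q? ∘ key) (filter (at? k) zs′)
      split k zs zs′ eq with Q? k
      ... | yes q = trans (all zs) (trans eq (sym (all zs′)))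
        where
        all : ∀ zs → μ (Q? ∘ key) (filter (at? k) zs) ≡ μ (at? k) zs
        all zs = μ-all (Q? ∘ key) λ x∈ → subst Q (sym (proj₂ (∈-filter⁻ (at? k) {xs = zs} x∈))) q
      ... | no ¬q = trans (none zs) (sym (none zs′))
        where
        none : ∀ zs → μ (Q? ∘ key) (filter (at? k) zs) ≡ 0ℚ
        none zs = μ-none (Q? ∘ key)
          λ x∈ qx → ¬q (subst Q (proj₂ (∈-filter⁻ (at? k) {xs = zs} x∈)) qx)

      drop-fibre : ∀ k k′ zs zs′ → μ (at? k′) zs ≡ μ (at? k′) zs′ →
                   μ (at? k′) (drop k zs) ≡ μ (at? k′) (drop k zs′)
      drop-fibre k k′ zs zs′ eq with k′ ≟ k
      ... | yes refl = trans (none zs) (sym (none zs′))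
        where
        none : ∀ zs → μ (at? k) (drop k zs) ≡ 0ℚ
        none zs = μ-none (at? k) λ x∈ → proj₂ (∈-filter⁻ (¬? ∘ at? k) {xs = zs} x∈)
      ... | no k′≢k = trans (keep zs) (trans eq (sym (keep zs′)))
        where
        keep : ∀ zs → μ (at? k′) (drop k zs) ≡ μ (at? k′) zs
        keep zs = μ-filter-superset (at? k′) (¬? ∘ at? k) zs
          λ _ eq eq′ → k′≢k (trans (sym eq) eq′)

      go : ∀ ks xs ys → (∀ {x} → x ∈ˡ xs → key x ∈ˡ ks) → (∀ {y} → y ∈ˡ ys → key y ∈ˡ ks) →
           (∀ k → μ (at? k) xs ≡ μ (at? k) ys) → μ (Q? ∘ key) xs ≡ μ (Q? ∘ key) ys
      go [] xs ys xs⊆ ys⊆ fibres = trans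
        (μ-none (Q? ∘ key) λ x∈ _ → case (xs⊆ x∈) of λ ())
        (sym (μ-none (Q? ∘ key) λ y∈ _ → case (ys⊆ y∈) of λ ()))
      go (k ∷ ks) xs ys xs⊆ ys⊆ fibres = trans (μ-partition (Q? ∘ key) (at? k) xs) (trans
        (cong₂ ℚ._+_
          (go ks (drop k xs) (drop k ys) (rest xs xs⊆) (rest ys ys⊆)
            (λ k′ → drop-fibre k k′ xs ys (fibres k′)))
          (split k xs ys (fibres k)))
        (sym (μ-partition (Q? ∘ key) (at? k) ys)))
        where
        rest : ∀ zs → (∀ {z} → z ∈ˡ zs → key z ∈ˡ k ∷ ks) → ∀ {z} → z ∈ˡ drop k zs → key z ∈ˡ ks
        rest zs sub z∈ with z∈zs , z≢k ← ∈-filter⁻ (¬? ∘ at? k) {xs = zs} z∈ | sub z∈zs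
        ... | here eq   = contradiction eq z≢k
        ... | there k∈  = k∈

-- Laminar families

x∈p─q⁻ : ∀ {n} {x : Fin n} p q → x ∈ p ─ q → x ∈ p × x ∉ q
x∈p─q⁻ p q x∈ = p─q⊆p p q x∈ , go p q x∈
  where
  go : ∀ {n} {x : Fin n} (p q : Subset n) → x ∈ p ─ q → x ∉ q
  go {x = zero}  (true ∷ p)  (true ∷ q)  () _
  go {x = zero}  (false ∷ p) (true ∷ q)  () _
  go {x = zero}  (_ ∷ p)     (false ∷ q) _ ()
  go {x = suc x} (_ ∷ p)     (_ ∷ q)     x∈p─q x∈q =
    go p q (drop-there x∈p─q) (drop-there x∈q)

x∉p⇒lookup≡outside : ∀ {n} {x : Fin n} {p} → x ∉ p → lookup p x ≡ outside
x∉p⇒lookup≡outside {x = x} {p} x∉p with lookup p x in eq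
... | true  = contradiction (Vec.lookup⇒[]= x p eq) x∉p
... | false = refl

⊈⇒witness : ∀ {n} (p q : Subset n) → ¬ p ⊆ q → ∃ λ x → x ∈ p × x ∉ q
⊈⇒witness p q p⊈q with nonempty? (p ─ q)
... | yes (x , x∈) = x , x∈p─q⁻ p q x∈
... | no  empty    = ⊥-elim (p⊈q sub)
  where
  sub : p ⊆ q
  sub {x} x∈p = decidable-stable (x ∈? q) λ x∉q → empty (x , x∈p∧x∉q⇒x∈p─q x∈p x∉q)

⊆⇒⊂⊎≡ : ∀ {n} {p q : Subset n} → p ⊆ q → p ⊂ q ⊎ p ≡ q
⊆⇒⊂⊎≡ {p = p} {q} p⊆q with q ⊆? p
... | yes q⊆p = inj₂ (⊆-antisym p⊆q q⊆p)
... | no  q⊈p = inj₁ (p⊆q , ⊈⇒witness q p q⊈p)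

⊆-or-⊂ : ∀ {n} {p q : Subset n} → p ⊆ q ⊎ q ⊆ p → p ⊆ q ⊎ q ⊂ p
⊆-or-⊂ (inj₁ p⊆q) = inj₁ p⊆q
⊆-or-⊂ (inj₂ q⊆p) with ⊆⇒⊂⊎≡ q⊆p
... | inj₁ q⊂p = inj₂ q⊂p
... | inj₂ refl = inj₁ q⊆p

∈-⋃⁺ : ∀ {n x} {p : Subset n} {ps} → p ∈ˡ ps → x ∈ p → x ∈ ⋃ ps
∈-⋃⁺ {ps = q ∷ qs} (here refl) x∈ = p⊆p∪q (⋃ qs) x∈
∈-⋃⁺ {ps = q ∷ qs} (there p∈)  x∈ = q⊆p∪q q (⋃ qs) (∈-⋃⁺ p∈ x∈)

∈-⋃⁻ : ∀ {n x} (ps : List (Subset n)) → x ∈ ⋃ ps → ∃ λ p → p ∈ˡ ps × x ∈ p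
∈-⋃⁻ []       x∈ = contradiction x∈ ∉⊥
∈-⋃⁻ (q ∷ qs) x∈ with x∈p∪q⁻ q (⋃ qs) x∈
... | inj₁ x∈q = q , here refl , x∈q
... | inj₂ x∈⋃ with ∈-⋃⁻ qs x∈⋃
...   | p , p∈ , x∈p = p , there p∈ , x∈p

-- `R` need only be total on the list, since cuts are comparable only when they share a vertex.
-- Reversed relations yield outermost cuts and deepest terminals.
least : ∀ {A : Set} {R : A → A → Set} → (∀ {x y z} → R x y → R y z → R x z) →
        (∀ {x} → R x x) → ∀ {x} xs → x ∈ˡ xs →
        (∀ {y z} → y ∈ˡ xs → z ∈ˡ xs → R y z ⊎ R z y) →
        ∃ λ m → m ∈ˡ xs × (∀ {y} → y ∈ˡ xs → R m y)
least tr rf (x ∷ [])     _ total = x , here refl , λ { (here refl) → rf }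
least tr rf (x ∷ y ∷ ys) _ total
  with m , m∈ , min ← least tr rf (y ∷ ys) (here refl) (λ p q → total (there p) (there q))
  with total (here refl) (there m∈)
... | inj₁ Rxm = x , here refl , λ { (here refl) → rf ; (there p) → tr Rxm (min p) }
... | inj₂ Rmx = m , there m∈ , λ { (here refl) → Rmx ; (there p) → min p }

module _ (G : MCP) where
  open MCP G
  open Weighted (weight {G})

  separates⁻ : ∀ X e → let (u , v) = ends e in
               e ∈ δ G X → (u ∈ X × v ∉ X) ⊎ (v ∈ X × u ∉ X)
  separates⁻ X e e∈
    with proj₁ (ends e) ∈? X | proj₂ (ends e) ∈? X
       | trans (sym (Vec.lookup∘tabulate _ e)) (Vec.[]=⇒lookup e∈)
  ... | yes u∈ | no v∉  | _ = inj₁ (u∈ , v∉)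
  ... | no u∉  | yes v∈ | _ = inj₂ (v∈ , u∉)
  ... | yes u∈ | yes v∈ | p rewrite Vec.[]=⇒lookup u∈ | Vec.[]=⇒lookup v∈ with () ← p
  ... | no u∉  | no v∉  | p
    rewrite x∉p⇒lookup≡outside u∉ | x∉p⇒lookup≡outside v∉ with () ← p

  separates⁺ : ∀ X e → let (u , v) = ends e in
               (u ∈ X × v ∉ X) ⊎ (v ∈ X × u ∉ X) → e ∈ δ G X
  separates⁺ X e (inj₁ (u∈ , v∉)) = Vec.lookup⇒[]= e (δ G X) (trans
    (Vec.lookup∘tabulate _ e)
    (cong₂ _xor_ (Vec.[]=⇒lookup u∈) (x∉p⇒lookup≡outside v∉)))
  separates⁺ X e (inj₂ (v∈ , u∉)) = Vec.lookup⇒[]= e (δ G X) (trans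
    (Vec.lookup∘tabulate _ e)
    (cong₂ _xor_ (x∉p⇒lookup≡outside u∉) (Vec.[]=⇒lookup v∈)))

  owned? : ∀ i → Decidable (λ (C : Cut G) → owner C ≡ i)
  owned? i C = owner C Fin.≟ i

  module Laminar {T : Subset #T} {𝒞 : Family G} (fl : IsFractionalLaminar G T 𝒞) where
    open IsFractionalLaminar fl

    nested : ∀ {C D v} → C ∈ˡ 𝒞 → D ∈ˡ 𝒞 → v ∈ side C → v ∈ side D →
             side C ⊆ side D ⊎ side D ⊆ side C
    nested {C} {D} {v} C∈ D∈ v∈C v∈D with side C ⊆? side D | side D ⊆? side C
    ... | yes C⊆D | _       = inj₁ C⊆D
    ... | no  _   | yes D⊆C = inj₂ D⊆C
    ... | no  C⊈D | no  D⊈C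
      with x , x∈C , x∉D ← ⊈⇒witness (side C) (side D) C⊈D
         | y , y∈D , y∉C ← ⊈⇒witness (side D) (side C) D⊈C =
      ⊥-elim (laminar C∈ D∈ ( (v , x∈p∩q⁺ (v∈C , v∈D))
                            , (x , x∈p∧x∉q⇒x∈p─q x∈C x∉D)
                            , (y , x∈p∧x∉q⇒x∈p─q y∈D y∉C)))

    hasCut : ∀ {i} → i ∈ T → ∃ λ C → C ∈ˡ 𝒞 × owner C ≡ i
    hasCut {i} i∈T with ownedBy G i 𝒞 in eq | weightSum i∈T
    -- No cut at all would make the weight 0 instead of 1.
    ... | []     | ()
    ... | C ∷ Cs | _ = C , ∈-filter⁻ (owned? i) (subst (C ∈ˡ_) (sym eq) (here refl))

    outermost : ∀ {i} → i ∈ T → ∃ λ P → P ∈ˡ 𝒞 × owner P ≡ i ×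
                  (∀ {C} → C ∈ˡ 𝒞 → owner C ≡ i → side C ⊆ side P)
    outermost {i} i∈T
      with C , C∈ , refl ← hasCut i∈T
      with P , P∈ , max ← least {R = λ C D → side D ⊆ side C} (λ p q x → p (q x)) (λ x → x)
             (ownedBy G i 𝒞) (∈-filter⁺ (owned? i) C∈ refl)
             (λ p q → let C∈ , Ci = ∈-filter⁻ (owned? i) p ; D∈ , Di = ∈-filter⁻ (owned? i) q
                      in nested D∈ C∈ (subst (λ j → r j ∈ _) Di (r∈side D∈))
                                      (subst (λ j → r j ∈ _) Ci (r∈side C∈)))
      with P∈𝒞 , Pi ← ∈-filter⁻ (owned? i) P∈ =
      P , P∈𝒞 , Pi , λ C∈ Ci → max (∈-filter⁺ (owned? i) C∈ Ci)

    outermost⇒Outermost : ∀ {i P} → P ∈ˡ 𝒞 → owner P ≡ i →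
      (∀ {C} → C ∈ˡ 𝒞 → owner C ≡ i → side C ⊆ side P) → Outermost G 𝒞 i (side P)
    outermost⇒Outermost {i} {P} P∈ Pi max =
      (P , ∈-filter⁺ (owned? i) P∈ Pi , refl) ,
      λ C∈ → let C∈𝒞 , Ci = ∈-filter⁻ (owned? i) C∈ in max C∈𝒞 Ci

  Outermost-cut : ∀ {𝒞 i P} → Outermost G 𝒞 i P →
                  ∃ λ C → C ∈ˡ 𝒞 × owner C ≡ i × side C ≡ P
  Outermost-cut {i = i} ((C , C∈ , eq) , _) =
    let C∈𝒞 , Ci = ∈-filter⁻ (owned? i) C∈ in C , C∈𝒞 , Ci , eq

  Outermost-⊆ : ∀ {𝒞 i P C} → Outermost G 𝒞 i P → C ∈ˡ 𝒞 → owner C ≡ i → side C ⊆ P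
  Outermost-⊆ {i = i} (_ , max) C∈ Ci = max (∈-filter⁺ (owned? i) C∈ Ci)

  -- The content of the inclusion invariant that survives an iteration: with the
  -- tie-breaking in place, domination is just the order of the ranks.
  record Ordered (rank : Terminal G → ℕ) (T : Subset #T) (𝒞 : Family G) : Set where
    field
      fractionalLaminar : IsFractionalLaminar G T 𝒞
      weight>0          : Pos 𝒞
      inclusion         : ∀ {C D} → C ∈ˡ 𝒞 → D ∈ˡ 𝒞 → rank (owner C) ℕ.< rank (owner D) →
                          r (owner C) ∈ side D → r (owner D) ∈ side C → side C ⊆ side D
      extends           : ∀ {C D v} → C ∈ˡ 𝒞 → D ∈ˡ 𝒞 → rank (owner C) ℕ.< rank (owner D) →
                          v ∈ side C → v ∈ side D →
                          ∃ λ D′ → D′ ∈ˡ 𝒞 × owner D′ ≡ owner D × side C ⊆ side D′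

    open IsFractionalLaminar fractionalLaminar public
    open Laminar fractionalLaminar public

    -- Applied to the outermost cut of `owner C`, `extends` places it inside the outermost cut of
    -- `owner D`; if the two are equal, the rank settles the tie.
    rank<⇒dominates : ∀ {C D v} → C ∈ˡ 𝒞 → D ∈ˡ 𝒞 → rank (owner C) ℕ.< rank (owner D) →
                      v ∈ side C → v ∈ side D → Dominates G rank 𝒞 (owner C) (owner D)
    rank<⇒dominates {C} {D} {v} C∈ D∈ C<D v∈C v∈D
      with P , P∈ , Pi , maxP ← outermost (owner∈T C∈)
         | Q , Q∈ , Qj , maxQ ← outermost (owner∈T D∈)
      with D′ , D′∈ , D′j , P⊆D′ ← extends P∈ Q∈
             (subst₂ (λ i j → rank i ℕ.< rank j) (sym Pi) (sym Qj) C<D)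
             (maxP C∈ refl v∈C) (maxQ D∈ refl v∈D)
      with ⊆⇒⊂⊎≡ {p = side P} {side Q} (λ x∈ → maxQ D′∈ (trans D′j Qj) (P⊆D′ x∈))
    ... | P⊂Q⊎P≡Q = side P , side Q , outermost⇒Outermost P∈ Pi maxP ,
                    outermost⇒Outermost Q∈ Qj maxQ , tie P⊂Q⊎P≡Q
      where
      tie : side P ⊂ side Q ⊎ side P ≡ side Q →
            side P ⊂ side Q ⊎ (side P ≡ side Q × rank (owner C) ℕ.< rank (owner D))
      tie (inj₁ P⊂Q) = inj₁ P⊂Q
      tie (inj₂ P≡Q) = inj₂ (P≡Q , C<D)

    -- With the ranks the other way round, `extends` would put `Q` inside `P`, against `P ⊂ Q`.
    dominates⇒rank< : Injective _≡_ _≡_ rank → ∀ {i j} → Dominates G rank 𝒞 i j →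
                      rank i ℕ.< rank j
    dominates⇒rank< inj (P , Q , oP , oQ , inj₂ (_ , i<j)) = i<j
    dominates⇒rank< inj {i} {j} (P , Q , oP , oQ , inj₁ (P⊆Q , x , x∈Q , x∉P))
      with C , C∈ , refl , refl ← Outermost-cut oP
         | D , D∈ , refl , refl ← Outermost-cut oQ
      with ℕ.<-cmp (rank (owner C)) (rank (owner D))
    ... | tri< i<j _ _ = i<j
    ... | tri≈ _ i≡j _ = contradiction (Outermost-⊆ oP D∈ (sym (inj i≡j)) x∈Q) x∉P
    ... | tri> _ _ j<i
      with C′ , C′∈ , C′i , Q⊆C′ ← extends D∈ C∈ j<i (P⊆Q (r∈side C∈)) (r∈side C∈) =
      contradiction (Outermost-⊆ oP C′∈ C′i (Q⊆C′ x∈Q)) x∉P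

-- Shrinking the innermost cuts

<⇒≱ : ∀ {p q} → p ℚ.< q → ¬ q ℚ.≤ p
<⇒≱ p<q q≤p = ℚ.<-irrefl refl (ℚ.<-≤-trans p<q q≤p)

0<1 : 0ℚ ℚ.< 1ℚ
0<1 = ℚ.positive⁻¹ 1ℚ

+-cancel-sub : ∀ b w → w ℚ.+ (b ℚ.- w) ≡ b
+-cancel-sub = solve 2 (λ b w → w :+ (b :- w) := b) refl
  where open +-*-Solver

p≤q⇒0≤q-p : ∀ {p q} → p ℚ.≤ q → 0ℚ ℚ.≤ q ℚ.- p
p≤q⇒0≤q-p {p} {q} p≤q = subst (ℚ._≤ q ℚ.- p) (ℚ.+-inverseʳ p) (ℚ.+-monoˡ-≤ (ℚ.- p) p≤q)

p<q⇒0<q-p : ∀ {p q} → p ℚ.< q → 0ℚ ℚ.< q ℚ.- p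
p<q⇒0<q-p {p} {q} p<q = subst (ℚ._< q ℚ.- p) (ℚ.+-inverseʳ p) (ℚ.+-monoˡ-< (ℚ.- p) p<q)

p≤q+r⇒p-q≤r : ∀ {p q r} → p ℚ.≤ q ℚ.+ r → p ℚ.- q ℚ.≤ r
p≤q+r⇒p-q≤r {p} {q} {r} p≤ = subst (p ℚ.- q ℚ.≤_)
  (solve 2 (λ q r → (q :+ r) :- q := r) refl q r) (ℚ.+-monoˡ-≤ (ℚ.- q) p≤)
  where open +-*-Solver

+-cancelʳ-≤ : ∀ r {p q} → p ℚ.+ r ℚ.≤ q ℚ.+ r → p ℚ.≤ q
+-cancelʳ-≤ r {p} {q} p+r≤q+r = subst₂ ℚ._≤_ (cancel p r) (cancel q r) (ℚ.+-monoˡ-≤ (ℚ.- r) p+r≤q+r)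
  where
  open +-*-Solver
  cancel = solve 2 (λ p r → (p :+ r) :- r := p) refl

module _ (G : MCP) where
  open MCP G
  open Weighted (weight {G})

  Same : Cut G → Cut G → Set
  Same C D = owner C ≡ owner D × side C ≡ side D

  shave : Subset #V → Cut G → Cut G
  shave N (cut j X w) = cut j (X ─ N) w

  -- `H` is K¹ before shaving and `R` the rest of the chain; a cut that is split has a copy in each.
  -- Splitting preserves owner and side but not weight, so `μ-split` and `precede` speak of owner
  -- and side only, and `precede` makes an exception for the two copies of the split cut.
  record Shrunk (N : Subset #V) (b : ℚ) (L : Family G) : Set₁ where
    field
      H R     : Family G
      shrink≡ : shrink G N b L ≡ map (shave N) H ++ R
      ΣH      : Σ H ≡ b
      μ-split : ∀ {Q : Terminal G → Subset #V → Set} (Q? : ∀ j X → Dec (Q j X)) →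
                let Q?′ = λ C → Q? (owner C) (side C) in μ Q?′ L ≡ μ Q?′ H ℚ.+ μ Q?′ R
      H-copy  : ∀ {C} → C ∈ˡ H → ∃ λ D → D ∈ˡ L × Same C D
      R-copy  : ∀ {C} → C ∈ˡ R → ∃ λ D → D ∈ˡ L × Same C D
      copied  : ∀ {D} → D ∈ˡ L → (∃ λ C → C ∈ˡ H × Same C D) ⊎ (∃ λ C → C ∈ˡ R × Same C D)
      H-pos   : Pos H
      R-pos   : Pos R
      precede : ∀ {_≺_ : Terminal G × Subset #V → Terminal G × Subset #V → Set} →
                AllPairs (λ C D → (owner C , side C) ≺ (owner D , side D)) L →
                ∀ {C D} → C ∈ˡ H → D ∈ˡ R →
                Same C D ⊎ (owner C , side C) ≺ (owner D , side D)
      head∈H  : ∀ {D L′} → 0ℚ ℚ.< b → L ≡ D ∷ L′ → ∃ λ C → C ∈ˡ H × Same C D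

  private
    if-true : ∀ {P A : Set} (P? : Dec P) → P → {x y : A} → (if does P? then x else y) ≡ x
    if-true P? p {x} {y} = cong (λ t → if t then x else y) (dec-true P? p)

    if-false : ∀ {P A : Set} (P? : Dec P) → ¬ P → {x y : A} → (if does P? then x else y) ≡ y
    if-false P? ¬p {x} {y} = cong (λ t → if t then x else y) (dec-false P? ¬p)

    shrink-none : ∀ N b C L → b ℚ.≤ 0ℚ → shrink G N b (C ∷ L) ≡ C ∷ L
    shrink-none N b (cut j X w) L b≤0 = if-true (b ℚ.≤? 0ℚ) b≤0

    shrink-all : ∀ N b j X w L → ¬ b ℚ.≤ 0ℚ → w ℚ.≤ b →
                 shrink G N b (cut j X w ∷ L) ≡ cut j (X ─ N) w ∷ shrink G N (b ℚ.- w) L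
    shrink-all N b j X w L b≰0 w≤b =
      trans (if-false (b ℚ.≤? 0ℚ) b≰0) (if-true (w ℚ.≤? b) w≤b)

    shrink-part : ∀ N b j X w L → ¬ b ℚ.≤ 0ℚ → ¬ w ℚ.≤ b →
                  shrink G N b (cut j X w ∷ L) ≡ cut j (X ─ N) b ∷ cut j X (w ℚ.- b) ∷ L
    shrink-part N b j X w L b≰0 w≰b =
      trans (if-false (b ℚ.≤? 0ℚ) b≰0) (if-false (w ℚ.≤? b) w≰b)

  shrunk-whole : ∀ N b C L → Pos (C ∷ L) → ¬ b ℚ.≤ 0ℚ → weight C ℚ.≤ b →
                 Shrunk N (b ℚ.- weight C) L → Shrunk N b (C ∷ L)
  shrunk-whole N b C@(cut j X w) L pos b≰0 w≤b rest = record
    { H = C ∷ H ; R = R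
    ; shrink≡ = trans (shrink-all N b j X w L b≰0 w≤b) (cong (cut j (X ─ N) w ∷_) shrink≡)
    ; ΣH = trans (cong (w ℚ.+_) ΣH) (+-cancel-sub b w)
    ; μ-split = split
    ; H-copy = λ { (here refl) → C , here refl , refl , refl
                 ; (there p) → let D , D∈ , same = H-copy p in D , there D∈ , same }
    ; R-copy = λ p → let D , D∈ , same = R-copy p in D , there D∈ , same
    ; copied = λ { (here refl) → inj₁ (C , here refl , refl , refl)
                 ; {D} (there p) → later {D} (copied p) }
    ; H-pos = λ { (here refl) → pos (here refl) ; (there p) → H-pos p }
    ; R-pos = R-pos
    ; precede = λ {_≺_} → precede′ {_≺_}
    ; head∈H = λ { _ refl → C , here refl , refl , refl } }
    where
    open Shrunk rest
    precede′ : ∀ {_≺_ : Terminal G × Subset #V → Terminal G × Subset #V → Set} →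
               AllPairs (λ C D → (owner C , side C) ≺ (owner D , side D)) (C ∷ L) →
               ∀ {D E} → D ∈ˡ C ∷ H → E ∈ˡ R →
               Same D E ⊎ (owner D , side D) ≺ (owner E , side E)
    precede′ {_≺_} (C≺ ∷ _) (here refl) q with D , D∈ , refl , refl ← R-copy q =
      inj₂ (All.lookup C≺ D∈)
    precede′ {_≺_} (_ ∷ chain) (there p) q = precede {_≺_} chain p q
    later : ∀ {D} → (∃ λ C → C ∈ˡ H × Same C D) ⊎ (∃ λ C → C ∈ˡ R × Same C D) →
            (∃ λ C′ → C′ ∈ˡ C ∷ H × Same C′ D) ⊎ (∃ λ C′ → C′ ∈ˡ R × Same C′ D)
    later (inj₁ (C′ , C′∈ , same)) = inj₁ (C′ , there C′∈ , same)
    later (inj₂ copy)              = inj₂ copy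
    split : ∀ {Q : Terminal G → Subset #V → Set} (Q? : ∀ j X → Dec (Q j X)) →
            let Q?′ = λ C → Q? (owner C) (side C) in
            μ Q?′ (C ∷ L) ≡ μ Q?′ (C ∷ H) ℚ.+ μ Q?′ R
    split Q? with Q? j X
    ... | yes _ = trans (cong (w ℚ.+_) (μ-split Q?)) (sym (ℚ.+-assoc w _ _))
    ... | no  _ = μ-split Q?

  -- The bound `b ≤ Σ L` makes `H` weigh exactly `b`: if the list runs out, the remaining budget
  -- lies between 0 and an empty sum.
  shrunk : ∀ N b L → 0ℚ ℚ.≤ b → b ℚ.≤ Σ L → Pos L → Shrunk N b L
  shrunk-∷ : ∀ N b C L → 0ℚ ℚ.≤ b → b ℚ.≤ Σ (C ∷ L) → Pos (C ∷ L) →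
             Dec (b ℚ.≤ 0ℚ) → Dec (weight C ℚ.≤ b) → Shrunk N b (C ∷ L)

  shrunk N b [] 0≤b b≤0 pos = record
    { H = [] ; R = [] ; shrink≡ = refl ; ΣH = ℚ.≤-antisym 0≤b b≤0
    ; μ-split = λ _ → refl ; H-copy = λ () ; R-copy = λ () ; copied = λ ()
    ; H-pos = λ () ; R-pos = λ ()
    ; precede = λ _ () ; head∈H = λ _ () }
  shrunk N b (C ∷ L) 0≤b b≤Σ pos = shrunk-∷ N b C L 0≤b b≤Σ pos (b ℚ.≤? 0ℚ) (weight C ℚ.≤? b)

  shrunk-∷ N b C@(cut j X w) L 0≤b b≤Σ pos (yes b≤0) _ = record
    { H = [] ; R = C ∷ L ; shrink≡ = shrink-none N b C L b≤0
    ; ΣH = ℚ.≤-antisym 0≤b b≤0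
    ; μ-split = λ _ → sym (ℚ.+-identityˡ _)
    ; H-copy = λ () ; R-copy = λ {D} D∈ → D , D∈ , refl , refl
    ; copied = λ {D} D∈ → inj₂ (D , D∈ , refl , refl)
    ; H-pos = λ () ; R-pos = pos
    ; precede = λ _ ()
    ; head∈H = λ 0<b _ → ⊥-elim (<⇒≱ 0<b b≤0) }
  shrunk-∷ N b C L 0≤b b≤Σ pos (no b≰0) (yes w≤b) = shrunk-whole N b C L pos b≰0 w≤b
    (shrunk N (b ℚ.- weight C) L (p≤q⇒0≤q-p w≤b) (p≤q+r⇒p-q≤r b≤Σ) (pos ∘ there))
  shrunk-∷ N b C@(cut j X w) L 0≤b b≤Σ pos (no b≰0) (no w≰b) = record
    { H = cut j X b ∷ [] ; R = cut j X (w ℚ.- b) ∷ L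
    ; shrink≡ = shrink-part N b j X w L b≰0 w≰b
    ; ΣH = ℚ.+-identityʳ b
    ; μ-split = split
    ; H-copy = λ { (here refl) → C , here refl , refl , refl }
    ; R-copy = λ { (here refl) → C , here refl , refl , refl
                 ; (there {x = D} p) → _ , there p , refl , refl }
    ; copied = λ { (here refl) → inj₁ (_ , here refl , refl , refl)
                 ; (there p) → inj₂ (_ , there p , refl , refl) }
    ; H-pos = λ { (here refl) → ℚ.≰⇒> b≰0 }
    ; R-pos = λ { (here refl) → p<q⇒0<q-p (ℚ.≰⇒> w≰b) ; (there p) → pos (there p) }
    ; precede = λ { _ (here refl) (here refl) → inj₁ (refl , refl)
                  ; (C≺ ∷ _) (here refl) (there q) → inj₂ (All.lookup C≺ q) }
    ; head∈H = λ { _ refl → _ , here refl , refl , refl } }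
    where
    split : ∀ {Q : Terminal G → Subset #V → Set} (Q? : ∀ j X → Dec (Q j X)) →
            let Q?′ = λ C → Q? (owner C) (side C) in
            μ Q?′ (C ∷ L) ≡ μ Q?′ (cut j X b ∷ []) ℚ.+ μ Q?′ (cut j X (w ℚ.- b) ∷ L)
    split Q? with Q? j X
    ... | yes _ = solve 3 (λ b w s → w :+ s := (b :+ con 0ℚ) :+ ((w :- b) :+ s)) refl b w _
      where open +-*-Solver
    ... | no  _ = sym (ℚ.+-identityˡ _)

  module _ {rank : Terminal G → ℕ} {T : Subset #T} {𝒞 : Family G}
           (ord : Ordered G rank T 𝒞) (rank-injective : Injective _≡_ _≡_ rank) where
    open Ordered ord

    -- Sorting by cardinality and then by the rank of the owner suffices: cuts through `v` are
    -- nested, so size decides inclusion, and equal sets appear by rank, with which domination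
    -- agrees.
    chain-exists : ∀ v → ∃ (IsChain G rank 𝒞 v)
    chain-exists v = sort K , sort-↭ K ,
      go (sort K) (∈-resp-↭ (sort-↭ K))
        (Linked.Linked⇒AllPairs (λ {C} {D} {E} → DecTotalOrder.trans order {C} {D} {E})
          (sort-↗ K))
      where
      K = containing G v 𝒞
      order : DecTotalOrder _ _ _
      order = On.decTotalOrder (×-decTotalOrder ℕ.≤-decTotalOrder ℕ.≤-decTotalOrder)
        (λ (C : Cut G) → ∣ side C ∣ , rank (owner C))
      open Sort order
      open DecTotalOrder order using () renaming (_≤_ to _⊑_)

      step : ∀ {C D} → C ∈ˡ K → D ∈ˡ K → C ⊑ D →
             side C ⊆ side D × (side C ≡ side D → ¬ Dominates G rank 𝒞 (owner D) (owner C))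
      step {C} {D} C∈K D∈K C⊑D
        with C∈ , v∈C ← ∈-filter⁻ (λ C → v ∈? side C) C∈K
           | D∈ , v∈D ← ∈-filter⁻ (λ C → v ∈? side C) D∈K
        with ⊆-or-⊂ (nested C∈ D∈ v∈C v∈D) | C⊑D
      ... | inj₁ C⊆D | inj₁ (_ , ≢) = C⊆D , λ eq → contradiction (cong ∣_∣ eq) ≢
      ... | inj₁ C⊆D | inj₂ (_ , C≤D) =
        C⊆D , λ _ dom → ℕ.<⇒≱ (dominates⇒rank< rank-injective dom) C≤D
      ... | inj₂ D⊂C | inj₁ (≤ , _) = ⊥-elim (ℕ.<⇒≱ (p⊂q⇒∣p∣<∣q∣ D⊂C) ≤)
      ... | inj₂ D⊂C | inj₂ (≡ , _) = ⊥-elim (ℕ.<⇒≢ (p⊂q⇒∣p∣<∣q∣ D⊂C) (sym ≡))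

      go : ∀ L → (∀ {C} → C ∈ˡ L → C ∈ˡ K) → AllPairs _⊑_ L →
           AllPairs (λ C D → side C ⊆ side D ×
             (side C ≡ side D → ¬ Dominates G rank 𝒞 (owner D) (owner C))) L
      go []      sub []         = []
      go (C ∷ L) sub (C⊑ ∷ chn) =
        All.tabulate (λ D∈ → step (sub (here refl)) (sub (there D∈)) (All.lookup C⊑ D∈))
          ∷ go L (sub ∘ there) chn

-- Preprocessing

fromℕ-+ : ∀ m n → fromℕ (m ℕ.+ n) ≡ fromℕ m ℚ.+ fromℕ n
fromℕ-+ zero    n = sym (trans (cong (ℚ._+ fromℕ n) (fromℕ≡ 0)) (ℚ.+-identityˡ (fromℕ n)))
fromℕ-+ (suc m) n = begin
  fromℕ (suc (m ℕ.+ n))            ≡⟨ fromℕ-suc (m ℕ.+ n) ⟩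
  fromℕ (m ℕ.+ n) ℚ.+ 1ℚ           ≡⟨ cong (ℚ._+ 1ℚ) (fromℕ-+ m n) ⟩
  (fromℕ m ℚ.+ fromℕ n) ℚ.+ 1ℚ     ≡⟨ solve 3 (λ a b c → (a :+ b) :+ c := (a :+ c) :+ b) refl
                                        (fromℕ m) (fromℕ n) 1ℚ ⟩
  (fromℕ m ℚ.+ 1ℚ) ℚ.+ fromℕ n     ≡⟨ cong (ℚ._+ fromℕ n) (fromℕ-suc m) ⟨
  fromℕ (suc m) ℚ.+ fromℕ n        ∎
  where
  open ≡-Reasoning
  open +-*-Solver

fromℕ-* : ∀ m n → fromℕ (m ℕ.* n) ≡ fromℕ m ℚ.* fromℕ n
fromℕ-* zero    n = trans (fromℕ≡ 0)
  (sym (trans (cong (ℚ._* fromℕ n) (fromℕ≡ 0)) (ℚ.*-zeroˡ (fromℕ n))))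
fromℕ-* (suc m) n = begin
  fromℕ (n ℕ.+ m ℕ.* n)                 ≡⟨ fromℕ-+ n (m ℕ.* n) ⟩
  fromℕ n ℚ.+ fromℕ (m ℕ.* n)           ≡⟨ cong (fromℕ n ℚ.+_) (fromℕ-* m n) ⟩
  fromℕ n ℚ.+ fromℕ m ℚ.* fromℕ n       ≡⟨ solve 2 (λ a b → b :+ a :* b := (a :+ con 1ℚ) :* b) refl
                                             (fromℕ m) (fromℕ n) ⟩
  (fromℕ m ℚ.+ 1ℚ) ℚ.* fromℕ n          ≡⟨ cong (ℚ._* fromℕ n) (fromℕ-suc m) ⟨
  fromℕ (suc m) ℚ.* fromℕ n             ∎
  where
  open ≡-Reasoning
  open +-*-Solver

opaque
  unfolding fromℕ

  clear-denominator : ∀ w → 0ℚ ℚ.≤ w → ∃ λ a → w ℚ.* fromℕ (ℚ.↧ₙ w) ≡ fromℕ a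
  clear-denominator (ℚ.mkℚ (ℤ.+ a) d c) _ = a , trans
    (cong (ℚ.mkℚ (ℤ.+ a) d c ℚ.*_)
      (ℚ.normalize-coprime {suc d} {0} (Coprime.sym (Coprime.1-coprimeTo (suc d)))))
    (ℚ.fromℚᵘ-cong {ℚᵘ.mkℚᵘ (ℤ.+ a ℤ.* ℤ.+ suc d) (d ℕ.* 1)} {ℚᵘ.mkℚᵘ (ℤ.+ a) 0}
      (ℚᵘ.*≡* (trans (ℤ.*-identityʳ _)
        (cong (λ n → ℤ.+ a ℤ.* ℤ.+ suc n) (sym (ℕ.*-identityʳ d))))))
  clear-denominator (ℚ.mkℚ ℤ.-[1+ a ] d c) (ℚ.*≤* ())

  fromℕ-pos : ∀ n .{{_ : ℕ.NonZero n}} → ℚ.Positive (fromℕ n)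
  fromℕ-pos n = ℚ.normalize-pos n 1

record Inverse (b : ℚ) : Set where
  field
    c    : ℚ
    bc≡1 : b ℚ.* c ≡ 1ℚ
    0<c  : 0ℚ ℚ.< c

  refine : ∀ n ε → n ℚ.* ε ≡ (n ℚ.* b) ℚ.* (ε ℚ.* c)
  refine n ε = begin
    n ℚ.* ε                   ≡⟨ ℚ.*-identityʳ (n ℚ.* ε) ⟨
    (n ℚ.* ε) ℚ.* 1ℚ          ≡⟨ cong ((n ℚ.* ε) ℚ.*_) bc≡1 ⟨
    (n ℚ.* ε) ℚ.* (b ℚ.* c)   ≡⟨ solve 4 (λ n e b c → (n :* e) :* (b :* c) := (n :* b) :* (e :* c))
                                   refl n ε b c ⟩
    (n ℚ.* b) ℚ.* (ε ℚ.* c)   ∎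
    where
    open ≡-Reasoning
    open +-*-Solver

inverse : ∀ b .{{_ : ℚ.Positive b}} → Inverse b
inverse b = record
  { c = ℚ.1/ b ; bc≡1 = ℚ.*-inverseʳ b ; 0<c = ℚ.positive⁻¹ (ℚ.1/ b) {{ℚ.1/pos⇒pos b}} }
  where
  instance
    nonZero : ℚ.NonZero b
    nonZero = ℚ.pos⇒nonZero b

-- A common unit of finitely many weights

module _ {A : Set} (w : A → ℚ) where

  -- That 1 is itself a multiple of `ε` is what lets the unit be refined: a further weight a/b is
  -- `N * a` times the new unit ε/b.
  record CommonUnit (xs : List A) : Set where
    field
      ε        : ℚ
      N        : ℕ
      Nε≡1     : fromℕ N ℚ.* ε ≡ 1ℚ
      0<ε      : 0ℚ ℚ.< ε
      multiple : ∀ {x} → x ∈ˡ xs → ∃ λ n → w x ≡ fromℕ n ℚ.* ε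

  refine-unit : ∀ {x xs} → CommonUnit xs → ∀ a b → w x ℚ.* fromℕ b ≡ fromℕ a →
                Inverse (fromℕ b) → CommonUnit (x ∷ xs)
  refine-unit {x} {xs} unit a b wb≡a inv = record
    { ε = ε ℚ.* c ; N = N ℕ.* b ; Nε≡1 = Nεbc≡1
    ; 0<ε = subst (ℚ._< ε ℚ.* c) (ℚ.*-zeroˡ c) (ℚ.*-monoˡ-<-pos c {{ℚ.positive 0<c}} 0<ε)
    ; multiple = λ { (here refl) → N ℕ.* a , head
                   ; (there y∈) → let n , wy≡ = multiple y∈ in n ℕ.* b , trans wy≡ (refine′ n) } }
    where
    open CommonUnit unit
    open Inverse inv

    refine′ : ∀ n → fromℕ n ℚ.* ε ≡ fromℕ (n ℕ.* b) ℚ.* (ε ℚ.* c)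
    refine′ n = trans (refine (fromℕ n) ε) (cong (ℚ._* (ε ℚ.* c)) (sym (fromℕ-* n b)))

    Nεbc≡1 : fromℕ (N ℕ.* b) ℚ.* (ε ℚ.* c) ≡ 1ℚ
    Nεbc≡1 = trans (sym (refine′ N)) Nε≡1

    move : ∀ n b e w → ((n ℚ.* b) ℚ.* e) ℚ.* w ≡ (n ℚ.* (w ℚ.* b)) ℚ.* e
    move = solve 4 (λ n b e w → ((n :* b) :* e) :* w := (n :* (w :* b)) :* e) refl
      where open +-*-Solver

    head : w x ≡ fromℕ (N ℕ.* a) ℚ.* (ε ℚ.* c)
    head = begin
      w x                                             ≡⟨ ℚ.*-identityˡ (w x) ⟨
      1ℚ ℚ.* w x                                      ≡⟨ cong (ℚ._* w x) Nεbc≡1 ⟨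
      (fromℕ (N ℕ.* b) ℚ.* (ε ℚ.* c)) ℚ.* w x
        ≡⟨ cong (λ q → (q ℚ.* (ε ℚ.* c)) ℚ.* w x) (fromℕ-* N b) ⟩
      ((fromℕ N ℚ.* fromℕ b) ℚ.* (ε ℚ.* c)) ℚ.* w x   ≡⟨ move (fromℕ N) (fromℕ b) (ε ℚ.* c) (w x) ⟩
      (fromℕ N ℚ.* (w x ℚ.* fromℕ b)) ℚ.* (ε ℚ.* c)
        ≡⟨ cong (λ q → (fromℕ N ℚ.* q) ℚ.* (ε ℚ.* c)) wb≡a ⟩
      (fromℕ N ℚ.* fromℕ a) ℚ.* (ε ℚ.* c)             ≡⟨ cong (ℚ._* (ε ℚ.* c)) (fromℕ-* N a) ⟨
      fromℕ (N ℕ.* a) ℚ.* (ε ℚ.* c)                   ∎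
      where open ≡-Reasoning

  common-unit : ∀ xs → (∀ {x} → x ∈ˡ xs → 0ℚ ℚ.≤ w x) → CommonUnit xs
  common-unit []       _   = record
    { ε = 1ℚ ; N = 1 ; Nε≡1 = cong (ℚ._* 1ℚ) (fromℕ≡ 1) ; 0<ε = 0<1 ; multiple = λ () }
  common-unit (x ∷ xs) w≥0 = refine-unit (common-unit xs (w≥0 ∘ there)) (proj₁ cleared)
    (ℚ.↧ₙ (w x)) (proj₂ cleared) (inverse _ {{fromℕ-pos (ℚ.↧ₙ (w x))}})
    where cleared = clear-denominator (w x) (w≥0 (here refl))

module _ {A : Set} where

  ∈⇒↭ : ∀ {x : A} {xs} → x ∈ˡ xs → ∃ λ ys → xs ↭ x ∷ ys
  ∈⇒↭ x∈ with as , bs , refl ← ∈-∃++ x∈ = as ++ bs , shift _ as bs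

  ∈∈⇒↭ : ∀ {x y : A} {xs} → x ∈ˡ xs → y ∈ˡ xs → x ≢ y → ∃ λ zs → xs ↭ x ∷ y ∷ zs
  ∈∈⇒↭ x∈ y∈ x≢y with ys , p ← ∈⇒↭ x∈ with ∈-resp-↭ p y∈
  ... | here refl = contradiction refl x≢y
  ... | there y∈′ with zs , q ← ∈⇒↭ y∈′ = zs , ↭.trans p (↭.prep _ q)

-- This is `(a - b) * (p - q) > 0`; in terms of the slacks `k` and `l` the difference is
-- `(1 + k) * (1 + l)`.
rearrangement : ∀ {a b p q} → b ℕ.< a → q ℕ.< p → a ℕ.* q ℕ.+ b ℕ.* p ℕ.< a ℕ.* p ℕ.+ b ℕ.* q
rearrangement {a} {b} {p} {q} b<a q<p
  with k , refl ← ℕ.m≤n⇒∃[o]m+o≡n b<a | l , refl ← ℕ.m≤n⇒∃[o]m+o≡n q<p =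
  subst (suc b+k ℕ.* q ℕ.+ b ℕ.* suc q+l ℕ.<_)
    (solve 4 (λ b k q l → ((con 1 :+ b :+ k) :* q :+ b :* (con 1 :+ q :+ l))
                            :+ (con 1 :+ k) :* (con 1 :+ l)
                          := (con 1 :+ b :+ k) :* (con 1 :+ q :+ l) :+ b :* q) refl b k q l)
    (ℕ.m<m+n _ ℕ.z<s)
  where
  open ℕ-Solver.+-*-Solver
  b+k = b ℕ.+ k
  q+l = q ℕ.+ l

-- Taken in `Fin` so that `combine` can encode lexicographic pairs as single numbers; priorities and
-- ranks are built this way.
size : ∀ {n} → Subset n → Fin (suc n)
size X = fromℕ< (ℕ.s≤s (∣p∣≤n X))

size-< : ∀ {n} (X Y : Subset n) → ∣ X ∣ ℕ.< ∣ Y ∣ → toℕ (size X) ℕ.< toℕ (size Y)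
size-< X Y = subst₂ ℕ._<_
  (sym (Fin.toℕ-fromℕ< (ℕ.s≤s (∣p∣≤n X)))) (sym (Fin.toℕ-fromℕ< (ℕ.s≤s (∣p∣≤n Y))))

combine-size-< : ∀ {n m} (X Y : Subset n) (k l : Fin m) → ∣ X ∣ ℕ.< ∣ Y ∣ →
                 toℕ (combine (size X) k) ℕ.< toℕ (combine (size Y) l)
combine-size-< X Y k l X<Y = Fin.combine-monoˡ-< {i = size X} {j = size Y} k l (size-< X Y X<Y)

-- Reassigning cuts by exchanging owners

module _ (G : MCP) where
  open MCP G
  open Weighted (weight {G})

  -- A total stand-in for `O_i`: the two agree whenever an outermost cut exists (`Outermost-⋃`).
  ⋃owned : Family G → Terminal G → Subset #V
  ⋃owned 𝒟 i = ⋃ (map side (ownedBy G i 𝒟))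

  ∈-⋃owned : ∀ {𝒟 C v} → C ∈ˡ 𝒟 → v ∈ side C → v ∈ ⋃owned 𝒟 (owner C)
  ∈-⋃owned C∈ = ∈-⋃⁺ (∈-map⁺ side (∈-filter⁺ (owned? G _) C∈ refl))

  Outermost-⋃ : ∀ 𝒟 i {P} → Outermost G 𝒟 i P → P ≡ ⋃owned 𝒟 i
  Outermost-⋃ 𝒟 i ((C , C∈ , refl) , max) = ⊆-antisym (∈-⋃⁺ (∈-map⁺ side C∈)) λ x∈ →
    let Z , Z∈ , x∈Z = ∈-⋃⁻ (map side (ownedBy G i 𝒟)) x∈ ; D , D∈ , eq = ∈-map⁻ side Z∈
    in max D∈ (subst (_ ∈_) eq x∈Z)

  record Copies (𝒞 𝒟 : Family G) (ε : ℚ) : Set₁ where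
    field
      unit : ∀ {C} → C ∈ˡ 𝒟 → weight C ≡ ε
      copy : ∀ {C} → C ∈ˡ 𝒟 → ∃ λ D → D ∈ˡ 𝒞 × Same G C D
      μ≡   : ∀ {Q : Terminal G → Subset #V → Set} (Q? : ∀ j X → Dec (Q j X)) →
             let Q?′ = λ C → Q? (owner C) (side C) in μ Q?′ 𝒟 ≡ μ Q?′ 𝒞

  Σ-replicate : ∀ n C → Σ (replicate n C) ≡ fromℕ n ℚ.* weight C
  Σ-replicate zero    C =
    sym (trans (cong (ℚ._* weight C) (fromℕ≡ 0)) (ℚ.*-zeroˡ (weight C)))
  Σ-replicate (suc n) C = trans (cong (weight C ℚ.+_) (Σ-replicate n C)) (trans
    (solve 2 (λ n w → w :+ n :* w := (n :+ con 1ℚ) :* w) refl (fromℕ n) (weight C))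
    (cong (ℚ._* weight C) (sym (fromℕ-suc n))))
    where open +-*-Solver

  ∈-replicate : ∀ n {C D : Cut G} → D ∈ˡ replicate n C → D ≡ C
  ∈-replicate (suc n) (here eq)  = eq
  ∈-replicate (suc n) (there D∈) = ∈-replicate n D∈

  -- A weight of `n` units becomes `n` copies of one unit. For positive `ε` a cut of weight 0 gets
  -- no copy, which is how such cuts are discarded. Equal weights are what allow an exchange to
  -- preserve both the weight of each terminal and that of each vertex set.
  copies : ∀ ε 𝒞 → (∀ {C} → C ∈ˡ 𝒞 → ∃ λ n → weight C ≡ fromℕ n ℚ.* ε) → ∃ λ 𝒟 → Copies 𝒞 𝒟 ε
  copies ε []              units = [] , record { unit = λ () ; copy = λ () ; μ≡ = λ _ → refl }
  copies ε (cut j X w ∷ 𝒞) units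
    with 𝒟 , cs ← copies ε 𝒞 (units ∘ there) | n , w≡ ← units (here refl) =
    replicate n C ++ 𝒟 , record { unit = unit′ ; copy = copy′ ; μ≡ = μ≡′ }
    where
    open Copies cs
    C = cut j X ε
    unit′ : ∀ {D} → D ∈ˡ replicate n C ++ 𝒟 → weight D ≡ ε
    unit′ D∈ with ∈-++⁻ (replicate n C) D∈
    ... | inj₁ D∈C = cong weight (∈-replicate n D∈C)
    ... | inj₂ D∈𝒟 = unit D∈𝒟
    copy′ : ∀ {D} → D ∈ˡ replicate n C ++ 𝒟 → ∃ λ E → E ∈ˡ cut j X w ∷ 𝒞 × Same G D E
    copy′ D∈ with ∈-++⁻ (replicate n C) D∈
    ... | inj₁ D∈C with refl ← ∈-replicate n D∈C = _ , here refl , refl , refl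
    ... | inj₂ D∈𝒟 = let E , E∈ , same = copy D∈𝒟 in E , there E∈ , same
    μ≡′ : ∀ {Q : Terminal G → Subset #V → Set} (Q? : ∀ j X → Dec (Q j X)) →
          let Q?′ = λ C → Q? (owner C) (side C) in
          μ Q?′ (replicate n C ++ 𝒟) ≡ μ Q?′ (cut j X w ∷ 𝒞)
    μ≡′ {Q} Q? = trans (μ-++ Q?′ (replicate n C) 𝒟) (head (Q? j X))
      where
      Q?′ = λ C → Q? (owner C) (side C)
      in-replicate : ∀ {P : Cut G → Set} → P C → ∀ {D} → D ∈ˡ replicate n C → P D
      in-replicate {P} p D∈ = subst P (sym (∈-replicate n D∈)) p
      head : Dec (Q j X) → μ Q?′ (replicate n C) ℚ.+ μ Q?′ 𝒟 ≡ μ Q?′ (cut j X w ∷ 𝒞)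
      head (yes q) = trans
        (cong₂ ℚ._+_ (trans (μ-all Q?′ (in-replicate {λ C → Q (owner C) (side C)} q))
          (trans (Σ-replicate n C) (sym w≡))) (μ≡ Q?))
        (sym (cong Σ (filter-accept Q?′ q)))
      head (no ¬q) = trans
        (cong₂ ℚ._+_ (μ-none Q?′ (in-replicate {λ C → ¬ Q (owner C) (side C)} ¬q)) (μ≡ Q?))
        (trans (ℚ.+-identityˡ _) (sym (cong Σ (filter-reject Q?′ ¬q))))

  module Preprocessing {T : Subset #T} {𝒞 : Family G} (fl : IsFractionalLaminar G T 𝒞) where
    open IsFractionalLaminar fl
    open Laminar G fl

    O : Terminal G → Subset #V
    O = ⋃owned 𝒞

    -- Lexicographic in the size of the original outermost cut and the name. It stays fixed while
    -- exchanges alter the current outermost cuts, so progress can be measured against it.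
    priority : Terminal G → Fin (suc #V ℕ.* #T)
    priority i = combine (size (O i)) i

    priority-injective : ∀ {i j} → priority i ≡ priority j → i ≡ j
    priority-injective {i} {j} eq = proj₂ (Fin.combine-injective (size (O i)) i (size (O j)) j eq)

    _≺_ : Terminal G → Terminal G → Set
    i ≺ j = toℕ (priority i) ℕ.< toℕ (priority j)

    outermost-O : ∀ {i} → i ∈ T → ∃ λ P → P ∈ˡ 𝒞 × side P ≡ O i
    outermost-O i∈T = let P , P∈ , Pi , max = outermost i∈T in
      P , P∈ , Outermost-⋃ 𝒞 _ (outermost⇒Outermost P∈ Pi max)

    O-mono : ∀ {i j v} → i ∈ T → j ∈ T → i ≺ j → v ∈ O i → v ∈ O j → O i ⊆ O j
    O-mono {i} {j} i∈ j∈ i≺j v∈i v∈j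
      with P , P∈ , P≡ ← outermost-O i∈ | Q , Q∈ , Q≡ ← outermost-O j∈
      with ⊆-or-⊂ (nested P∈ Q∈ (subst (_ ∈_) (sym P≡) v∈i) (subst (_ ∈_) (sym Q≡) v∈j))
    ... | inj₁ P⊆Q = subst₂ _⊆_ P≡ Q≡ P⊆Q
    ... | inj₂ Q⊂P = ⊥-elim (ℕ.<-asym i≺j (combine-size-< (O j) (O i) j i
      (p⊂q⇒∣p∣<∣q∣ (subst₂ _⊂_ Q≡ P≡ Q⊂P))))

    record Reassigned (ε : ℚ) (𝒟 : Family G) : Set where
      field
        fractionalLaminar : IsFractionalLaminar G T 𝒟
        unit              : ∀ {C} → C ∈ˡ 𝒟 → weight C ≡ ε
        within            : ∀ {C} → C ∈ˡ 𝒟 → side C ⊆ O (owner C)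
        weightOf≡         : ∀ X → weightOf G 𝒟 X ≡ weightOf G 𝒞 X

    -- Compared with the inclusion invariant, the order is that of the fixed priorities, and only
    -- the preferred terminal is asked to lie in the cut of the other.
    Stable : Family G → Set
    Stable 𝒟 = ∀ {C D} → C ∈ˡ 𝒟 → D ∈ˡ 𝒟 → owner D ≺ owner C → r (owner D) ∈ side C →
               side D ⊆ side C

    -- An exchange hands the smaller set, hence the larger complement, to the owner of smaller
    -- priority. By `rearrangement` the sum of products then drops strictly.
    potential : Family G → ℕ
    potential 𝒟 = sum (map (λ C → ∣ ∁ (side C) ∣ ℕ.* toℕ (priority (owner C))) 𝒟)

    Exchangeable : Cut G → Cut G → Set
    Exchangeable C D = (owner D ≺ owner C × r (owner D) ∈ side C) × ¬ side D ⊆ side C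

    exchangeable? : ∀ C D → Dec (Exchangeable C D)
    exchangeable? C D =
      ((toℕ (priority (owner D)) ℕ.<? toℕ (priority (owner C))) ×-dec (r (owner D) ∈? side C))
        ×-dec ¬? (side D ⊆? side C)

    -- Both cuts contain `r j`, so laminarity turns `¬ Y ⊆ X` into `X ⊂ Y`, and each terminal lies
    -- in the set it receives. The larger set stays within the original outermost cut of its new
    -- owner by `O-mono`.
    exchange : ∀ {ε 𝒟 C D} → C ∈ˡ 𝒟 → D ∈ˡ 𝒟 → Exchangeable C D → Reassigned ε 𝒟 →
               ∃ λ 𝒟′ → Reassigned ε 𝒟′ × potential 𝒟′ ℕ.< potential 𝒟
    exchange {ε} {𝒟} {C@(cut i X w)} {D@(cut j Y w′)} C∈ D∈ ((j≺i , rj∈X) , Y⊈X) re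
      with refl ← Reassigned.unit re C∈ | refl ← Reassigned.unit re D∈
      with rest , perm ← ∈∈⇒↭ C∈ D∈ (λ { refl → Y⊈X (λ x∈ → x∈) }) =
      𝒟′ , record
        { fractionalLaminar = record
          { owner∈T   = λ E∈ → owner∈T′ (cases E∈)
          ; isCut     = λ E∈ → let F , F∈ , eq = side-from E∈ in subst (IsCut G) eq (IFL.isCut F∈)
          ; r∈side    = λ E∈ → r∈side′ (cases E∈)
          ; weight≥0  = λ E∈ → subst (0ℚ ℚ.≤_) (sym (unit′ E∈)) (IFL.weight≥0 C∈)
          ; laminar   = λ E∈ F∈ → let E , E∈′ , eq = side-from E∈ ; F , F∈′ , eq′ = side-from F∈
                                  in subst₂ (λ X Y → ¬ Cross G X Y) eq eq′ (IFL.laminar E∈′ F∈′)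
          ; weightSum = λ {k} k∈ → trans (owner-swap k)
              (trans (μ-↭ (owned? G k) (↭.trans (↭.swap D C ↭.refl) (↭.↭-sym perm)))
                (IFL.weightSum k∈)) }
        ; unit      = unit′
        ; within    = λ E∈ → within′ (cases E∈)
        ; weightOf≡ = λ Z → trans (side-swap Z)
            (trans (μ-↭ (λ C → side C ≡? Z) (↭.↭-sym perm)) (Reassigned.weightOf≡ re Z)) } ,
      subst (potential 𝒟′ ℕ.<_) (sym (sum-↭ (map⁺ _ perm)))
        (subst₂ ℕ._<_ (ℕ.+-assoc (∣ ∁ X ∣ ℕ.* pj) (∣ ∁ Y ∣ ℕ.* pi) tail)
          (ℕ.+-assoc (∣ ∁ X ∣ ℕ.* pi) (∣ ∁ Y ∣ ℕ.* pj) tail)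
          (ℕ.+-monoˡ-< tail (rearrangement (p⊂q⇒∣p∣<∣q∣ (p⊂q⇒∁p⊃∁q X⊂Y)) j≺i)))
      where
      module IFL = IsFractionalLaminar (Reassigned.fractionalLaminar re)
      pi = toℕ (priority i)
      pj = toℕ (priority j)
      tail = potential rest

      𝒟′ : Family G
      𝒟′ = cut j X ε ∷ cut i Y ε ∷ rest

      rest⊆ : ∀ {E} → E ∈ˡ rest → E ∈ˡ 𝒟
      rest⊆ E∈ = ∈-resp-↭ (↭.↭-sym perm) (there (there E∈))

      X⊂Y : X ⊂ Y
      X⊂Y with ⊆-or-⊂ (Laminar.nested G (Reassigned.fractionalLaminar re) D∈ C∈
                         (IFL.r∈side D∈) rj∈X)
      ... | inj₁ Y⊆X = ⊥-elim (Y⊈X Y⊆X)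
      ... | inj₂ X⊂Y = X⊂Y

      data Cases : Cut G → Set where
        inner-cut : Cases (cut j X ε)
        outer-cut : Cases (cut i Y ε)
        unchanged : ∀ {E} → E ∈ˡ 𝒟 → Cases E

      cases : ∀ {E} → E ∈ˡ 𝒟′ → Cases E
      cases (here refl)         = inner-cut
      cases (there (here refl)) = outer-cut
      cases (there (there E∈))  = unchanged (rest⊆ E∈)

      side-from : ∀ {E} → E ∈ˡ 𝒟′ → ∃ λ F → F ∈ˡ 𝒟 × side F ≡ side E
      side-from (here refl)         = C , C∈ , refl
      side-from (there (here refl)) = D , D∈ , refl
      side-from (there (there E∈))  = _ , rest⊆ E∈ , refl

      owner∈T′ : ∀ {E} → Cases E → owner E ∈ T
      owner∈T′ inner-cut      = IFL.owner∈T D∈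
      owner∈T′ outer-cut      = IFL.owner∈T C∈
      owner∈T′ (unchanged E∈) = IFL.owner∈T E∈

      r∈side′ : ∀ {E} → Cases E → r (owner E) ∈ side E
      r∈side′ inner-cut      = rj∈X
      r∈side′ outer-cut      = proj₁ X⊂Y (IFL.r∈side C∈)
      r∈side′ (unchanged E∈) = IFL.r∈side E∈

      unit′ : ∀ {E} → E ∈ˡ 𝒟′ → weight E ≡ ε
      unit′ (here refl)         = refl
      unit′ (there (here refl)) = refl
      unit′ (there (there E∈))  = Reassigned.unit re (rest⊆ E∈)

      within′ : ∀ {E} → Cases E → side E ⊆ O (owner E)
      within′ (unchanged E∈) = Reassigned.within re E∈
      within′ inner-cut x∈   = Reassigned.within re D∈ (proj₁ X⊂Y x∈)
      within′ outer-cut x∈   = O-mono (IFL.owner∈T D∈) (IFL.owner∈T C∈) j≺i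
        (Reassigned.within re D∈ (IFL.r∈side D∈)) (Reassigned.within re C∈ rj∈X)
        (Reassigned.within re D∈ x∈)

      -- By owner the new pair matches `D`, `C`; by side it matches `C`, `D`. Hence the two orders
      -- here and in `side-swap`.
      owner-swap : ∀ k → μ (owned? G k) 𝒟′ ≡ μ (owned? G k) (D ∷ C ∷ rest)
      owner-swap k = μ-∷ (owned? G k) {cut j X ε} {D} {cut i Y ε ∷ rest} {C ∷ rest}
        refl (λ eq → eq) (λ eq → eq)
        (μ-∷ (owned? G k) {cut i Y ε} {C} {rest} {rest} refl (λ eq → eq) (λ eq → eq) refl)

      side-swap : ∀ Z → weightOf G 𝒟′ Z ≡ weightOf G (C ∷ D ∷ rest) Z
      side-swap Z = μ-∷ side? {cut j X ε} {C} {cut i Y ε ∷ rest} {D ∷ rest}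
        refl (λ eq → eq) (λ eq → eq)
        (μ-∷ side? {cut i Y ε} {D} {rest} {rest} refl (λ eq → eq) (λ eq → eq) refl)
        where
        side? : Decidable (λ (E : Cut G) → side E ≡ Z)
        side? E = side E ≡? Z

    stabilise : ∀ {ε} n {𝒟} → potential 𝒟 ℕ.≤ n → Reassigned ε 𝒟 → ∃ λ 𝒟 → Reassigned ε 𝒟 × Stable 𝒟
    stabilise n {𝒟} bound re with any? (λ C → any? (exchangeable? C) 𝒟) 𝒟
    ... | no none = 𝒟 , re , λ {C} {D} C∈ D∈ D≺C r∈ →
      decidable-stable (side D ⊆? side C) λ D⊈C → none (lose C∈ (lose D∈ ((D≺C , r∈) , D⊈C)))
    ... | yes some with C , C∈ , some′ ← find some with D , D∈ , ex ← find some′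
      with exchange C∈ D∈ ex re | n
    ...   | 𝒟′ , re′ , less | zero   = ⊥-elim (ℕ.<⇒≱ (ℕ.≤-<-trans ℕ.z≤n less) bound)
    ...   | 𝒟′ , re′ , less | suc n′ = stabilise n′ (ℕ.≤-pred (ℕ.≤-trans less bound)) re′

    module _ {ε : ℚ} (0<ε : 0ℚ ℚ.< ε) {𝒟 : Family G} (re : Reassigned ε 𝒟) (stable : Stable 𝒟) where
      open Reassigned re using (unit; within; weightOf≡)
      module IFL = IsFractionalLaminar (Reassigned.fractionalLaminar re)

      -- The size of the current outermost cut comes first for the sake of `rank-consistent`. Ties
      -- go by priority, the order in which `Stable` is phrased, so that `inclusion` also holds for
      -- equal outermost cuts.
      rank : Terminal G → ℕ
      rank i = toℕ (combine (size (⋃owned 𝒟 i)) (priority i))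

      ⊂⇒rank< : ∀ {i j P Q} → Outermost G 𝒟 i P → Outermost G 𝒟 j Q → P ⊂ Q → rank i ℕ.< rank j
      ⊂⇒rank< {i} {j} oP oQ P⊂Q = combine-size-< (⋃owned 𝒟 i) (⋃owned 𝒟 j) (priority i) (priority j)
        (p⊂q⇒∣p∣<∣q∣ (subst₂ _⊂_ (Outermost-⋃ 𝒟 i oP) (Outermost-⋃ 𝒟 j oQ) P⊂Q))

      ≡⇒≺ : ∀ {i j P} → Outermost G 𝒟 i P → Outermost G 𝒟 j P → rank i ℕ.< rank j → i ≺ j
      ≡⇒≺ {i} {j} oP oQ i<j = ℕ.+-cancelˡ-< (suc #V ℕ.* #T ℕ.* toℕ (size (⋃owned 𝒟 i))) _ _
        (subst₂ ℕ._<_ (Fin.toℕ-combine (size (⋃owned 𝒟 i)) (priority i))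
          (trans (Fin.toℕ-combine (size (⋃owned 𝒟 j)) (priority j))
            (cong (λ Z → suc #V ℕ.* #T ℕ.* toℕ (size Z) ℕ.+ toℕ (priority j))
              (trans (sym (Outermost-⋃ 𝒟 j oQ)) (Outermost-⋃ 𝒟 i oP)))) i<j)

      inclusion : InclusionInvariant G rank 𝒟
      inclusion {C} {D} C∈ D∈ (P , Q , oP , oQ , dom) ri∈ rj∈
        with ℕ.<-cmp (toℕ (priority (owner C))) (toℕ (priority (owner D)))
      ... | tri< C≺D _ _ = stable D∈ C∈ C≺D (proj₂ (x∈p∩q⁻ (side C) (side D) ri∈))
      ... | tri≈ _ C≡D _ with refl ← priority-injective (Fin.toℕ-injective C≡D) | dom
      ...   | inj₂ (_ , i<i) = ⊥-elim (ℕ.<-irrefl refl i<i)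
      ...   | inj₁ P⊂Q = ⊥-elim (⊂-irref
        (trans (Outermost-⋃ 𝒟 _ oP) (sym (Outermost-⋃ 𝒟 _ oQ))) P⊂Q)
      inclusion {C} {D} C∈ D∈ (P , Q , oP , oQ , dom) ri∈ rj∈ | tri> _ _ D≺C
        with P′ , P′∈ , P′i , refl ← Outermost-cut G oP | Q′ , Q′∈ , Q′j , refl ← Outermost-cut G oQ
        = ⊥-elim (impossible dom)
        where
        -- Stability of the outermost cuts themselves rules out domination against the priorities.
        Q⊆P : side Q′ ⊆ side P′
        Q⊆P = stable P′∈ Q′∈ (subst₂ _≺_ (sym Q′j) (sym P′i) D≺C)
          (subst (λ j → r j ∈ side P′) (sym Q′j)
            (Outermost-⊆ G oP C∈ refl (proj₁ (x∈p∩q⁻ (side C) (side D) rj∈))))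
        impossible : side P′ ⊂ side Q′ ⊎ (side P′ ≡ side Q′ × rank (owner C) ℕ.< rank (owner D)) →
                     Empty.⊥
        impossible (inj₁ (_ , x , x∈Q , x∉P)) = x∉P (Q⊆P x∈Q)
        impossible (inj₂ (P≡Q , i<j)) =
          ℕ.<-asym D≺C (≡⇒≺ oP (subst (Outermost G 𝒟 (owner D)) (sym P≡Q) oQ) i<j)

      stable⇒preprocessed : Preprocessed G T 𝒞 𝒟 rank
      stable⇒preprocessed = record
        { fractionalLaminar = Reassigned.fractionalLaminar re
        ; weight>0          = λ C∈ → subst (0ℚ ℚ.<_) (sym (unit C∈)) 0<ε
        ; reassigned        = weightOf≡
        ; shrinks           = shrinks
        ; inclusion         = inclusion
        ; rank-injective    = λ {i} {j} eq → priority-injective (proj₂ (Fin.combine-injective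
            (size (⋃owned 𝒟 i)) (priority i) (size (⋃owned 𝒟 j)) (priority j)
            (Fin.toℕ-injective eq)))
        ; rank-consistent   = λ _ _ → ⊂⇒rank< }
        where
        shrinks : ∀ {i P Q} → i ∈ T → Outermost G 𝒟 i P → Outermost G 𝒞 i Q → P ⊆ Q
        shrinks _ oP oQ x∈ with C , C∈ , refl , refl ← Outermost-cut G oP =
          subst (_ ∈_) (sym (Outermost-⋃ 𝒞 _ oQ)) (within C∈ x∈)

    copies⇒reassigned : ∀ {ε 𝒟} → Copies 𝒞 𝒟 ε → 0ℚ ℚ.< ε → Reassigned ε 𝒟
    copies⇒reassigned {ε} {𝒟} cs 0<ε = record
      { fractionalLaminar = record
        { owner∈T   = λ C∈ → let D , D∈ , eq , _ = copy C∈ in subst (_∈ T) (sym eq) (owner∈T D∈)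
        ; isCut     = λ C∈ → let D , D∈ , _ , eq = copy C∈ in subst (IsCut G) (sym eq) (isCut D∈)
        ; r∈side    = λ C∈ → let D , D∈ , eq , eq′ = copy C∈ in
                      subst₂ (λ j X → r j ∈ X) (sym eq) (sym eq′) (r∈side D∈)
        ; weight≥0  = λ C∈ → subst (0ℚ ℚ.≤_) (sym (unit C∈)) (ℚ.<⇒≤ 0<ε)
        ; laminar   = λ C∈ D∈ → let C , C∈′ , _ , eq = copy C∈ ; D , D∈′ , _ , eq′ = copy D∈ in
                      subst₂ (λ X Y → ¬ Cross G X Y) (sym eq) (sym eq′) (laminar C∈′ D∈′)
        ; weightSum = λ {i} i∈ → trans (μ≡ (λ j _ → j Fin.≟ i)) (weightSum i∈) }
      ; unit      = unit
      ; within    = λ {C} C∈ → within C∈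
      ; weightOf≡ = λ X → μ≡ (λ _ Y → Y ≡? X) }
      where
      open Copies cs
      within : ∀ {C} → C ∈ˡ 𝒟 → side C ⊆ O (owner C)
      within C∈ x∈ with D , D∈ , refl , refl ← copy C∈ = ∈-⋃owned D∈ x∈

    preprocessed-exists : ∃₂ λ 𝒞⁰ rank → Preprocessed G T 𝒞 𝒞⁰ rank
    preprocessed-exists =
      let 𝒟 , cs          = copies ε 𝒞 multiple
          𝒞⁰ , re , stable = stabilise (potential 𝒟) {𝒟} ℕ.≤-refl (copies⇒reassigned cs 0<ε)
      in 𝒞⁰ , rank 0<ε re stable , stable⇒preprocessed 0<ε re stable
      where open CommonUnit (common-unit weight 𝒞 weight≥0)

-- One iteration, on the level of cuts

module _ (G : MCP) where
  open MCP G

  open Weighted (weight {G})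

  crosses? : ∀ u v → Decidable (λ (C : Cut G) → u ∈ side C × v ∉ side C)
  crosses? u v C = (u ∈? side C) ×-dec ¬? (v ∈? side C)

  cross : Vertex G → Vertex G → Family G → ℚ
  cross u v = μ (crosses? u v)

  cross>0 : ∀ {u v 𝒞 C} → Pos 𝒞 → C ∈ˡ 𝒞 → u ∈ side C → v ∉ side C → 0ℚ ℚ.< cross u v 𝒞
  cross>0 {u} {v} pos C∈ u∈ v∉ = μ>0 (crosses? u v) pos C∈ (u∈ , v∉)

  cross≡0⇒none : ∀ {u v 𝒞 C} → Pos 𝒞 → cross u v 𝒞 ≡ 0ℚ → C ∈ˡ 𝒞 → u ∈ side C → v ∈ side C
  cross≡0⇒none {u} {v} {C = C} pos ≡0 C∈ u∈ = decidable-stable (v ∈? side C) λ v∉ →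
    ℚ.<-irrefl (sym ≡0) (cross>0 pos C∈ u∈ v∉)

  none⇒cross≡0 : ∀ {u v 𝒞} → (∀ {C} → C ∈ˡ 𝒞 → u ∈ side C → v ∈ side C) → cross u v 𝒞 ≡ 0ℚ
  none⇒cross≡0 {u} {v} none = μ-none (crosses? u v) λ C∈ (u∈ , v∉) → v∉ (none C∈ u∈)

  load≡cross : ∀ 𝒞 e → let (u , v) = ends e in load G 𝒞 e ≡ cross u v 𝒞 ℚ.+ cross v u 𝒞
  load≡cross 𝒞 e = μ-⊎ (crosses? _ _) (crosses? _ _) (λ C → e ∈? δ G (side C)) 𝒞
    (λ {C} _ → separates⁻ G (side C) e)
    (λ {C} _ p → separates⁺ G (side C) e (inj₁ p))
    (λ {C} _ p → separates⁺ G (side C) e (inj₂ p))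
    (λ (u∈ , _) (_ , u∉) → u∉ u∈)

  depth≡cross : ∀ 𝒞 u v → depth G 𝒞 u ≡
    cross u v 𝒞 ℚ.+ μ (λ C → (u ∈? side C) ×-dec (v ∈? side C)) 𝒞
  depth≡cross 𝒞 u v = μ-⊎ (crosses? u v) (λ C → (u ∈? side C) ×-dec (v ∈? side C))
    (λ C → u ∈? side C) 𝒞 by-v (λ _ → proj₁) (λ _ → proj₁) (λ (_ , v∉) (_ , v∈) → v∉ v∈)
    where
    by-v : ∀ {C} → C ∈ˡ 𝒞 → u ∈ side C → (u ∈ side C × v ∉ side C) ⊎ (u ∈ side C × v ∈ side C)
    by-v {C} _ u∈ with v ∈? side C
    ... | yes v∈ = inj₂ (u∈ , v∈)
    ... | no  v∉ = inj₁ (u∈ , v∉)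

  -- A vertex v covered at all lies no deeper than the terminal owning an innermost cut
  -- around v, hence no deeper than u.
  deepest⇒cross≤ : ∀ {rank T 𝒞 u} → Ordered G rank T 𝒞 →
    (∀ {j} → j ∈ T → depth G 𝒞 (r j) ℚ.≤ depth G 𝒞 u) → ∀ v → cross v u 𝒞 ℚ.≤ cross u v 𝒞
  deepest⇒cross≤ {𝒞 = 𝒞} {u} ord deepest v with any? (crosses? v u) 𝒞
  ... | no none = subst (ℚ._≤ cross u v 𝒞)
    (sym (μ-none (crosses? v u) λ C∈ crosses → none (lose C∈ crosses)))
    (μ≥0 (crosses? u v) 𝒞 (Pos⇒NonNeg (Ordered.weight>0 ord)))
  ... | yes some
    with C , C∈ , crosses ← find some
    with D , D∈′ , minimal ← least {R = λ C D → side C ⊆ side D} (λ p q x → q (p x)) (λ x → x)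
           (filter (crosses? v u) 𝒞) (∈-filter⁺ (crosses? v u) C∈ crosses)
           (λ p q → let C∈ , v∈C , _ = ∈-filter⁻ (crosses? v u) p
                        D∈ , v∈D , _ = ∈-filter⁻ (crosses? v u) q
                    in Ordered.nested ord C∈ D∈ v∈C v∈D)
    with D∈ , v∈D , u∉D ← ∈-filter⁻ (crosses? v u) D∈′ =
    +-cancelʳ-≤ _ (begin
      cross v u 𝒞 ℚ.+ both    ≡⟨ cong (cross v u 𝒞 ℚ.+_) (μ-cong _ _ 𝒞
                                    (λ _ (a , b) → b , a) (λ _ (a , b) → b , a)) ⟩
      cross v u 𝒞 ℚ.+ both′   ≡⟨ depth≡cross 𝒞 v u ⟨
      depth G 𝒞 v             ≤⟨ μ-mono (λ C → v ∈? side C) (λ C → r (owner D) ∈? side C) 𝒞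
                                   (Pos⇒NonNeg weight>0) deeper ⟩
      depth G 𝒞 (r (owner D)) ≤⟨ deepest (owner∈T D∈) ⟩
      depth G 𝒞 u             ≡⟨ depth≡cross 𝒞 u v ⟩
      cross u v 𝒞 ℚ.+ both    ∎)
    where
    open ℚ.≤-Reasoning
    open Ordered ord
    both  = μ (λ C → (u ∈? side C) ×-dec (v ∈? side C)) 𝒞
    both′ = μ (λ C → (v ∈? side C) ×-dec (u ∈? side C)) 𝒞
    deeper : ∀ {C} → C ∈ˡ 𝒞 → v ∈ side C → r (owner D) ∈ side C
    deeper C∈ v∈C with nested D∈ C∈ v∈D v∈C
    ... | inj₁ D⊆C = D⊆C (r∈side D∈)
    ... | inj₂ C⊆D = minimal (∈-filter⁺ (crosses? v u) C∈ (v∈C , λ u∈C → u∉D (C⊆D u∈C)))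
                       (r∈side D∈)

  -- `N` is the meta-node of `r i`; the two wholeness hypotheses say that no cut splits it. Of the
  -- selection rule only `first` is kept.
  module Step {rank : Terminal G → ℕ} {T : Subset #T} {𝒞 : Family G} (ord : Ordered G rank T 𝒞)
    (rank-injective : Injective _≡_ _≡_ rank) {i : Terminal G} (i∈T : i ∈ T)
    {N : Subset #V} (r∈N : r i ∈ N)
    (N-whole : ∀ {C v} → C ∈ˡ 𝒞 → v ∈ N → v ∈ side C → r i ∈ side C)
    (N-whole⁻ : ∀ {C v} → C ∈ˡ 𝒞 → v ∈ N → r i ∈ side C → v ∈ side C)
    (first : ∀ {j} → j ∈ T → j ≢ i → (∀ {C} → C ∈ˡ 𝒞 → r i ∈ side C → r j ∈ side C) →
             rank i ℕ.< rank j)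
    {L : Family G} (chain : IsChain G rank 𝒞 (r i) L) where
    open Ordered ord

    A K : Family G
    A = filter (λ C → ¬? (r i ∈? side C)) 𝒞
    K = containing G (r i) 𝒞

    L⊆𝒞 : ∀ {C} → C ∈ˡ L → C ∈ˡ 𝒞
    L⊆𝒞 C∈ = proj₁ (∈-filter⁻ (λ C → r i ∈? side C) (∈-resp-↭ (proj₁ chain) C∈))

    r∈L : ∀ {C} → C ∈ˡ L → r i ∈ side C
    r∈L C∈ = proj₂ (∈-filter⁻ (λ C → r i ∈? side C) {xs = 𝒞} (∈-resp-↭ (proj₁ chain) C∈))

    L⁺ : ∀ {C} → C ∈ˡ 𝒞 → r i ∈ side C → C ∈ˡ L
    L⁺ C∈ r∈ = ∈-resp-↭ (↭.↭-sym (proj₁ chain)) (∈-filter⁺ (λ C → r i ∈? side C) C∈ r∈)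

    L-pos : Pos L
    L-pos C∈ = weight>0 (L⊆𝒞 C∈)

    μ-owned-L : μ (owned? G i) L ≡ 1ℚ
    μ-owned-L = trans (μ-↭ (owned? G i) (proj₁ chain)) (trans
      (μ-filter-superset (owned? G i) (λ C → r i ∈? side C) 𝒞 λ { C∈ refl → r∈side C∈ })
      (weightSum i∈T))

    1≤ΣL : 1ℚ ℚ.≤ Σ L
    1≤ΣL = subst (ℚ._≤ Σ L) μ-owned-L (μ≤Σ (owned? G i) L (Pos⇒NonNeg L-pos))

    opaque
      K¹ : Shrunk G N 1ℚ L
      K¹ = shrunk G N 1ℚ L (ℚ.<⇒≤ 0<1) 1≤ΣL L-pos

    open Shrunk K¹ public

    H-base : ∀ {C} → C ∈ˡ H → ∃ λ D → D ∈ˡ 𝒞 × Same G C D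
    H-base C∈ = let D , D∈ , same = H-copy C∈ in D , L⊆𝒞 D∈ , same

    R-base : ∀ {C} → C ∈ˡ R → ∃ λ D → D ∈ˡ 𝒞 × Same G C D
    R-base C∈ = let D , D∈ , same = R-copy C∈ in D , L⊆𝒞 D∈ , same

    r∈H : ∀ {C} → C ∈ˡ H → r i ∈ side C
    r∈H C∈ = let D , D∈ , _ , eq = H-copy C∈ in subst (r i ∈_) (sym eq) (r∈L D∈)

    r∈R : ∀ {C} → C ∈ˡ R → r i ∈ side C
    r∈R C∈ = let D , D∈ , _ , eq = R-copy C∈ in subst (r i ∈_) (sym eq) (r∈L D∈)

    inner-before-outer : ∀ {C D} → C ∈ˡ H → D ∈ˡ R → Same G C D ⊎
      (side C ⊆ side D × (side C ≡ side D → ¬ Dominates G rank 𝒞 (owner D) (owner C)))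
    inner-before-outer = precede
      {λ (j , X) (k , Y) → X ⊆ Y × (X ≡ Y → ¬ Dominates G rank 𝒞 k j)} (proj₂ chain)

    -- A cut of a terminal ranked after i cannot lie in K¹: all the cuts of i precede
    -- it in the chain, and they have weight 1 already.
    H-owner : ∀ {C} → C ∈ˡ H → owner C ≢ i → rank (owner C) ℕ.< rank i
    H-owner {C} C∈H C≢i with ℕ.<-cmp (rank (owner C)) (rank i)
    ... | tri< C<i _ _ = C<i
    ... | tri≈ _ C≡i _ = contradiction (rank-injective C≡i) C≢i
    ... | tri> _ _ i<C = ⊥-elim (ℚ.<-irrefl (trans (sym 1≡) (sym ΣH))
            (μ<Σ (owned? G i) H-pos C∈H C≢i))
      where
      none : ∀ {D} → D ∈ˡ R → owner D ≢ i
      none {D} D∈R refl with inner-before-outer C∈H D∈R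
      ... | inj₁ (eq , _) = C≢i eq
      ... | inj₂ (C⊆D , ties)
        with C₀ , C₀∈ , refl , refl ← H-base C∈H | D₀ , D₀∈ , refl , refl ← R-base D∈R =
        ties (⊆-antisym C⊆D (inclusion D₀∈ C₀∈ i<C (r∈H C∈H) (C⊆D (r∈side C₀∈))))
          (rank<⇒dominates D₀∈ C₀∈ i<C (r∈R D∈R) (r∈H C∈H))

      1≡ : 1ℚ ≡ μ (owned? G i) H
      1≡ = trans (sym μ-owned-L) (trans (μ-split (λ j _ → j Fin.≟ i))
        (trans (cong (μ (owned? G i) H ℚ.+_) (μ-none (owned? G i) none)) (ℚ.+-identityʳ _)))

    Innermost : Set
    Innermost = ∃ λ C → C ∈ˡ 𝒞 × owner C ≡ i ×
                  (∀ {D} → D ∈ˡ 𝒞 → r i ∈ side D → side C ⊆ side D)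

    -- The head of the chain lies in K¹, so an owner other than `i` would be ranked before `i` by
    -- `H-owner`. But every cut around `r i` contains the head and with it the terminal of its
    -- owner, which `first` ranks after `i`.
    innermost : Innermost
    innermost = go L refl (proj₂ chain)
      where
      go : ∀ L′ → L ≡ L′ → AllPairs (λ C D → side C ⊆ side D ×
             (side C ≡ side D → ¬ Dominates G rank 𝒞 (owner D) (owner C))) L′ → Innermost
      go []       eq _ = ⊥-elim (<⇒≱ 0<1 (subst (λ L → 1ℚ ℚ.≤ Σ L) eq 1≤ΣL))
      go (C ∷ L′) eq (C≤ ∷ _) = C , C∈𝒞 , owner≡ , least-C
        where
        C∈𝒞 : C ∈ˡ 𝒞
        C∈𝒞 = L⊆𝒞 (subst (C ∈ˡ_) (sym eq) (here refl))
        least-C : ∀ {D} → D ∈ˡ 𝒞 → r i ∈ side D → side C ⊆ side D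
        least-C D∈ r∈D with subst (_ ∈ˡ_) eq (L⁺ D∈ r∈D)
        ... | here refl = λ x∈ → x∈
        ... | there D∈′ with C⊆D , _ ← All.lookup C≤ D∈′ = C⊆D
        owner≡ : owner C ≡ i
        owner≡ with owner C Fin.≟ i
        ... | yes C≡i = C≡i
        ... | no  C≢i with D , D∈H , refl , refl ← head∈H 0<1 eq =
          ⊥-elim (ℕ.<-asym (H-owner D∈H C≢i)
            (first (owner∈T C∈𝒞) C≢i (λ D∈ r∈D → least-C D∈ r∈D (r∈side C∈𝒞))))

    -- Removing `N` from the cuts of K¹ therefore never costs a remaining terminal its place in its
    -- own cut.
    H-owner∉N : ∀ {C} → C ∈ˡ H → owner C ≢ i → r (owner C) ∉ N
    H-owner∉N C∈H C≢i r∈N′ with C₀ , C₀∈ , refl , refl ← H-base C∈H =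
      ℕ.<-asym (H-owner C∈H C≢i) (first (owner∈T C₀∈) C≢i (λ D∈ r∈D → N-whole⁻ D∈ r∈N′ r∈D))

    pieces 𝒞⁺ : Family G
    pieces = A ++ map (shave G N) H ++ R
    𝒞⁺     = filter (λ C → ¬? (owner C Fin.≟ i)) (A ++ shrink G N 1ℚ L)

    𝒞⁺≡ : 𝒞⁺ ≡ filter (λ C → ¬? (owner C Fin.≟ i)) pieces
    𝒞⁺≡ = cong (λ B → filter (λ C → ¬? (owner C Fin.≟ i)) (A ++ B)) shrink≡

    -- The second index remembers the vertex set before shaving: containments are derived there and
    -- carried over by `mono`.
    data Origin : Cut G → Subset #V → Set where
      outside-r : ∀ {C} → C ∈ˡ 𝒞 → r i ∉ side C → Origin C (side C)
      outer     : ∀ {C} → C ∈ˡ R → Origin C (side C)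
      inner     : ∀ {C} → C ∈ˡ H → Origin (shave G N C) (side C)

    piece⁻ : ∀ {C} → C ∈ˡ pieces → ∃ (Origin C)
    piece⁻ {C} C∈ with ∈-++⁻ A C∈
    ... | inj₁ C∈A = let C∈𝒞 , r∉ = ∈-filter⁻ (λ C → ¬? (r i ∈? side C)) C∈A in
                     _ , outside-r C∈𝒞 r∉
    ... | inj₂ C∈B with ∈-++⁻ (map (shave G N) H) C∈B
    ...   | inj₂ C∈R = _ , outer C∈R
    ...   | inj₁ C∈H with D , D∈H , refl ← ∈-map⁻ (shave G N) C∈H = _ , inner D∈H

    piece⁺ : ∀ {C B} → Origin C B → C ∈ˡ pieces
    piece⁺ (outside-r C∈ r∉) = ∈-++⁺ˡ (∈-filter⁺ (λ C → ¬? (r i ∈? side C)) C∈ r∉)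
    piece⁺ (outer C∈R)       = ∈-++⁺ʳ A (∈-++⁺ʳ (map (shave G N) H) C∈R)
    piece⁺ (inner C∈H)       = ∈-++⁺ʳ A (∈-++⁺ˡ (∈-map⁺ (shave G N) C∈H))

    origin : ∀ {C} → C ∈ˡ 𝒞⁺ → owner C ≢ i × ∃ (Origin C)
    origin C∈ = let C∈′ , C≢i = ∈-filter⁻ (λ C → ¬? (owner C Fin.≟ i)) (subst (_ ∈ˡ_) 𝒞⁺≡ C∈)
                in C≢i , piece⁻ C∈′

    origin⁺ : ∀ {C B} → owner C ≢ i → Origin C B → C ∈ˡ 𝒞⁺
    origin⁺ C≢i o = subst (_ ∈ˡ_) (sym 𝒞⁺≡)
      (∈-filter⁺ (λ C → ¬? (owner C Fin.≟ i)) (piece⁺ o) C≢i)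

    pieces-pos : Pos pieces
    pieces-pos C∈ with piece⁻ C∈
    ... | _ , outside-r C∈𝒞 _ = weight>0 C∈𝒞
    ... | _ , outer C∈R       = R-pos C∈R
    ... | _ , inner C∈H       = H-pos C∈H

    base : ∀ {C B} → Origin C B → ∃ λ D → D ∈ˡ 𝒞 × owner D ≡ owner C × side D ≡ B
    base (outside-r C∈ _) = _ , C∈ , refl , refl
    base (outer C∈R) = let D , D∈ , eq , eq′ = R-base C∈R in D , D∈ , sym eq , sym eq′
    base (inner C∈H) = let D , D∈ , eq , eq′ = H-base C∈H in D , D∈ , sym eq , sym eq′

    ⊆base : ∀ {C B} → Origin C B → side C ⊆ B
    ⊆base (outside-r _ _)       = λ x∈ → x∈
    ⊆base (outer _)             = λ x∈ → x∈
    ⊆base (inner {cut _ X _} _) = p─q⊆p X N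

    survives : ∀ {C} → C ∈ˡ 𝒞 → ∃ λ C′ → owner C′ ≡ owner C × Origin C′ (side C)
    survives {C} C∈ with r i ∈? side C
    ... | no  r∉ = C , refl , outside-r C∈ r∉
    ... | yes r∈ with copied (L⁺ C∈ r∈)
    ...   | inj₁ (D , D∈H , refl , refl) = shave G N D , refl , inner D∈H
    ...   | inj₂ (D , D∈R , refl , refl) = D , refl , outer D∈R

    -- Inclusions survive with one exception: `D` belongs to K¹ and `C` is a copy of the same set
    -- beyond it. The inclusion then reverses, which is harmless for laminarity, and the tie rule of
    -- the chain shields the inclusion invariant.
    mono : ∀ {C D B B′} → Origin C B → Origin D B′ → B ⊆ B′ →
           side C ⊆ side D ⊎
           (side D ⊆ side C × (owner D ≡ owner C ⊎ ¬ Dominates G rank 𝒞 (owner C) (owner D)))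
    mono c (outside-r _ _) B⊆ = inj₁ (λ x∈ → B⊆ (⊆base c x∈))
    mono c (outer _)       B⊆ = inj₁ (λ x∈ → B⊆ (⊆base c x∈))
    mono (outside-r C∈ r∉) (inner {cut _ Y _} D∈) B⊆ = inj₁ λ x∈ →
      x∈p∧x∉q⇒x∈p─q (B⊆ x∈) (λ x∈N → r∉ (N-whole C∈ x∈N x∈))
    mono (inner {cut _ X _} C∈) (inner {cut _ Y _} D∈) B⊆ = inj₁ λ x∈ →
      let x∈X , x∉N = x∈p─q⁻ X N x∈ in x∈p∧x∉q⇒x∈p─q (B⊆ x∈X) x∉N
    mono (outer C∈) (inner {D@(cut _ Y _)} D∈) B⊆ with inner-before-outer D∈ C∈
    ... | inj₁ (eq , refl)  = inj₂ (⊆base (inner D∈) , inj₁ eq)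
    ... | inj₂ (D⊆C , ties) =
      inj₂ ((λ x∈ → D⊆C (⊆base (inner D∈) x∈)) , inj₂ (ties (⊆-antisym D⊆C B⊆)))

    μ-decompose : ∀ {Q : Terminal G → Subset #V → Set} (Q? : ∀ j X → Dec (Q j X)) →
                  let Q?′ = λ C → Q? (owner C) (side C) in
                  μ Q?′ 𝒞 ≡ μ Q?′ A ℚ.+ (μ Q?′ H ℚ.+ μ Q?′ R)
    μ-decompose Q? = trans (μ-partition Q?′ (λ C → r i ∈? side C) 𝒞)
      (cong (μ Q?′ A ℚ.+_) (trans (μ-↭ Q?′ (↭.↭-sym (proj₁ chain))) (μ-split Q?)))
      where Q?′ = λ C → Q? (owner C) (side C)

    μ-pieces : ∀ {Q : Cut G → Set} (Q? : Decidable Q) →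
               μ Q? pieces ≡ μ Q? A ℚ.+ (μ (Q? ∘ shave G N) H ℚ.+ μ Q? R)
    μ-pieces Q? = trans (μ-++ Q? A _) (cong (μ Q? A ℚ.+_) (trans
      (μ-++ Q? (map (shave G N) H) R)
      (cong (ℚ._+ μ Q? R) (μ-map Q? (shave G N) (λ _ → refl) H))))

    μ-𝒞⁺-≤ : ∀ {Q : Cut G → Set} (Q? : Decidable Q) →
             μ Q? 𝒞⁺ ℚ.≤ μ Q? A ℚ.+ (μ (Q? ∘ shave G N) H ℚ.+ μ Q? R)
    μ-𝒞⁺-≤ Q? = begin
      μ Q? 𝒞⁺     ≡⟨ cong (μ Q?) 𝒞⁺≡ ⟩
      μ Q? (filter (λ C → ¬? (owner C Fin.≟ i)) pieces)
                  ≤⟨ μ-filter-≤ Q? (λ C → ¬? (owner C Fin.≟ i)) pieces (Pos⇒NonNeg pieces-pos) ⟩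
      μ Q? pieces ≡⟨ μ-pieces Q? ⟩
      μ Q? A ℚ.+ (μ (Q? ∘ shave G N) H ℚ.+ μ Q? R) ∎
      where open ℚ.≤-Reasoning

    ordered : Ordered G rank (T - i) 𝒞⁺
    ordered = record
      { fractionalLaminar = record
        { owner∈T = λ C∈ → let C≢i , _ , o = origin C∈ ; D , D∈ , eq , _ = base o in
            x∈p∧x≢y⇒x∈p-y (subst (_∈ T) eq (owner∈T D∈)) C≢i
        ; isCut = λ C∈ → let _ , _ , o = origin C∈ ; D , D∈ , _ , eq = base o
                             v , v∉ = proj₂ (isCut D∈) in
            (_ , r∈side⁺ C∈) , v , λ v∈ → v∉ (subst (v ∈_) (sym eq) (⊆base o v∈))
        ; r∈side = r∈side⁺
        ; weight≥0 = λ C∈ → ℚ.<⇒≤ (weight>0⁺ C∈)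
        ; laminar = laminar⁺
        ; weightSum = weightSum⁺ }
      ; weight>0 = weight>0⁺
      ; inclusion = inclusion⁺
      ; extends = extends⁺ }
      where
      weight>0⁺ : Pos 𝒞⁺
      weight>0⁺ C∈ = pieces-pos (piece⁺ (proj₂ (proj₂ (origin C∈))))

      r∈side⁺ : ∀ {C} → C ∈ˡ 𝒞⁺ → r (owner C) ∈ side C
      r∈side⁺ C∈ with origin C∈
      ... | _ , _ , outside-r C∈𝒞 _ = r∈side C∈𝒞
      ... | _ , _ , outer C∈R with D , D∈ , refl , refl ← R-base C∈R = r∈side D∈
      ... | C≢i , _ , inner C∈H with D , D∈ , refl , refl ← H-base C∈H =
        x∈p∧x∉q⇒x∈p─q (r∈side D∈) (H-owner∉N C∈H C≢i)

      laminar⁺ : ∀ {C D} → C ∈ˡ 𝒞⁺ → D ∈ˡ 𝒞⁺ → ¬ Cross G (side C) (side D)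
      laminar⁺ {C} {D} C∈ D∈ ((x , x∈) , (y , y∈) , (z , z∈))
        with _ , _ , oC ← origin C∈ | _ , _ , oD ← origin D∈
        with C₀ , C₀∈ , _ , refl ← base oC | D₀ , D₀∈ , _ , refl ← base oD
        with x∈C , x∈D ← x∈p∩q⁻ (side C) (side D) x∈
           | y∈C , y∉D ← x∈p─q⁻ (side C) (side D) y∈
           | z∈D , z∉C ← x∈p─q⁻ (side D) (side C) z∈
        with nested C₀∈ D₀∈ (⊆base oC x∈C) (⊆base oD x∈D)
      ... | inj₁ C⊆D with mono oC oD C⊆D
      ...   | inj₁ C⊆D′       = y∉D (C⊆D′ y∈C)
      ...   | inj₂ (D⊆C′ , _) = z∉C (D⊆C′ z∈D)
      laminar⁺ {C} {D} C∈ D∈ ((x , x∈) , (y , y∈) , (z , z∈)) | inj₂ D⊆C with mono oD oC D⊆C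
      ...   | inj₁ D⊆C′       = z∉C (D⊆C′ z∈D)
      ...   | inj₂ (C⊆D′ , _) = y∉D (C⊆D′ y∈C)

      mono-rank : ∀ {C D C₀ D₀ v} → Origin C (side C₀) → Origin D (side D₀) →
                  C₀ ∈ˡ 𝒞 → D₀ ∈ˡ 𝒞 → owner C₀ ≡ owner C → owner D₀ ≡ owner D →
                  rank (owner C) ℕ.< rank (owner D) → v ∈ side C₀ → v ∈ side D₀ →
                  side C₀ ⊆ side D₀ → side C ⊆ side D
      mono-rank oC oD C₀∈ D₀∈ refl refl C<D v∈C v∈D C₀⊆D₀ with mono oC oD C₀⊆D₀
      ... | inj₁ C⊆D              = C⊆D
      ... | inj₂ (_ , inj₁ eq)    = contradiction C<D (ℕ.<-irrefl (cong rank (sym eq)))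
      ... | inj₂ (_ , inj₂ ¬dom)  =
        contradiction (rank<⇒dominates C₀∈ D₀∈ C<D v∈C v∈D) ¬dom

      inclusion⁺ : ∀ {C D} → C ∈ˡ 𝒞⁺ → D ∈ˡ 𝒞⁺ → rank (owner C) ℕ.< rank (owner D) →
                   r (owner C) ∈ side D → r (owner D) ∈ side C → side C ⊆ side D
      inclusion⁺ C∈ D∈ C<D rC∈D rD∈C
        with _ , _ , oC ← origin C∈ | _ , _ , oD ← origin D∈
        with C₀ , C₀∈ , refl , refl ← base oC | D₀ , D₀∈ , refl , refl ← base oD =
        mono-rank oC oD C₀∈ D₀∈ refl refl C<D (r∈side C₀∈) (⊆base oD rC∈D)
          (inclusion C₀∈ D₀∈ C<D (⊆base oD rC∈D) (⊆base oC rD∈C))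

      extends⁺ : ∀ {C D v} → C ∈ˡ 𝒞⁺ → D ∈ˡ 𝒞⁺ → rank (owner C) ℕ.< rank (owner D) →
                 v ∈ side C → v ∈ side D →
                 ∃ λ D′ → D′ ∈ˡ 𝒞⁺ × owner D′ ≡ owner D × side C ⊆ side D′
      extends⁺ C∈ D∈ C<D v∈C v∈D
        with _ , _ , oC ← origin C∈ | D≢i , _ , oD ← origin D∈
        with C₀ , C₀∈ , refl , refl ← base oC | D₀ , D₀∈ , refl , refl ← base oD
        with E , E∈ , E≡D , C₀⊆E ← extends C₀∈ D₀∈ C<D (⊆base oC v∈C) (⊆base oD v∈D)
        with E′ , E′≡E , oE ← survives E∈ =
        E′ , origin⁺ (λ eq → D≢i (trans (sym E≡D) (trans (sym E′≡E) eq))) oE ,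
        trans E′≡E E≡D ,
        mono-rank oC oE C₀∈ E∈ refl (sym E′≡E)
          (subst (λ j → rank _ ℕ.< rank j) (sym (trans E′≡E E≡D)) C<D)
          (⊆base oC v∈C) (C₀⊆E (⊆base oC v∈C)) C₀⊆E

      weightSum⁺ : ∀ {j} → j ∈ T - i → totalWeight G (ownedBy G j 𝒞⁺) ≡ 1ℚ
      weightSum⁺ {j} j∈ with j∈T , j∉i ← x∈p─q⁻ T ⁅ i ⁆ j∈ = begin
        μ (owned? G j) 𝒞⁺     ≡⟨ cong (μ (owned? G j)) 𝒞⁺≡ ⟩
        μ (owned? G j) (filter (λ C → ¬? (owner C Fin.≟ i)) pieces)
                              ≡⟨ μ-filter-superset (owned? G j) (λ C → ¬? (owner C Fin.≟ i)) pieces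
                                   (λ { _ refl refl → j∉i (x∈⁅x⁆ i) }) ⟩
        μ (owned? G j) pieces ≡⟨ μ-pieces (owned? G j) ⟩
        _                     ≡⟨ μ-decompose (λ k _ → k Fin.≟ j) ⟨
        μ (owned? G j) 𝒞      ≡⟨ weightSum j∈T ⟩
        1ℚ                    ∎
        where open ≡-Reasoning

    cross-outside : ∀ {u v} → u ∉ N → v ∉ N → cross u v 𝒞⁺ ℚ.≤ cross u v 𝒞
    cross-outside {u} {v} u∉N v∉N = begin
      cross u v 𝒞⁺                                              ≤⟨ μ-𝒞⁺-≤ (crosses? u v) ⟩
      cross u v A ℚ.+ (μ (crosses? u v ∘ shave G N) H ℚ.+ cross u v R)
        ≡⟨ cong (λ h → cross u v A ℚ.+ (h ℚ.+ cross u v R)) (μ-cong _ (crosses? u v) H to from) ⟩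
      cross u v A ℚ.+ (cross u v H ℚ.+ cross u v R)
        ≡⟨ μ-decompose (λ _ X → (u ∈? X) ×-dec ¬? (v ∈? X)) ⟨
      cross u v 𝒞                                               ∎
      where
      open ℚ.≤-Reasoning
      to : ∀ {C} → C ∈ˡ H → u ∈ side C ─ N × v ∉ side C ─ N → u ∈ side C × v ∉ side C
      to {C} _ (u∈ , v∉) = p─q⊆p (side C) N u∈ , λ v∈ → v∉ (x∈p∧x∉q⇒x∈p─q v∈ v∉N)
      from : ∀ {C} → C ∈ˡ H → u ∈ side C × v ∉ side C → u ∈ side C ─ N × v ∉ side C ─ N
      from {C} _ (u∈ , v∉) = x∈p∧x∉q⇒x∈p─q u∈ u∉N , λ v∈ → v∉ (p─q⊆p (side C) N v∈)

    module _ {u v : Vertex G} where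

      crossing-outside : ∀ {C} → u ∉ N → v ∉ N → C ∈ˡ 𝒞⁺ → u ∈ side C → v ∉ side C →
        ∃ λ D → D ∈ˡ 𝒞 × owner D ≡ owner C × u ∈ side D × v ∉ side D
      crossing-outside u∉N v∉N C∈ u∈C v∉C with origin C∈
      ... | _ , _ , outside-r C∈𝒞 _ = _ , C∈𝒞 , refl , u∈C , v∉C
      ... | _ , _ , outer C∈R with D , D∈ , refl , refl ← R-base C∈R = D , D∈ , refl , u∈C , v∉C
      ... | _ , _ , inner {cut _ X _} C∈H with D , D∈ , refl , refl ← H-base C∈H =
        D , D∈ , refl , p─q⊆p X N u∈C , λ v∈ → v∉C (x∈p∧x∉q⇒x∈p─q v∈ v∉N)

      module _ (u∈N : u ∈ N) (v∉N : v ∉ N) where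

        u∈H : ∀ {C} → C ∈ˡ H → u ∈ side C
        u∈H C∈H with D , D∈ , refl , refl ← H-base C∈H = N-whole⁻ D∈ u∈N (r∈H C∈H)

        u∈R : ∀ {C} → C ∈ˡ R → u ∈ side C
        u∈R C∈R with D , D∈ , refl , refl ← R-base C∈R = N-whole⁻ D∈ u∈N (r∈R C∈R)

        u∉A : ∀ {C} → C ∈ˡ A → u ∉ side C
        u∉A C∈A u∈C with C∈ , r∉C ← ∈-filter⁻ (λ C → ¬? (r i ∈? side C)) C∈A =
          r∉C (N-whole C∈ u∈N u∈C)

        -- A cut that newly separates `v` from `u` was shaved, and `H-owner` ranks its owner before
        -- `i`.
        crossing-into : ∀ {C} → C ∈ˡ 𝒞⁺ → v ∈ side C → u ∉ side C →
          (∃ λ D → D ∈ˡ 𝒞 × v ∈ side D × u ∉ side D) ⊎ rank (owner C) ℕ.< rank i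
        crossing-into C∈ v∈C u∉C with origin C∈
        ... | _ , _ , outside-r C∈𝒞 _ = inj₁ (_ , C∈𝒞 , v∈C , u∉C)
        ... | _ , _ , outer C∈R       = contradiction (u∈R C∈R) u∉C
        ... | C≢i , _ , inner C∈H     = inj₂ (H-owner C∈H C≢i)

        cross-from-split : cross u v 𝒞 ≡ cross u v H ℚ.+ cross u v R
        cross-from-split = trans (μ-decompose (λ _ X → (u ∈? X) ×-dec ¬? (v ∈? X)))
          (trans (cong (ℚ._+ (cross u v H ℚ.+ cross u v R))
            (μ-none (crosses? u v) λ C∈ (u∈ , _) → u∉A C∈ u∈)) (ℚ.+-identityˡ _))

        cross-from≤ : cross u v 𝒞⁺ ℚ.≤ cross u v R
        cross-from≤ = ℚ.≤-trans (μ-𝒞⁺-≤ (crosses? u v)) (ℚ.≤-reflexive (trans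
          (cong₂ (λ a h → a ℚ.+ (h ℚ.+ cross u v R))
            (μ-none (crosses? u v) λ C∈ (u∈ , _) → u∉A C∈ u∈)
            (μ-none (crosses? u v ∘ shave G N) {H} λ {C} _ (u∈ , _) →
              proj₂ (x∈p─q⁻ (side C) N u∈) u∈N))
          (trans (ℚ.+-identityˡ _) (ℚ.+-identityˡ _))))

        -- A cut of K¹ containing `v` gives up `u` together with `N` and starts to load the edge
        -- from the other side; nothing else can be added.
        cross-into≤ : cross v u 𝒞⁺ ℚ.≤ cross v u 𝒞 ℚ.+ μ (λ C → v ∈? side C) H
        cross-into≤ = begin
          cross v u 𝒞⁺
            ≤⟨ μ-𝒞⁺-≤ (crosses? v u) ⟩
          cross v u A ℚ.+ (μ (crosses? v u ∘ shave G N) H ℚ.+ cross v u R)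
            ≡⟨ cong₂ (λ h o → cross v u A ℚ.+ (h ℚ.+ o))
                 (μ-cong (crosses? v u ∘ shave G N) (λ C → v ∈? side C) H
                   (λ {C} _ (v∈ , _) → p─q⊆p (side C) N v∈)
                   (λ {C} _ v∈ → x∈p∧x∉q⇒x∈p─q v∈ v∉N ,
                                 λ u∈ → proj₂ (x∈p─q⁻ (side C) N u∈) u∈N))
                 R≡0 ⟩
          cross v u A ℚ.+ (μ (λ C → v ∈? side C) H ℚ.+ 0ℚ)
            ≡⟨ solve 2 (λ a h → a :+ (h :+ con 0ℚ) := (a :+ (con 0ℚ :+ con 0ℚ)) :+ h) refl
                 (cross v u A) (μ (λ C → v ∈? side C) H) ⟩
          (cross v u A ℚ.+ (0ℚ ℚ.+ 0ℚ)) ℚ.+ μ (λ C → v ∈? side C) H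
            ≡⟨ cong (ℚ._+ μ (λ C → v ∈? side C) H) (sym (trans
                 (μ-decompose (λ _ X → (v ∈? X) ×-dec ¬? (u ∈? X)))
                 (cong₂ (λ h o → cross v u A ℚ.+ (h ℚ.+ o))
                   (μ-none (crosses? v u) λ C∈ (_ , u∉) → u∉ (u∈H C∈)) R≡0))) ⟩
          cross v u 𝒞 ℚ.+ μ (λ C → v ∈? side C) H ∎
          where
          open ℚ.≤-Reasoning
          open +-*-Solver
          R≡0 : cross v u R ≡ 0ℚ
          R≡0 = μ-none (crosses? v u) λ C∈ (_ , u∉) → u∉ (u∈R C∈)

        H-split : 1ℚ ≡ cross u v H ℚ.+ μ (λ C → v ∈? side C) H
        H-split = trans (sym ΣH) (trans (sym (μ-all (λ C → u ∈? side C) u∈H))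
          (μ-⊎ (crosses? u v) (λ C → v ∈? side C) (λ C → u ∈? side C) H by-v
            (λ _ → proj₁) (λ C∈ _ → u∈H C∈) (λ (_ , v∉) v∈ → v∉ v∈)))
          where
          by-v : ∀ {C} → C ∈ˡ H → u ∈ side C → (u ∈ side C × v ∉ side C) ⊎ v ∈ side C
          by-v {C} _ u∈ with v ∈? side C
          ... | yes v∈ = inj₂ v∈
          ... | no  v∉ = inj₁ (u∈ , v∉)

        -- Either the cuts of K¹ all avoid v, or all cuts beyond K¹ contain v.
        cross-inside :
          (cross u v 𝒞⁺ ℚ.+ 1ℚ ℚ.≤ cross u v 𝒞 × cross v u 𝒞⁺ ℚ.≤ cross v u 𝒞) ⊎
          (cross u v 𝒞⁺ ≡ 0ℚ × cross v u 𝒞⁺ ℚ.+ cross u v 𝒞 ℚ.≤ cross v u 𝒞 ℚ.+ 1ℚ)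
        cross-inside with any? (λ C → v ∈? side C) H
        ... | no none = inj₁
          ( subst₂ (λ h x → cross u v 𝒞⁺ ℚ.+ h ℚ.≤ x)
              (sym (trans H-split (trans (cong (cross u v H ℚ.+_) k≡0) (ℚ.+-identityʳ _))))
              (trans (ℚ.+-comm (cross u v R) (cross u v H)) (sym cross-from-split))
              (ℚ.+-monoˡ-≤ (cross u v H) cross-from≤)
          , subst (cross v u 𝒞⁺ ℚ.≤_) (trans (cong (cross v u 𝒞 ℚ.+_) k≡0) (ℚ.+-identityʳ _))
              cross-into≤ )
          where
          k≡0 : μ (λ C → v ∈? side C) H ≡ 0ℚ
          k≡0 = μ-none (λ C → v ∈? side C) λ C∈ v∈ → none (lose C∈ v∈)
        ... | yes some with C , C∈H , v∈C ← find some = inj₂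
          ( ℚ.≤-antisym (subst (cross u v 𝒞⁺ ℚ.≤_) R≡0 cross-from≤)
              (μ≥0 (crosses? u v) 𝒞⁺ (Pos⇒NonNeg (Ordered.weight>0 ordered)))
          , (begin
              cross v u 𝒞⁺ ℚ.+ cross u v 𝒞
                ≡⟨ cong (cross v u 𝒞⁺ ℚ.+_) (trans cross-from-split
                     (trans (cong (cross u v H ℚ.+_) R≡0) (ℚ.+-identityʳ _))) ⟩
              cross v u 𝒞⁺ ℚ.+ cross u v H
                ≤⟨ ℚ.+-monoˡ-≤ (cross u v H) cross-into≤ ⟩
              (cross v u 𝒞 ℚ.+ μ (λ C → v ∈? side C) H) ℚ.+ cross u v H
                ≡⟨ ℚ.+-assoc (cross v u 𝒞) _ _ ⟩
              cross v u 𝒞 ℚ.+ (μ (λ C → v ∈? side C) H ℚ.+ cross u v H)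
                ≡⟨ cong (cross v u 𝒞 ℚ.+_) (trans
                     (ℚ.+-comm (μ (λ C → v ∈? side C) H) (cross u v H)) (sym H-split)) ⟩
              cross v u 𝒞 ℚ.+ 1ℚ ∎))
          where
          open ℚ.≤-Reasoning
          beyond : ∀ {D} → D ∈ˡ R → v ∈ side D
          beyond D∈R with inner-before-outer C∈H D∈R
          ... | inj₁ (_ , refl)  = v∈C
          ... | inj₂ (C⊆D , _) = C⊆D v∈C
          R≡0 : cross u v R ≡ 0ℚ
          R≡0 = μ-none (crosses? u v) λ D∈ (_ , v∉) → v∉ (beyond D∈)

        -- The chain starts with a cut of i, and its cuts avoiding v come first.
        own-crossing : ∀ {D} → D ∈ˡ 𝒞 → u ∈ side D → v ∉ side D →
          ∃ λ C → C ∈ˡ 𝒞 × owner C ≡ i × u ∈ side C × v ∉ side C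
        own-crossing D∈ u∈D v∉D with C , C∈ , refl , C⊆ ← innermost =
          C , C∈ , refl , N-whole⁻ C∈ u∈N (r∈side C∈) ,
          λ v∈C → v∉D (C⊆ D∈ (N-whole D∈ u∈N u∈D) v∈C)

-- Meta-nodes and integral loads

module _ {A : Set} {P Q : A → Set} (P? : Decidable P) (Q? : Decidable Q) where

  count-mono : ∀ xs → (∀ {x} → x ∈ˡ xs → P x → Q x) →
               length (filter P? xs) ℕ.≤ length (filter Q? xs)
  count-mono []       f = ℕ.z≤n
  count-mono (x ∷ xs) f with ih ← count-mono xs (f ∘ there) | P? x | Q? x
  ... | yes _ | yes _ = ℕ.s≤s ih
  ... | yes p | no ¬q = contradiction (f (here refl) p) ¬q
  ... | no _  | yes _ = ℕ.m≤n⇒m≤1+n ih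
  ... | no _  | no _  = ih

  -- The exception `i` occurs at most once in a list without repetitions; behind it `count-mono`
  -- takes over.
  count-suc : ∀ {i} xs → Unique xs → (∀ {x} → x ≢ i → P x → Q x) →
              (∀ x → x ≡ i ⊎ x ≢ i) → length (filter P? xs) ℕ.≤ suc (length (filter Q? xs))
  count-suc []       _            f i? = ℕ.z≤n
  count-suc (x ∷ xs) (x∉ ∷ uniq) f i? with P? x | Q? x | i? x
  ... | no _  | no _  | _         = count-suc xs uniq f i?
  ... | no _  | yes _ | _         = ℕ.m≤n⇒m≤1+n (count-suc xs uniq f i?)
  ... | yes _ | yes _ | _         = ℕ.s≤s (count-suc xs uniq f i?)
  ... | yes p | no ¬q | inj₂ x≢i  = contradiction (f x≢i p) ¬q
  ... | yes p | no ¬q | inj₁ refl =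
    ℕ.s≤s (count-mono xs λ y∈ → f λ { refl → All.lookup x∉ y∈ refl })

module _ (G : MCP) where
  open MCP G

  record Partition (M : Vertex G → Subset #V) : Set where
    field
      self : ∀ v → v ∈ M v
      same : ∀ {u v} → u ∈ M v → M u ≡ M v

    ≡⇒∈ : ∀ {u v} → M u ≡ M v → u ∈ M v
    ≡⇒∈ {u} eq = subst (u ∈_) eq (self u)

    swap-∈ : ∀ {u v} → u ∈ M v → v ∈ M u
    swap-∈ {v = v} u∈ = subst (v ∈_) (sym (same u∈)) (self v)

    trans-∈ : ∀ {u v w} → u ∈ M v → v ∈ M w → u ∈ M w
    trans-∈ {u} u∈ v∈ = subst (u ∈_) (same v∈) u∈

  Whole : (Vertex G → Subset #V) → Subset #V → Set
  Whole M X = ∀ {u v} → u ∈ M v → v ∈ X → u ∈ X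

  module _ {M : Vertex G → Subset #V} (part : Partition M) (e : Edge G) where
    open Partition part
    private
      p = proj₁ (ends e)
      q = proj₂ (ends e)
      UV = M p ∪ M q

      merge-in : ∀ {w} → w ∈ UV → mergeEdge G M e w ≡ UV
      merge-in {w} w∈ = cong (if_then UV else M w) (dec-true (w ∈? UV) w∈)

      merge-out : ∀ {w} → w ∉ UV → mergeEdge G M e w ≡ M w
      merge-out {w} w∉ = cong (if_then UV else M w) (dec-false (w ∈? UV) w∉)

      UV-closed : ∀ {u v} → u ∈ M v → u ∈ UV → v ∈ UV
      UV-closed {u} {v} u∈v u∈UV with x∈p∪q⁻ (M p) (M q) u∈UV
      ... | inj₁ u∈p = x∈p∪q⁺ (inj₁ (trans-∈ (swap-∈ u∈v) u∈p))
      ... | inj₂ u∈q = x∈p∪q⁺ (inj₂ (trans-∈ (swap-∈ u∈v) u∈q))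

    merge-⊇ : ∀ v → M v ⊆ mergeEdge G M e v
    merge-⊇ v {x} x∈ with v ∈? UV
    ... | no  v∉ = x∈
    ... | yes v∈ = UV-closed (swap-∈ x∈) v∈

    merge-partition : Partition (mergeEdge G M e)
    merge-partition = record { self = λ v → merge-⊇ v (self v) ; same = same′ }
      where
      same′ : ∀ {u v} → u ∈ mergeEdge G M e v → mergeEdge G M e u ≡ mergeEdge G M e v
      same′ {u} {v} u∈ with v ∈? UV
      ... | yes v∈ = merge-in u∈
      ... | no  v∉ = trans (merge-out (λ u∈UV → v∉ (UV-closed u∈ u∈UV))) (same u∈)

    merge-ends : mergeEdge G M e p ≡ mergeEdge G M e q
    merge-ends = trans (merge-in (x∈p∪q⁺ (inj₁ (self p)))) (sym (merge-in (x∈p∪q⁺ (inj₂ (self q)))))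

    merge-closed : ∀ {X} → Whole M X → (p ∈ X → q ∈ X) → (q ∈ X → p ∈ X) →
                  Whole (mergeEdge G M e) X
    merge-closed {X} closed p⇒q q⇒p {u} {v} u∈ v∈X with v ∈? UV
    ... | no  _  = closed u∈ v∈X
    ... | yes v∈ = from (x∈p∪q⁻ (M p) (M q) u∈) (to (x∈p∪q⁻ (M p) (M q) v∈))
      where
      to : v ∈ M p ⊎ v ∈ M q → p ∈ X
      to (inj₁ v∈p) = closed (swap-∈ v∈p) v∈X
      to (inj₂ v∈q) = q⇒p (closed (swap-∈ v∈q) v∈X)
      from : u ∈ M p ⊎ u ∈ M q → p ∈ X → u ∈ X
      from (inj₁ u∈p) p∈ = closed u∈p p∈
      from (inj₂ u∈q) p∈ = closed u∈q (p⇒q p∈)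

  merges-partition : ∀ {M} es → Partition M → Partition (foldl (mergeEdge G) M es)
  merges-partition []       part = part
  merges-partition (e ∷ es) part = merges-partition es (merge-partition part e)

  merges-⊇ : ∀ {M} es → Partition M → ∀ v → M v ⊆ foldl (mergeEdge G) M es v
  merges-⊇ []       part v x∈ = x∈
  merges-⊇ (e ∷ es) part v x∈ = merges-⊇ es (merge-partition part e) v (merge-⊇ part e v x∈)

  merges-ends : ∀ {M} es → Partition M → ∀ {e} → e ∈ˡ es →
                foldl (mergeEdge G) M es (proj₁ (ends e)) ≡
                foldl (mergeEdge G) M es (proj₂ (ends e))
  merges-ends {M} (e ∷ es) part (here refl) = Partition.same (merges-partition es part′)
    (merges-⊇ es part′ _ (Partition.≡⇒∈ part′ (merge-ends part e)))
    where part′ = merge-partition part e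
  merges-ends (e ∷ es) part (there e∈) = merges-ends es (merge-partition part e) e∈

  -- Meant for cuts and edges of load 0: no cut separates the ends of such an edge, so cuts remain
  -- unions of meta-nodes under merging.
  merges-closed : ∀ {M X} es → Partition M → Whole M X →
                 (∀ {e} → e ∈ˡ es → let (p , q) = ends e in (p ∈ X → q ∈ X) × (q ∈ X → p ∈ X)) →
                 Whole (foldl (mergeEdge G) M es) X
  merges-closed []       part closed f = closed
  merges-closed (e ∷ es) part closed f = merges-closed es (merge-partition part e)
    (merge-closed part e closed (proj₁ (f (here refl))) (proj₂ (f (here refl)))) (f ∘ there)

  module _ (𝒜 : IntegralFamily G) (i : Terminal G) (X : Subset #V) where
    private
      𝒜⁺ : IntegralFamily G
      𝒜⁺ = Functional.updateAt 𝒜 i λ _ → just X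

      loads? : ∀ (𝒜 : IntegralFamily G) (e : Edge G) →
               Decidable (λ j → Maybe.Any (λ X → e ∈ δ G X) (𝒜 j))
      loads? 𝒜 e j = Maybe.dec (λ X → e ∈? δ G X) (𝒜 j)

    assign-here : 𝒜⁺ i ≡ just X
    assign-here = Functional.updateAt-updates i 𝒜

    assign-there : ∀ {j} → j ≢ i → 𝒜⁺ j ≡ 𝒜 j
    assign-there {j} j≢i = Functional.updateAt-minimal j i 𝒜 j≢i

    integralLoad-suc : ∀ e → integralLoad G 𝒜⁺ e ℕ.≤ suc (integralLoad G 𝒜 e)
    integralLoad-suc e = count-suc (loads? 𝒜⁺ e) (loads? 𝒜 e) (allFin #T) (allFin⁺ #T)
      (λ j≢i → subst (Maybe.Any (λ X → e ∈ δ G X)) (assign-there j≢i)) decide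
      where
      decide : ∀ j → j ≡ i ⊎ j ≢ i
      decide j with j Fin.≟ i
      ... | yes j≡i = inj₁ j≡i
      ... | no  j≢i = inj₂ j≢i

    integralLoad-same : ∀ e → e ∉ δ G X → integralLoad G 𝒜⁺ e ℕ.≤ integralLoad G 𝒜 e
    integralLoad-same e e∉ = count-mono (loads? 𝒜⁺ e) (loads? 𝒜 e) (allFin #T) old
      where
      old : ∀ {j} → j ∈ˡ allFin #T → Maybe.Any (λ X → e ∈ δ G X) (𝒜⁺ j) →
            Maybe.Any (λ X → e ∈ δ G X) (𝒜 j)
      old {j} _ p with j Fin.≟ i
      ... | no j≢i = subst (Maybe.Any (λ X → e ∈ δ G X)) (assign-there j≢i) p
      ... | yes refl with subst (Maybe.Any (λ X → e ∈ δ G X)) assign-here p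
      ...   | Maybe.just e∈ = contradiction e∈ e∉

    integralLoad-mono : 𝒜 i ≡ nothing → ∀ e → integralLoad G 𝒜 e ℕ.≤ integralLoad G 𝒜⁺ e
    integralLoad-mono 𝒜i≡ e = count-mono (loads? 𝒜 e) (loads? 𝒜⁺ e) (allFin #T) new
      where
      new : ∀ {j} → j ∈ˡ allFin #T → Maybe.Any (λ X → e ∈ δ G X) (𝒜 j) →
            Maybe.Any (λ X → e ∈ δ G X) (𝒜⁺ j)
      new {j} _ p with j Fin.≟ i
      ... | no j≢i = subst (Maybe.Any (λ X → e ∈ δ G X)) (sym (assign-there j≢i)) p
      ... | yes refl with () ← subst (Maybe.Any (λ X → e ∈ δ G X)) 𝒜i≡ p

-- The invariant

least-time : ∀ {P : ℕ → Set} → Decidable P → ∀ {n} → P n →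
             ∃ λ t → t ℕ.≤ n × P t × (∀ {t′} → t′ ℕ.< t → ¬ P t′)
least-time {P} P? {n} p = go n 0 (ℕ.+-identityʳ n) λ ()
  where
  go : ∀ fuel t → fuel ℕ.+ t ≡ n → (∀ {t′} → t′ ℕ.< t → ¬ P t′) →
       ∃ λ t → t ℕ.≤ n × P t × (∀ {t′} → t′ ℕ.< t → ¬ P t′)
  go fuel t eq before with P? t
  ... | yes pt = t , subst (t ℕ.≤_) eq (ℕ.m≤n+m t fuel) , pt , before
  go zero       t refl before | no ¬pt = contradiction p ¬pt
  go (suc fuel) t eq   before | no ¬pt = go fuel (suc t) (trans (ℕ.+-suc fuel t) eq)
    λ { (ℕ.s≤s t′≤t) → earlier-or-now (ℕ.m≤n⇒m<n∨m≡n t′≤t) }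
    where
    earlier-or-now : ∀ {t′} → t′ ℕ.< t ⊎ t′ ≡ t → ¬ P t′
    earlier-or-now (inj₁ t′<t) = before t′<t
    earlier-or-now (inj₂ refl) = ¬pt

module _ (G : MCP) (rank : Terminal G → ℕ) (T : Subset (MCP.#T G)) where
  open MCP G
  open Weighted (weight {G})

  Ends : Edge G → Vertex G → Vertex G → Set
  Ends e u v = ends e ≡ (u , v) ⊎ ends e ≡ (v , u)

  -- B w a: at some earlier iteration the selected terminal, the terminal w and the
  -- vertex a were all in one meta-node.
  module _ (B : Terminal G → Vertex G → Set) (s : State G) where
    open State s

    -- All cuts through an edge uv contain u, so only a terminal in M(u) may be selected
    -- while the edge carries load.
    record Facing (u v : Vertex G) : Set where
      field
        v⇒u     : ∀ {C} → C ∈ˡ 𝒞 → v ∈ side C → u ∈ side C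
        cross≤1 : cross G u v 𝒞 ℚ.≤ 1ℚ
        0<cross  : 0ℚ ℚ.< cross G u v 𝒞

    -- To be played off against `CrossingBelow`: a selected terminal in the meta-node of `u` owns a
    -- cut through the edge, so its rank is below `ρ`, whereas terminals with a past at the end `a`
    -- are ranked above `ρ`.
    Outranked : ℕ → Vertex G → Set
    Outranked ρ a = ∀ {w} → w ∈ T′ → B w a ⊎ r w ≡ a → ρ ℕ.< rank w

    CrossingBelow : ℕ → Vertex G → Vertex G → Set
    CrossingBelow ρ u v = ∀ {C} → C ∈ˡ 𝒞 → u ∈ side C → v ∉ side C → rank (owner C) ℕ.< ρ

    -- An iteration with a terminal in M(u) turns the edge uv if it leaves no cut that
    -- contains u but not v.  The constructors count the turns so far.
    data Phase (e : Edge G) : Set where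
      unturned : ∀ d → integralLoad G 𝒜 e ℕ.+ suc d ℕ.≤ cap e →
                 load G 𝒞 e ℚ.≤ fromℕ (suc d) → Phase e
      once     : ∀ {u v} → Ends e u v → Facing u v → integralLoad G 𝒜 e ℕ.≤ cap e → Phase e
      twice    : ∀ {u v} ρ → Ends e u v → Facing u v → integralLoad G 𝒜 e ℕ.≤ cap e ℕ.+ 1 →
                 CrossingBelow ρ u v → Outranked ρ v → Phase e
      thrice   : ∀ {u v} ρ → Ends e u v → Facing u v → integralLoad G 𝒜 e ℕ.≤ cap e ℕ.+ 2 →
                 CrossingBelow ρ u v → Outranked ρ v → Outranked ρ u → Phase e

    Live : Edge G → Set
    Live e = M (proj₁ (ends e)) ≢ M (proj₂ (ends e))

    -- An edge is `locked` once it has been loaded inside a meta-node. Then `t` is a time at which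
    -- its ends shared a meta-node such that every remaining terminal in it is related by `B` to
    -- every vertex in it.
    data EdgeInvariant (e : Edge G) : Set where
      live   : Live e → Phase e → EdgeInvariant e
      merged : M (proj₁ (ends e)) ≡ M (proj₂ (ends e)) →
               integralLoad G 𝒜 e ℕ.≤ cap e ℕ.+ 2 → EdgeInvariant e
      locked : ∀ {t} → t ℕ.≤ now →
               metaAt t (proj₁ (ends e)) ≡ metaAt t (proj₂ (ends e)) →
               (∀ {w a} → w ∈ T′ → r w ∈ metaAt t (proj₁ (ends e)) →
                 a ∈ metaAt t (proj₁ (ends e)) → B w a) →
               integralLoad G 𝒜 e ℕ.≤ cap e ℕ.+ 3 → EdgeInvariant e

    record Assigned : Set where
      field
        T′⊆T      : T′ ⊆ T
        total     : ∀ {i} → i ∈ T → i ∈ T′ ⊎ ∃ λ X → 𝒜 i ≡ just X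
        pending   : ∀ {i} → i ∈ T′ → 𝒜 i ≡ nothing
        assigned∈T : ∀ {i X} → 𝒜 i ≡ just X → i ∈ T
        isCut     : ∀ {i X} → 𝒜 i ≡ just X → IsCut G X
        r∈side    : ∀ {i X} → 𝒜 i ≡ just X → r i ∈ X
        apart     : ∀ a {i j} → i ∈ S a → j ∈ S a → i ≢ j →
                    (∀ {C} → C ∈ˡ 𝒞 → owner C ≡ i → r j ∉ side C) ⊎
                    (∀ {C} → C ∈ˡ 𝒞 → owner C ≡ j → r i ∉ side C)
        apart-pending : ∀ a {i j X} → i ∈ S a → j ∈ S a → i ≢ j → 𝒜 i ≡ just X → j ∈ T′ → r j ∉ X
        apart-done : ∀ a {i j X Y} → i ∈ S a → j ∈ S a → i ≢ j →
                    𝒜 i ≡ just X → 𝒜 j ≡ just Y → r j ∉ X ⊎ r i ∉ Y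

    record RunInvariant : Set where
      field
        ordered    : Ordered G rank T′ 𝒞
        partition  : ∀ {t} → t ℕ.≤ now → Partition G (metaAt t)
        grows      : ∀ {t t′} → t ℕ.≤ t′ → t′ ℕ.≤ now → ∀ v → metaAt t v ⊆ metaAt t′ v
        singletons : ∀ v → metaAt 0 v ≡ ⁅ v ⁆
        closed     : ∀ {C} → C ∈ˡ 𝒞 → Whole G M (side C)
        B⇒node     : ∀ {w a} → B w a → r w ∈ M a
        edges      : ∀ e → EdgeInvariant e
        Y⇒live     : ∀ {e} → e ∈ Y → Live e × cap e ℕ.+ 2 ℕ.≤ integralLoad G 𝒜 e
        live⇒Y     : ∀ {e} → Live e → cap e ℕ.+ 2 ℕ.≤ integralLoad G 𝒜 e → e ∈ Y
        assigned   : Assigned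

-- One iteration preserves the invariant

∈-tabulate⁺ : ∀ {n} {P : Fin n → Set} (P? : Decidable P) {x} → P x → x ∈ tabulate (does ∘ P?)
∈-tabulate⁺ P? {x} p = Vec.lookup⇒[]= x _ (trans (Vec.lookup∘tabulate _ x) (dec-true (P? x) p))

∈-tabulate⁻ : ∀ {n} {P : Fin n → Set} (P? : Decidable P) {x} → x ∈ tabulate (does ∘ P?) → P x
∈-tabulate⁻ P? {x} x∈
  with P? x | trans (sym (Vec.lookup∘tabulate (does ∘ P?) x)) (Vec.[]=⇒lookup x∈)
... | yes p | _ = p

module _ (G : MCP) {rank : Terminal G → ℕ} (rank-injective : Injective _≡_ _≡_ rank)
         {T : Subset (MCP.#T G)} where
  open MCP G
  open Weighted (weight {G})

  module Selected {B : Terminal G → Vertex G → Set} {s : State G} (inv : RunInvariant G rank T B s)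
                  {i : Terminal G} (selectable : Selectable G s rank i) where
    open State s
    open RunInvariant inv
    open Ordered ordered using (weight>0; rank<⇒dominates; hasCut; r∈side; owner∈T)
    module Now = Partition (partition ℕ.≤-refl)

    i∈T′ : i ∈ T′
    i∈T′ = proj₁ (proj₁ selectable)

    N : Subset #V
    N = M (r i)

    -- A terminal lying in every cut around `r i` is at least as deep, hence of maximum depth too.
    -- Ranked before `i` it would dominate `i`, against the selection.
    first : ∀ {w} → w ∈ T′ → w ≢ i → (∀ {C} → C ∈ˡ 𝒞 → r i ∈ side C → r w ∈ side C) →
            rank i ℕ.< rank w
    first {w} w∈T′ w≢i deeper with ℕ.<-cmp (rank i) (rank w)
    ... | tri< i<w _ _ = i<w
    ... | tri≈ _ i≡w _ = contradiction (sym (rank-injective i≡w)) w≢i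
    ... | tri> _ _ w<i
      with C , C∈ , refl ← hasCut i∈T′ | D , D∈ , refl ← hasCut w∈T′ =
      contradiction (rank<⇒dominates D∈ C∈ w<i (r∈side D∈) (deeper C∈ (r∈side C∈)))
        (proj₂ selectable (w∈T′ , λ j∈ → ℚ.≤-trans (proj₂ (proj₁ selectable) j∈)
          (μ-mono (λ C → r i ∈? side C) (λ C → r w ∈? side C) 𝒞 (Pos⇒NonNeg weight>0) deeper)))

    first-node : ∀ {w} → w ∈ T′ → w ≢ i → r w ∈ N → rank i ℕ.< rank w
    first-node w∈T′ w≢i r∈N = first w∈T′ w≢i λ C∈ → closed C∈ r∈N

    -- The inequality y ≤ x of the introduction.
    turn : ∀ {u} → u ∈ N → ∀ v → cross G v u 𝒞 ℚ.≤ cross G u v 𝒞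
    turn {u} u∈N = deepest⇒cross≤ G ordered λ j∈ → ℚ.≤-trans (proj₂ (proj₁ selectable) j∈)
      (μ-mono (λ C → r i ∈? side C) (λ C → u ∈? side C) 𝒞 (Pos⇒NonNeg weight>0)
        λ C∈ → closed C∈ u∈N)

    -- If `v` were in the selected meta-node, `turn` would bound the positive weight crossing from
    -- `u` by the weight crossing from `v`, which is 0.
    facing-away : ∀ {u v} → Facing G rank T B s u v → v ∉ N
    facing-away {u} {v} f v∈N = ℚ.<-irrefl refl (ℚ.<-≤-trans (Facing.0<cross f)
      (subst (cross G u v 𝒞 ℚ.≤_) (none⇒cross≡0 G (Facing.v⇒u f)) (turn v∈N u)))

    facing-end : ∀ {e u v a} → Ends G rank T e u v → Facing G rank T B s u v → a ∈ N →
                 a ≡ proj₁ (ends e) ⊎ a ≡ proj₂ (ends e) → a ≡ u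
    facing-end (inj₁ refl) f a∈N (inj₁ refl) = refl
    facing-end (inj₁ refl) f a∈N (inj₂ refl) = contradiction a∈N (facing-away f)
    facing-end (inj₂ refl) f a∈N (inj₁ refl) = contradiction a∈N (facing-away f)
    facing-end (inj₂ refl) f a∈N (inj₂ refl) = refl

    N-closed : ∀ {C v} → C ∈ˡ 𝒞 → v ∈ N → v ∈ side C → r i ∈ side C
    N-closed C∈ v∈N = closed C∈ (Now.swap-∈ v∈N)

    own-crossing : ∀ {u v} → u ∈ N → v ∉ N → ∀ {D} → D ∈ˡ 𝒞 → u ∈ side D → v ∉ side D →
                   ∃ λ C → C ∈ˡ 𝒞 × owner C ≡ i × u ∈ side C × v ∉ side C
    own-crossing = Step.own-crossing G ordered rank-injective i∈T′ (Now.self (r i)) N-closed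
      (λ C∈ → closed C∈) first (proj₂ (chain-exists G ordered rank-injective (r i)))

    X⊆N : ∀ {X} → NewCut G s i X → X ⊆ N
    X⊆N (whole _)                           = λ x∈ → x∈
    X⊆N (earlier _ _ (_ , (t<now , _) , _)) = grows (ℕ.<⇒≤ t<now) ℕ.≤-refl (r i)

    r∈X : ∀ {X} → NewCut G s i X → r i ∈ X
    r∈X (whole _)                           = Now.self (r i)
    r∈X (earlier _ _ (_ , (t<now , _) , _)) = Partition.self (partition (ℕ.<⇒≤ t<now)) (r i)

    -- A vertex of `U` inside `metaAt t (r i)` would have entered by time `t`, although the first
    -- entry is at `suc t`.
    U∉X : ∀ {X a} → NewCut G s i X → U G s i a → a ∉ X
    U∉X (whole empty) a∈U a∈X = empty (_ , proj₁ (proj₂ (proj₂ a∈U)))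
    U∉X {a = a} (earlier {t} _ _ (_ , (t<now , _) , minimal)) a∈U a∈X
      with t′ , t′≤t , same , before ← least-time (λ t → metaAt t a ≡? metaAt t (r i))
             (Partition.same (partition (ℕ.<⇒≤ t<now)) a∈X) =
      ℕ.<⇒≱ (minimal a∈U (ℕ.≤-trans t′≤t (ℕ.<⇒≤ t<now) , same , before)) t′≤t

    -- A terminal that faces an edge of Y has not been in the same meta-node as its end
    -- when that meta-node was last processed.
    not-stale : ∀ {e a} → e ∈ Y → a ∈ N → a ≡ proj₁ (ends e) ⊎ a ≡ proj₂ (ends e) →
                ¬ (B i a ⊎ r i ≡ a)
    not-stale {e} {a} e∈Y a∈N a∈e stale with Y⇒live e∈Y
    ... | live-e , full with edges e
    ...   | merged eq _ = live-e eq
    ...   | locked {t} t≤ eq _ _ = live-e (Now.same (grows t≤ ℕ.≤-refl _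
              (Partition.≡⇒∈ (partition t≤) eq)))
    -- An integral load of `cap e + 2` excludes every phase but `thrice`.
    ...   | live _ (unturned d small _) =
              ℕ.<⇒≱ (ℕ.<-≤-trans (ℕ.m<m+n (integralLoad G 𝒜 e) ℕ.z<s) small)
              (ℕ.≤-trans (ℕ.m≤m+n _ 2) full)
    ...   | live _ (once _ _ small) = ℕ.<⇒≱ (ℕ.m<m+n (cap e) ℕ.z<s) (ℕ.≤-trans full small)
    ...   | live _ (twice _ _ _ small _ _) =
              ℕ.<⇒≱ (ℕ.+-monoʳ-< (cap e) (ℕ.s<s ℕ.z<s)) (ℕ.≤-trans full small)
    ...   | live _ (thrice {u} {v} ρ ends≡ f _ below _ above) = go (facing-end ends≡ f a∈N a∈e)
      where
      go : a ≡ u → Empty.⊥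
      go refl with any? (crosses? G a v) 𝒞
      ... | no none = ℚ.<-irrefl (sym (μ-none (crosses? G a v) λ D∈ p → none (lose D∈ p)))
                        (Facing.0<cross f)
      ... | yes some
        with D , D∈ , a∈D , v∉D ← find some
        -- `i` itself owns a crossing cut, so its rank is below `ρ`; being stale, it would also be
        -- above.
        with C , C∈ , refl , a∈C , v∉C ← own-crossing a∈N (facing-away f) D∈ a∈D v∉D =
        ℕ.<-asym (below C∈ a∈C v∉C) (above i∈T′ stale)

    no-abort : ∀ {a} → U G s i a → a ≢ r i
    no-abort (a∈N , e , e∈E , a∈e) refl = not-stale (proj₁ (x∈p∩q⁻ Y _ e∈E)) a∈N a∈e (inj₂ refl)

    U-nonempty : Nonempty (E G s i) → ∃ (U G s i)
    U-nonempty (e , e∈E) with separates⁻ G N e (proj₂ (x∈p∩q⁻ Y _ e∈E))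
    ... | inj₁ (u∈ , _) = _ , u∈ , e , e∈E , inj₁ refl
    ... | inj₂ (v∈ , _) = _ , v∈ , e , e∈E , inj₂ refl

    -- At time 0 the meta-node of `r i` holds only `r i`, which is no member of `U` by `no-abort`.
    -- The first entry thus happens at some `suc t`, and there is a meta-node just before it.
    newCut : ∃ (NewCut G s i)
    newCut with nonempty? (E G s i)
    ... | no  empty = N , whole empty
    ... | yes ne
      with u , u∈U ← U-nonempty ne
      with least-time entered? {now} (u , u∈U , Now.same (proj₁ u∈U))
      where
      U? : Decidable (U G s i)
      U? u = (u ∈? N) ×-dec Fin.any? λ e → (e ∈? E G s i) ×-dec
               ((u Fin.≟ proj₁ (ends e)) ⊎-dec (u Fin.≟ proj₂ (ends e)))
      entered? : Decidable (λ t → ∃ λ u → U G s i u × metaAt t u ≡ metaAt t (r i))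
      entered? t = Fin.any? λ u → U? u ×-dec (metaAt t u ≡? metaAt t (r i))
    ... | zero , _ , (a , a∈U , same) , _ = contradiction
      (x∈⁅y⁆⇒x≡y (r i) (subst (a ∈_)
        (trans (sym (singletons a)) (trans same (singletons (r i)))) (x∈⁅x⁆ a)))
      (no-abort a∈U)
    ... | suc t , t≤ , (a , a∈U , same) , before = metaAt t (r i) ,
      earlier ne (λ r∈U → no-abort r∈U refl)
        (a∈U , (t≤ , same , λ t′< eq → before t′< (a , a∈U , eq)) ,
          λ {u′} u′∈U (_ , eq , _) → ℕ.≮⇒≥ λ t′< → before t′< (u′ , u′∈U , eq))

    -- The history `B` extended by the present iteration.
    Stale : Terminal G → Vertex G → Set
    Stale w a = B w a ⊎ (r w ∈ N × a ∈ N)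

    -- The state after the iteration

    module Transition {X : Subset #V} {L : Family G} (new : NewCut G s i X)
                      (chain : IsChain G rank 𝒞 (r i) L) where
      open Step G ordered rank-injective i∈T′ (Now.self (r i)) N-closed (λ C∈ → closed C∈)
             first chain
        using (𝒞⁺; origin; base; ⊆base; outside-r; outer; inner; R-base; H-base;
               cross-outside; cross-inside; crossing-outside; crossing-into)
        renaming (ordered to ordered⁺)

      s⁺ : State G
      s⁺ = update G s i X L

      module Next = State s⁺

      load⁺ : Edge G → ℚ
      load⁺ = load G 𝒞⁺

      A A⁺ : Edge G → ℕ
      A  = integralLoad G 𝒜
      A⁺ = integralLoad G Next.𝒜

      zeroLoad : Subset #E
      zeroLoad = tabulate λ e → does (load⁺ e ℚ.≟ 0ℚ)

      merging : List (Edge G)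
      merging = filter (_∈? zeroLoad) (allFin #E)

      M⁺ : Vertex G → Subset #V
      M⁺ = foldl (mergeEdge G) M merging

      metaAt-old : ∀ {t} → t ℕ.≤ now → Next.metaAt t ≡ metaAt t
      metaAt-old {t} t≤ = cong (if_then metaAt t else M⁺) (dec-true (t ℕ.≤? now) t≤)

      metaAt-new : Next.M ≡ M⁺
      metaAt-new = cong (if_then metaAt (suc now) else M⁺)
        (dec-false (suc now ℕ.≤? now) (ℕ.<-irrefl refl))

      zeroLoad⁺ : ∀ {e} → load⁺ e ≡ 0ℚ → e ∈ zeroLoad
      zeroLoad⁺ = ∈-tabulate⁺ (λ e → load⁺ e ℚ.≟ 0ℚ)

      zeroLoad⁻ : ∀ {e} → e ∈ zeroLoad → load⁺ e ≡ 0ℚ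
      zeroLoad⁻ = ∈-tabulate⁻ (λ e → load⁺ e ℚ.≟ 0ℚ)

      pos⁺ : Pos 𝒞⁺
      pos⁺ = Ordered.weight>0 ordered⁺

      closed-before : ∀ {C} → C ∈ˡ 𝒞⁺ → Whole G M (side C)
      closed-before C∈ {u} {v} u∈v v∈C with origin C∈
      ... | _ , _ , outside-r C∈𝒞 _ = closed C∈𝒞 u∈v v∈C
      ... | _ , _ , outer C∈R with D , D∈ , refl , refl ← R-base C∈R = closed D∈ u∈v v∈C
      ... | _ , _ , inner {cut _ Z _} C∈H with D , D∈ , refl , refl ← H-base C∈H =
        let v∈Z , v∉N = x∈p─q⁻ Z N v∈C in
        x∈p∧x∉q⇒x∈p─q (closed D∈ u∈v v∈Z) (λ u∈N → v∉N (Now.trans-∈ (Now.swap-∈ u∈v) u∈N))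

      load≡0⇒uncrossed : ∀ {e C} → load⁺ e ≡ 0ℚ → C ∈ˡ 𝒞⁺ → e ∉ δ G (side C)
      load≡0⇒uncrossed {e} ≡0 C∈ e∈ =
        ℚ.<-irrefl (sym ≡0) (μ>0 (λ C → e ∈? δ G (side C)) pos⁺ C∈ e∈)

      closed⁺ : ∀ {C} → C ∈ˡ 𝒞⁺ → Whole G Next.M (side C)
      closed⁺ {C} C∈ = subst (λ M → Whole G M (side C)) (sym metaAt-new)
        (merges-closed G merging (partition ℕ.≤-refl) (closed-before C∈) λ {e} e∈ →
          let uncrossed = load≡0⇒uncrossed
                (zeroLoad⁻ (proj₂ (∈-filter⁻ (_∈? zeroLoad) {xs = allFin #E} e∈))) C∈
          in (λ p∈ → decidable-stable (_ ∈? side C) λ q∉ →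
               uncrossed (separates⁺ G (side C) e (inj₁ (p∈ , q∉))))
           , (λ q∈ → decidable-stable (_ ∈? side C) λ p∉ →
               uncrossed (separates⁺ G (side C) e (inj₂ (q∈ , p∉)))))

      partition⁺ : ∀ {t} → t ℕ.≤ suc now → Partition G (Next.metaAt t)
      partition⁺ t≤ with ℕ.m≤n⇒m<n∨m≡n t≤
      ... | inj₁ (ℕ.s≤s t≤now) = subst (Partition G) (sym (metaAt-old t≤now)) (partition t≤now)
      ... | inj₂ refl = subst (Partition G) (sym metaAt-new)
        (merges-partition G merging (partition ℕ.≤-refl))

      grows-now : ∀ v → M v ⊆ Next.M v
      grows-now v x∈ = subst (λ M → _ ∈ M v) (sym metaAt-new)
        (merges-⊇ G merging (partition ℕ.≤-refl) v x∈)

      grows⁺ : ∀ {t t′} → t ℕ.≤ t′ → t′ ℕ.≤ suc now → ∀ v → Next.metaAt t v ⊆ Next.metaAt t′ v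
      grows⁺ t≤t′ t′≤ v x∈ with ℕ.m≤n⇒m<n∨m≡n t′≤
      ... | inj₁ (ℕ.s≤s t′≤now) = subst (λ M → _ ∈ M v) (sym (metaAt-old t′≤now))
        (grows t≤t′ t′≤now v (subst (λ M → _ ∈ M v) (metaAt-old (ℕ.≤-trans t≤t′ t′≤now)) x∈))
      ... | inj₂ refl with ℕ.m≤n⇒m<n∨m≡n t≤t′
      ...   | inj₂ refl = x∈
      ...   | inj₁ (ℕ.s≤s t≤now) = grows-now v (grows t≤now ℕ.≤-refl v
        (subst (λ M → _ ∈ M v) (metaAt-old t≤now) x∈))

      module Next-partition = Partition (partition⁺ ℕ.≤-refl)

      B⇒node⁺ : ∀ {w a} → Stale w a → r w ∈ Next.M a
      B⇒node⁺ (inj₁ b)           = grows-now _ (B⇒node b)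
      B⇒node⁺ (inj₂ (r∈N , a∈N)) = grows-now _ (Now.trans-∈ r∈N (Now.swap-∈ a∈N))

      Live⁺ : Edge G → Set
      Live⁺ = Live G rank T Stale s⁺

      Live-before : ∀ {e} → Live⁺ e → Live G rank T B s e
      Live-before live⁺ eq = live⁺ (Next-partition.same (grows-now _ (Now.≡⇒∈ eq)))

      load≥0 : ∀ e → 0ℚ ℚ.≤ load⁺ e
      load≥0 e = μ≥0 (λ C → e ∈? δ G (side C)) 𝒞⁺ (Pos⇒NonNeg pos⁺)

      Live⇒load>0 : ∀ {e} → Live⁺ e → 0ℚ ℚ.< load⁺ e
      Live⇒load>0 {e} live⁺ with ℚ.<-cmp 0ℚ (load⁺ e)
      ... | tri< 0<l _ _ = 0<l
      ... | tri> _ _ l<0 = contradiction (load≥0 e) (<⇒≱ l<0)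
      ... | tri≈ _ 0≡l _ = contradiction
        (subst (λ M → M (proj₁ (ends e)) ≡ M (proj₂ (ends e))) (sym metaAt-new)
          (merges-ends G merging (partition ℕ.≤-refl)
            (∈-filter⁺ (_∈? zeroLoad) (∈-allFin e) (zeroLoad⁺ (sym 0≡l))))) live⁺

      -- Together with `Live⇒load>0`, being live is the same as carrying load: edges of load 0 are
      -- merged at once, and no cut splits a meta-node.
      load≢0⇒Live : ∀ {e} → load⁺ e ≢ 0ℚ → Live⁺ e
      load≢0⇒Live {e} ≢0 eq = ≢0 (μ-none (λ C → e ∈? δ G (side C)) uncrossed)
        where
        uncrossed : ∀ {C} → C ∈ˡ 𝒞⁺ → e ∉ δ G (side C)
        uncrossed {C} C∈ e∈ with separates⁻ G (side C) e e∈
        ... | inj₁ (p∈ , q∉) = q∉ (closed⁺ C∈ (Next-partition.≡⇒∈ (sym eq)) p∈)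
        ... | inj₂ (q∈ , p∉) = p∉ (closed⁺ C∈ (Next-partition.≡⇒∈ eq) q∈)

      T⁺⁻ : ∀ {w} → w ∈ T′ - i → w ∈ T′ × w ≢ i
      T⁺⁻ w∈ = let w∈T′ , w∉i = x∈p─q⁻ T′ ⁅ i ⁆ w∈ in w∈T′ , λ { refl → w∉i (x∈⁅x⁆ i) }

      A⁺≤1+A : ∀ e → A⁺ e ℕ.≤ suc (A e)
      A⁺≤1+A = integralLoad-suc G 𝒜 i X

      A⁺≤A : ∀ {e} → e ∉ δ G X → A⁺ e ℕ.≤ A e
      A⁺≤A {e} = integralLoad-same G 𝒜 i X e

      uncrossed-outside : ∀ {e} → proj₁ (ends e) ∉ N → proj₂ (ends e) ∉ N → e ∉ δ G X
      uncrossed-outside {e} p∉ q∉ e∈ with separates⁻ G X e e∈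
      ... | inj₁ (p∈X , _) = p∉ (X⊆N new p∈X)
      ... | inj₂ (q∈X , _) = q∉ (X⊆N new q∈X)

      -- The new cut lies in `N`. A live edge of `Y` with an end in it leaves `N`, so that end
      -- belongs to `U`, which the new cut avoids.
      Y-uncrossed : ∀ {e} → e ∈ Y → e ∉ δ G X
      Y-uncrossed {e} e∈Y e∈ with live-e , _ ← Y⇒live e∈Y | separates⁻ G X e e∈
      ... | inj₁ (p∈X , _) = U∉X new (X⊆N new p∈X , e , x∈p∩q⁺ (e∈Y ,
        separates⁺ G N e (inj₁ (X⊆N new p∈X ,
          λ q∈N → live-e (trans (Now.same (X⊆N new p∈X)) (sym (Now.same q∈N)))))) , inj₁ refl) p∈X
      ... | inj₂ (q∈X , _) = U∉X new (X⊆N new q∈X , e , x∈p∩q⁺ (e∈Y ,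
        separates⁺ G N e (inj₂ (X⊆N new q∈X ,
          λ p∈N → live-e (trans (Now.same p∈N) (sym (Now.same (X⊆N new q∈X))))))) , inj₂ refl) q∈X

      -- A live edge already at `cap e + 2` is in `Y` and gets no further cut; below that, one more
      -- is affordable.
      full-bound : ∀ {e} → Live G rank T B s e → A e ℕ.≤ cap e ℕ.+ 2 → A⁺ e ℕ.≤ cap e ℕ.+ 2
      full-bound {e} live-e A≤ with ℕ.m≤n⇒m<n∨m≡n A≤
      ... | inj₁ A<  = ℕ.≤-trans (A⁺≤1+A e) A<
      ... | inj₂ A≡  = ℕ.≤-trans (A⁺≤A (Y-uncrossed (live⇒Y live-e (ℕ.≤-reflexive (sym A≡))))) A≤

      suc-bound : ∀ e {k} → A e ℕ.≤ cap e ℕ.+ k → A⁺ e ℕ.≤ cap e ℕ.+ suc k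
      suc-bound e {k} A≤ = ℕ.≤-trans (A⁺≤1+A e)
        (subst (suc (A e) ℕ.≤_) (sym (ℕ.+-suc (cap e) k)) (ℕ.s≤s A≤))

      unturned-bound : ∀ {e} d → A e ℕ.+ suc d ℕ.≤ cap e → A⁺ e ℕ.+ d ℕ.≤ cap e
      unturned-bound {e} d A≤ = ℕ.≤-trans (ℕ.+-monoˡ-≤ d (A⁺≤1+A e))
        (subst (ℕ._≤ cap e) (ℕ.+-suc (A e) d) A≤)

      live-bound : ∀ {e} → Live G rank T B s e → Phase G rank T B s e → A⁺ e ℕ.≤ cap e ℕ.+ 2
      live-bound {e} _ (unturned d A≤ _) =
        ℕ.≤-trans (ℕ.m≤m+n (A⁺ e) d) (ℕ.≤-trans (unturned-bound d A≤) (ℕ.m≤m+n (cap e) 2))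
      live-bound {e} _ (once _ _ A≤) = ℕ.≤-trans (suc-bound e {0} (ℕ.≤-trans A≤ (ℕ.m≤m+n _ 0)))
        (ℕ.+-monoʳ-≤ (cap e) (ℕ.s≤s ℕ.z≤n))
      live-bound {e} _ (twice _ _ _ A≤ _ _)      = suc-bound e A≤
      live-bound     l (thrice _ _ _ A≤ _ _ _) = full-bound l A≤

      load-ends : ∀ {e u v} 𝒟 → Ends G rank T e u v → load G 𝒟 e ≡ cross G u v 𝒟 ℚ.+ cross G v u 𝒟
      load-ends {e} 𝒟 (inj₁ refl) = load≡cross G 𝒟 e
      load-ends {e} {u} {v} 𝒟 (inj₂ refl) =
        trans (load≡cross G 𝒟 e) (ℚ.+-comm (cross G v u 𝒟) (cross G u v 𝒟))

      Facing⁺ : Vertex G → Vertex G → Set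
      Facing⁺ = Facing G rank T Stale s⁺

      facing⁺ : ∀ {e u v} → Ends G rank T e u v → Live⁺ e → cross G v u 𝒞⁺ ≡ 0ℚ →
                cross G u v 𝒞⁺ ℚ.≤ 1ℚ → Facing⁺ u v
      facing⁺ {u = u} {v} ends≡ live⁺ ≡0 ≤1 = record
        { v⇒u     = cross≡0⇒none G pos⁺ ≡0
        ; cross≤1 = ≤1
        ; 0<cross = subst (0ℚ ℚ.<_)
            (trans (load-ends 𝒞⁺ ends≡) (trans (cong (cross G u v 𝒞⁺ ℚ.+_) ≡0) (ℚ.+-identityʳ _)))
            (Live⇒load>0 live⁺) }

      Outranked-out : ∀ {ρ a} → a ∉ N → Outranked G rank T B s ρ a →
                      Outranked G rank T Stale s⁺ ρ a
      Outranked-out a∉N above w∈ (inj₁ (inj₁ b))         = above (proj₁ (T⁺⁻ w∈)) (inj₁ b)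
      Outranked-out a∉N above w∈ (inj₁ (inj₂ (_ , a∈N))) = contradiction a∈N a∉N
      Outranked-out a∉N above w∈ (inj₂ eq)               = above (proj₁ (T⁺⁻ w∈)) (inj₂ eq)

      -- Meta-nodes only grow, so whoever was once together with `a` is now in `N`, where `i` has
      -- the smallest rank.
      Outranked-in : ∀ {a} → a ∈ N → Outranked G rank T Stale s⁺ (rank i) a
      Outranked-in {a} a∈N {w} w∈ p with w∈T′ , w≢i ← T⁺⁻ w∈ = first-node w∈T′ w≢i (node p)
        where
        node : Stale w a ⊎ r w ≡ a → r w ∈ N
        node (inj₁ (inj₁ b))         = Now.trans-∈ (B⇒node b) a∈N
        node (inj₁ (inj₂ (r∈N , _))) = r∈N
        node (inj₂ refl)             = a∈N

      module Outside {e u v} (ends≡ : Ends G rank T e u v) (live⁺ : Live⁺ e)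
                     (u∉N : u ∉ N) (v∉N : v ∉ N) where

        facing-outside : Facing G rank T B s u v → Facing⁺ u v
        facing-outside f = facing⁺ ends≡ live⁺
          (none⇒cross≡0 G λ {C} C∈ v∈C → decidable-stable (u ∈? side C) λ u∉C →
            let D , D∈ , _ , v∈D , u∉D = crossing-outside v∉N u∉N C∈ v∈C u∉C
            in u∉D (Facing.v⇒u f D∈ v∈D))
          (ℚ.≤-trans (cross-outside u∉N v∉N) (Facing.cross≤1 f))

        below-outside : ∀ {ρ} → CrossingBelow G rank T B s ρ u v →
                        CrossingBelow G rank T Stale s⁺ ρ u v
        below-outside below C∈ u∈C v∉C
          with D , D∈ , refl , u∈D , v∉D ← crossing-outside u∉N v∉N C∈ u∈C v∉C = below D∈ u∈D v∉D

      phase-outside : ∀ {e} → Live⁺ e → proj₁ (ends e) ∉ N → proj₂ (ends e) ∉ N →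
                      Phase G rank T B s e → Phase G rank T Stale s⁺ e
      phase-outside {e} live⁺ p∉N q∉N = go
        where
        A≤ : ∀ {n} → A e ℕ.≤ n → A⁺ e ℕ.≤ n
        A≤ = ℕ.≤-trans (A⁺≤A (uncrossed-outside p∉N q∉N))

        ∉N : ∀ {u v} → Ends G rank T e u v → u ∉ N × v ∉ N
        ∉N (inj₁ refl) = p∉N , q∉N
        ∉N (inj₂ refl) = q∉N , p∉N

        go : Phase G rank T B s e → Phase G rank T Stale s⁺ e
        go (unturned d small load≤) = unturned d
          (ℕ.≤-trans (ℕ.+-monoˡ-≤ (suc d) (A⁺≤A (uncrossed-outside p∉N q∉N))) small)
          (ℚ.≤-trans (subst₂ ℚ._≤_ (sym (load≡cross G 𝒞⁺ e)) (sym (load≡cross G 𝒞 e))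
            (ℚ.+-mono-≤ (cross-outside p∉N q∉N) (cross-outside q∉N p∉N))) load≤)
        go (once ends≡ f small) with u∉ , v∉ ← ∉N ends≡ =
          once ends≡ (Outside.facing-outside ends≡ live⁺ u∉ v∉ f) (A≤ small)
        go (twice ρ ends≡ f small below above-v) with u∉ , v∉ ← ∉N ends≡ =
          twice ρ ends≡ (Outside.facing-outside ends≡ live⁺ u∉ v∉ f) (A≤ small)
            (Outside.below-outside ends≡ live⁺ u∉ v∉ below) (Outranked-out v∉ above-v)
        go (thrice ρ ends≡ f small below above-v above-u) with u∉ , v∉ ← ∉N ends≡ =
          thrice ρ ends≡ (Outside.facing-outside ends≡ live⁺ u∉ v∉ f) (A≤ small)
            (Outside.below-outside ends≡ live⁺ u∉ v∉ below) (Outranked-out v∉ above-v)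
            (Outranked-out u∉ above-u)

      Ends-swap : ∀ {e u v} → Ends G rank T e u v → Ends G rank T e v u
      Ends-swap (inj₁ eq) = inj₂ eq
      Ends-swap (inj₂ eq) = inj₁ eq

      same-ends : ∀ {e u v u′ v′} → Ends G rank T e u v → u ∈ N → Ends G rank T e u′ v′ →
                  Facing G rank T B s u′ v′ → u′ ≡ u × v′ ≡ v
      same-ends (inj₁ refl) u∈N (inj₁ refl) f = refl , refl
      same-ends (inj₂ refl) u∈N (inj₁ refl) f = contradiction u∈N (facing-away f)
      same-ends (inj₁ refl) u∈N (inj₂ refl) f = contradiction u∈N (facing-away f)
      same-ends (inj₂ refl) u∈N (inj₂ refl) f = refl , refl

      module Turn {e u v} (ends≡ : Ends G rank T e u v) (live⁺ : Live⁺ e)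
                  (u∈N : u ∈ N) (v∉N : v ∉ N) where

        -- The depth inequality of `turn` enters here: it is what limits the load of a turned edge
        -- to 1.
        into≤1 : ∀ {y} → cross G v u 𝒞 ℚ.≤ y → y ℚ.≤ cross G u v 𝒞 →
                 cross G v u 𝒞⁺ ℚ.+ cross G u v 𝒞 ℚ.≤ cross G v u 𝒞 ℚ.+ 1ℚ → cross G v u 𝒞⁺ ℚ.≤ 1ℚ
        into≤1 ≤y y≤ bound = +-cancelʳ-≤ (cross G u v 𝒞) (ℚ.≤-trans bound
          (subst (cross G v u 𝒞 ℚ.+ 1ℚ ℚ.≤_) (ℚ.+-comm (cross G u v 𝒞) 1ℚ)
            (ℚ.+-monoˡ-≤ 1ℚ (ℚ.≤-trans ≤y y≤))))

        module _ (f : Facing G rank T B s u v) where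

          into≡0 : cross G v u 𝒞 ≡ 0ℚ
          into≡0 = none⇒cross≡0 G (Facing.v⇒u f)

          -- A facing edge cannot be reduced without turning: it carries at most 1, so losing 1
          -- would leave no load, and the edge would not be live.
          facing-turned : Facing⁺ v u
          facing-turned with cross-inside u∈N v∉N
          ... | inj₂ (≡0 , bound) = facing⁺ (Ends-swap ends≡) live⁺ ≡0
            (into≤1 ℚ.≤-refl (turn u∈N v) bound)
          ... | inj₁ (from≤ , into≤) = ⊥-elim (<⇒≱ (Live⇒load>0 live⁺) (begin
              load⁺ e                             ≡⟨ load-ends 𝒞⁺ ends≡ ⟩
              cross G u v 𝒞⁺ ℚ.+ cross G v u 𝒞⁺ ≤⟨ ℚ.+-mono-≤ from≤0 into≤ ⟩
              0ℚ ℚ.+ cross G v u 𝒞               ≡⟨ ℚ.+-identityˡ (cross G v u 𝒞) ⟩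
              cross G v u 𝒞                      ≡⟨ into≡0 ⟩
              0ℚ                                 ∎))
            where
            open ℚ.≤-Reasoning
            from≤0 : cross G u v 𝒞⁺ ℚ.≤ 0ℚ
            from≤0 = +-cancelʳ-≤ 1ℚ {cross G u v 𝒞⁺} {0ℚ} (begin
              cross G u v 𝒞⁺ ℚ.+ 1ℚ ≤⟨ from≤ ⟩
              cross G u v 𝒞         ≤⟨ Facing.cross≤1 f ⟩
              1ℚ                    ≡⟨ ℚ.+-identityˡ 1ℚ ⟨
              0ℚ ℚ.+ 1ℚ             ∎)

          below-turned : CrossingBelow G rank T Stale s⁺ (rank i) v u
          below-turned C∈ v∈C u∉C with crossing-into u∈N v∉N C∈ v∈C u∉C
          ... | inj₁ (D , D∈ , v∈D , u∉D) = contradiction (Facing.v⇒u f D∈ v∈D) u∉D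
          ... | inj₂ C<i                  = C<i

          i-below : ∀ {ρ} → CrossingBelow G rank T B s ρ u v → rank i ℕ.< ρ
          i-below below with any? (crosses? G u v) 𝒞
          ... | no none = ⊥-elim (ℚ.<-irrefl
            (sym (μ-none (crosses? G u v) λ D∈ p → none (lose D∈ p))) (Facing.0<cross f))
          ... | yes some
            with D , D∈ , u∈D , v∉D ← find some
            with C , C∈ , refl , u∈C , v∉C ← own-crossing u∈N v∉N D∈ u∈D v∉D = below C∈ u∈C v∉C

        phase-turned : Phase G rank T B s e → Phase G rank T Stale s⁺ e
        phase-turned (unturned d small load≤) with cross-inside u∈N v∉N
        -- The slack `suc d` pays for the cut of the first turn, so the integral load does not
        -- exceed the capacity.
        ... | inj₂ (≡0 , bound) = once (Ends-swap ends≡)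
          (facing⁺ (Ends-swap ends≡) live⁺ ≡0 (into≤1 ℚ.≤-refl (turn u∈N v) bound))
          (ℕ.≤-trans (ℕ.m≤m+n (A⁺ e) d) (unturned-bound d small))
        ... | inj₁ (from≤ , into≤) = reduce d small (+-cancelʳ-≤ 1ℚ (begin
            load⁺ e ℚ.+ 1ℚ
              ≡⟨ cong (ℚ._+ 1ℚ) (load-ends 𝒞⁺ ends≡) ⟩
            (cross G u v 𝒞⁺ ℚ.+ cross G v u 𝒞⁺) ℚ.+ 1ℚ
              ≡⟨ solve 3 (λ x y z → (x :+ y) :+ z := (x :+ z) :+ y) refl
                   (cross G u v 𝒞⁺) (cross G v u 𝒞⁺) 1ℚ ⟩
            (cross G u v 𝒞⁺ ℚ.+ 1ℚ) ℚ.+ cross G v u 𝒞⁺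
              ≤⟨ ℚ.+-mono-≤ from≤ into≤ ⟩
            cross G u v 𝒞 ℚ.+ cross G v u 𝒞
              ≡⟨ load-ends 𝒞 ends≡ ⟨
            load G 𝒞 e
              ≤⟨ load≤ ⟩
            fromℕ (suc d)
              ≡⟨ fromℕ-suc d ⟩
            fromℕ d ℚ.+ 1ℚ ∎))
          where
          open ℚ.≤-Reasoning
          open +-*-Solver
          -- The load drops by 1 and so does the slack. With `d = 0` nothing would be left of the
          -- load, contrary to liveness.
          reduce : ∀ d → A e ℕ.+ suc d ℕ.≤ cap e → load⁺ e ℚ.≤ fromℕ d → Phase G rank T Stale s⁺ e
          reduce zero    _     load≤0 =
            contradiction (subst (load⁺ e ℚ.≤_) (fromℕ≡ 0) load≤0) (<⇒≱ (Live⇒load>0 live⁺))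
          reduce (suc d) small load≤d = unturned d (unturned-bound (suc d) small) load≤d
        phase-turned (once ends′ f small) with refl , refl ← same-ends ends≡ u∈N ends′ f =
          twice (rank i) (Ends-swap ends≡) (facing-turned f)
            (suc-bound e {0} (ℕ.≤-trans small (ℕ.m≤m+n _ 0))) (below-turned f) (Outranked-in u∈N)
        phase-turned (twice ρ ends′ f small below above-v)
          with refl , refl ← same-ends ends≡ u∈N ends′ f =
          thrice (rank i) (Ends-swap ends≡) (facing-turned f)
            (suc-bound e small) (below-turned f) (Outranked-in u∈N)
            -- Ranks of turning terminals descend, so the bound from the previous turn at the other
            -- end still holds for the new, smaller rank.
            (λ w∈ p → ℕ.<-trans (i-below f below) (Outranked-out v∉N above-v w∈ p))
        phase-turned (thrice ρ ends′ f small below above-v above-u)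
          with refl , refl ← same-ends ends≡ u∈N ends′ f =
          thrice (rank i) (Ends-swap ends≡) (facing-turned f)
            (full-bound (Live-before live⁺) small) (below-turned f) (Outranked-in u∈N)
            (λ w∈ p → ℕ.<-trans (i-below f below) (Outranked-out v∉N above-v w∈ p))

      phase⁺ : ∀ {e} → Live⁺ e → Phase G rank T B s e → Phase G rank T Stale s⁺ e
      phase⁺ {e} live⁺ ph with proj₁ (ends e) ∈? N | proj₂ (ends e) ∈? N
      ... | no  p∉N | no  q∉N = phase-outside live⁺ p∉N q∉N ph
      ... | yes p∈N | no  q∉N = Turn.phase-turned (inj₁ refl) live⁺ p∈N q∉N ph
      ... | no  p∉N | yes q∈N = Turn.phase-turned (inj₂ refl) live⁺ q∈N p∉N ph
      ... | yes p∈N | yes q∈N =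
        contradiction (trans (Now.same p∈N) (sym (Now.same q∈N))) (Live-before live⁺)

      -- An edge within M(r i) can only be loaded by an earlier meta-node of r i, which
      -- leaves out an end a of an edge of Y; so i is not yet stale with respect to a.
      crossed-merged : ∀ {e t} → e ∈ δ G X → t ℕ.≤ now →
        metaAt t (proj₁ (ends e)) ≡ metaAt t (proj₂ (ends e)) →
        ¬ (∀ {w a} → w ∈ T′ → r w ∈ metaAt t (proj₁ (ends e)) → a ∈ metaAt t (proj₁ (ends e)) →
             B w a)
      crossed-merged {e} {t₀} e∈ t₀≤ eq stale = split new (separates⁻ G X e e∈)
        where
        module P₀ = Partition (partition t₀≤)
        p = proj₁ (ends e)
        q = proj₂ (ends e)

        within : ∀ {u v t a} → metaAt t₀ u ≡ metaAt t₀ v → p ∈ metaAt t₀ u → U G s i a →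
                 suc t ℕ.≤ now → metaAt (suc t) a ≡ metaAt (suc t) (r i) →
                 u ∈ metaAt t (r i) → v ∉ metaAt t (r i) → Empty.⊥
        within {u} {v} {t} {a} same p∈u (a∈N , f , f∈E , a∈f) t<now a≡r u∈ v∉ =
          not-stale (proj₁ (x∈p∩q⁻ Y _ f∈E)) a∈N a∈f (inj₁ (stale i∈T′
            (P₀.trans-∈ r∈u (P₀.swap-∈ p∈u))
            (P₀.trans-∈ (P₀.trans-∈ a∈r r∈u) (P₀.swap-∈ p∈u))))
          where
          -- From time `t₀` on the ends are together, but the meta-node at time `t` separates them.
          -- Strictness matters: `a` arrives only at `suc t`, which is still at most `t₀`.
          t<t₀ : t ℕ.< t₀
          t<t₀ = ℕ.≰⇒> λ t₀≤t → v∉ (Partition.trans-∈ (partition (ℕ.<⇒≤ t<now))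
            (grows t₀≤t (ℕ.<⇒≤ t<now) u (P₀.≡⇒∈ (sym same))) u∈)
          r∈u : r i ∈ metaAt t₀ u
          r∈u = P₀.swap-∈ (grows (ℕ.<⇒≤ t<t₀) t₀≤ (r i) u∈)
          a∈r : a ∈ metaAt t₀ (r i)
          a∈r = grows t<t₀ t₀≤ (r i) (Partition.≡⇒∈ (partition t<now) a≡r)

        split : NewCut G s i X → (p ∈ X × q ∉ X) ⊎ (q ∈ X × p ∉ X) → Empty.⊥
        split (whole _) (inj₁ (p∈ , q∉)) =
          q∉ (Now.trans-∈ (grows t₀≤ ℕ.≤-refl p (P₀.≡⇒∈ (sym eq))) p∈)
        split (whole _) (inj₂ (q∈ , p∉)) =
          p∉ (Now.trans-∈ (grows t₀≤ ℕ.≤-refl q (P₀.≡⇒∈ eq)) q∈)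
        split (earlier _ _ (a∈U , (t<now , a≡r , _) , _)) (inj₁ (p∈ , q∉)) =
          within eq (P₀.self p) a∈U t<now a≡r p∈ q∉
        split (earlier _ _ (a∈U , (t<now , a≡r , _) , _)) (inj₂ (q∈ , p∉)) =
          within (sym eq) (P₀.≡⇒∈ eq) a∈U t<now a≡r q∈ p∉

      edges⁺ : ∀ e → EdgeInvariant G rank T Stale s⁺ e
      edges⁺ e with Next.M (proj₁ (ends e)) ≡? Next.M (proj₂ (ends e)) | edges e
      ... | no live⁺ | live _ ph = live live⁺ (phase⁺ live⁺ ph)
      ... | yes eq   | live l ph = merged eq (live-bound l ph)
      ... | no live⁺ | merged eq _ = contradiction eq (Live-before live⁺)
      ... | yes eq⁺  | merged eq A≤ with e ∈? δ G X
      ...   | no  e∉ = merged eq⁺ (ℕ.≤-trans (A⁺≤A e∉) A≤)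
      -- The time is `now`: the meta-node concerned is `N`, and all its terminals have just become
      -- `Stale` with respect to all its vertices.
      ...   | yes e∈ = locked (ℕ.n≤1+n now)
        (subst (λ M → M (proj₁ (ends e)) ≡ M (proj₂ (ends e))) (sym (metaAt-old ℕ.≤-refl)) eq)
        (λ {w} {a} _ w∈ a∈ → inj₂ (within w∈ , within a∈)) (suc-bound e A≤)
        where
        p∈N : proj₁ (ends e) ∈ N
        p∈N with separates⁻ G X e e∈
        ... | inj₁ (p∈X , _) = X⊆N new p∈X
        ... | inj₂ (q∈X , _) = Now.trans-∈ (Now.≡⇒∈ eq) (X⊆N new q∈X)
        within : ∀ {v} → v ∈ Next.metaAt now (proj₁ (ends e)) → v ∈ N
        within {v} v∈ = Now.trans-∈ (subst (λ M → v ∈ M _) (metaAt-old ℕ.≤-refl) v∈) p∈N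
      edges⁺ e | _ | locked {t} t≤ eq stale A≤ with e ∈? δ G X
      ... | yes e∈ = ⊥-elim (crossed-merged e∈ t≤ eq stale)
      ... | no  e∉ = locked (ℕ.m≤n⇒m≤1+n t≤)
        (subst (λ M → M (proj₁ (ends e)) ≡ M (proj₂ (ends e))) (sym (metaAt-old t≤)) eq)
        (λ w∈ r∈ a∈ → inj₁ (stale (proj₁ (T⁺⁻ w∈)) (old r∈) (old a∈)))
        (ℕ.≤-trans (A⁺≤A e∉) A≤)
        where
        old : ∀ {v} → v ∈ Next.metaAt t (proj₁ (ends e)) → v ∈ metaAt t (proj₁ (ends e))
        old {v} = subst (λ M → v ∈ M (proj₁ (ends e))) (metaAt-old t≤)

      critical? : Decidable (λ e → A⁺ e ≡ cap e ℕ.+ 2 × 0ℚ ℚ.< load⁺ e)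
      critical? e = (A⁺ e ℕ.≟ cap e ℕ.+ 2) ×-dec (0ℚ ℚ.<? load⁺ e)

      A≤A⁺ : ∀ e → A e ℕ.≤ A⁺ e
      A≤A⁺ = integralLoad-mono G 𝒜 i X (Assigned.pending assigned i∈T′)

      Y⇒live⁺ : ∀ {e} → e ∈ Next.Y → Live⁺ e × cap e ℕ.+ 2 ℕ.≤ A⁺ e
      Y⇒live⁺ {e} e∈ with e∈Y′ , e∉zero ← x∈p─q⁻ (Y ∪ tabulate (does ∘ critical?)) zeroLoad e∈ =
        load≢0⇒Live (λ ≡0 → e∉zero (zeroLoad⁺ ≡0)) , full (x∈p∪q⁻ Y _ e∈Y′)
        where
        full : e ∈ Y ⊎ e ∈ tabulate (does ∘ critical?) → cap e ℕ.+ 2 ℕ.≤ A⁺ e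
        full (inj₁ e∈Y)    = ℕ.≤-trans (proj₂ (Y⇒live e∈Y)) (A≤A⁺ e)
        full (inj₂ e∈crit) = ℕ.≤-reflexive (sym (proj₁ (∈-tabulate⁻ critical? e∈crit)))

      -- The algorithm tests for equality with `cap e + 2`. This misses nothing, as a live edge
      -- cannot exceed that value.
      live⇒Y⁺ : ∀ {e} → Live⁺ e → cap e ℕ.+ 2 ℕ.≤ A⁺ e → e ∈ Next.Y
      live⇒Y⁺ {e} live⁺ full = x∈p∧x∉q⇒x∈p─q
        (x∈p∪q⁺ (inj₂ (∈-tabulate⁺ critical? (ℕ.≤-antisym bound full , Live⇒load>0 live⁺))))
        (λ e∈zero → ℚ.<-irrefl (sym (zeroLoad⁻ e∈zero)) (Live⇒load>0 live⁺))
        where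
        bound : A⁺ e ℕ.≤ cap e ℕ.+ 2
        bound with edges e
        ... | live l ph         = live-bound l ph
        ... | merged eq _       = contradiction eq (Live-before live⁺)
        ... | locked t≤ eq _ _  = contradiction (Now.same (grows t≤ ℕ.≤-refl _
                (Partition.≡⇒∈ (partition t≤) eq))) (Live-before live⁺)

      assigned⁺ : Assigned G rank T Stale s⁺
      assigned⁺ = record
        { T′⊆T          = λ w∈ → T′⊆T (proj₁ (T⁺⁻ w∈))
        ; total         = total⁺
        ; pending       = λ w∈ → let w∈T′ , w≢i = T⁺⁻ w∈ in trans (there⁺ w≢i) (pending w∈T′)
        ; assigned∈T    = assigned∈T⁺
        ; isCut         = isCut⁺
        ; r∈side        = r∈side⁺
        ; apart         = apart⁺
        ; apart-pending = apart-pending⁺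
        ; apart-done    = apart-done⁺ }
        where
        open Assigned assigned hiding (r∈side)
        here⁺ : Next.𝒜 i ≡ just X
        here⁺ = assign-here G 𝒜 i X
        there⁺ : ∀ {j} → j ≢ i → Next.𝒜 j ≡ 𝒜 j
        there⁺ = assign-there G 𝒜 i X

        cases : ∀ {j Z} → Next.𝒜 j ≡ just Z → (j ≡ i × Z ≡ X) ⊎ (j ≢ i × 𝒜 j ≡ just Z)
        cases {j} eq with j Fin.≟ i
        ... | yes refl = inj₁ (refl , just-injective (trans (sym eq) here⁺))
        ... | no  j≢i  = inj₂ (j≢i , trans (sym (there⁺ j≢i)) eq)

        total⁺ : ∀ {j} → j ∈ T → j ∈ T′ - i ⊎ ∃ λ Z → Next.𝒜 j ≡ just Z
        total⁺ {j} j∈ with j Fin.≟ i | total j∈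
        ... | yes refl | _             = inj₂ (X , here⁺)
        ... | no  j≢i  | inj₁ j∈T′     = inj₁ (x∈p∧x≢y⇒x∈p-y j∈T′ j≢i)
        ... | no  j≢i  | inj₂ (Z , eq) = inj₂ (Z , trans (there⁺ j≢i) eq)

        assigned∈T⁺ : ∀ {j Z} → Next.𝒜 j ≡ just Z → j ∈ T
        assigned∈T⁺ eq with cases eq
        ... | inj₁ (refl , refl) = T′⊆T i∈T′
        ... | inj₂ (_ , eq′)     = assigned∈T eq′

        isCut⁺ : ∀ {j Z} → Next.𝒜 j ≡ just Z → IsCut G Z
        isCut⁺ eq with cases eq
        ... | inj₂ (_ , eq′)     = isCut eq′
        -- A cut of `i` contains all of `N`, so a vertex outside it is also outside `X`.
        ... | inj₁ (refl , refl) with C , C∈ , refl ← hasCut i∈T′ =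
          let _ , v , v∉C = Ordered.isCut ordered C∈ in
          (r i , r∈X new) , v , λ v∈X → v∉C (closed C∈ (X⊆N new v∈X) (r∈side C∈))

        r∈side⁺ : ∀ {j Z} → Next.𝒜 j ≡ just Z → r j ∈ Z
        r∈side⁺ eq with cases eq
        ... | inj₁ (refl , refl) = r∈X new
        ... | inj₂ (_ , eq′)     = Assigned.r∈side assigned eq′

        avoids : ∀ {j v} → (∀ {C} → C ∈ˡ 𝒞 → owner C ≡ j → v ∉ side C) →
                 ∀ {C} → C ∈ˡ 𝒞⁺ → owner C ≡ j → v ∉ side C
        avoids f C∈ C≡j v∈C with _ , _ , o ← origin C∈ =
          let D , D∈ , D≡C , D≡B = base o
          in f D∈ (trans D≡C C≡j) (subst (_ ∈_) (sym D≡B) (⊆base o v∈C))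

        apart⁺ : ∀ a {j k} → j ∈ S a → k ∈ S a → j ≢ k →
                 (∀ {C} → C ∈ˡ 𝒞⁺ → owner C ≡ j → r k ∉ side C) ⊎
                 (∀ {C} → C ∈ˡ 𝒞⁺ → owner C ≡ k → r j ∉ side C)
        apart⁺ a j∈ k∈ j≢k with apart a j∈ k∈ j≢k
        ... | inj₁ f = inj₁ (avoids f)
        ... | inj₂ f = inj₂ (avoids f)

        -- For the terminal just processed: no cut splits `N`, so with `r k` in `N` every cut of `i`
        -- contains `r k` and every cut of `k` contains `r i`, against the fractional separation.
        apart-pending⁺ : ∀ a {j k Z} → j ∈ S a → k ∈ S a → j ≢ k → Next.𝒜 j ≡ just Z →
                         k ∈ T′ - i → r k ∉ Z
        apart-pending⁺ a {k = k} j∈ k∈ j≢k eq k∈⁺ r∈Z with cases eq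
        ... | inj₂ (_ , eq′) = apart-pending a j∈ k∈ j≢k eq′ (proj₁ (T⁺⁻ k∈⁺)) r∈Z
        ... | inj₁ (refl , refl)
          with C , C∈ , refl ← hasCut i∈T′ | D , D∈ , refl ← hasCut (proj₁ (T⁺⁻ k∈⁺))
          with apart a j∈ k∈ j≢k
        ...   | inj₁ f = f C∈ refl (closed C∈ (X⊆N new r∈Z) (r∈side C∈))
        ...   | inj₂ f = f D∈ refl (N-closed D∈ (X⊆N new r∈Z) (r∈side D∈))

        apart-done⁺ : ∀ a {j k Y Z} → j ∈ S a → k ∈ S a → j ≢ k →
                      Next.𝒜 j ≡ just Y → Next.𝒜 k ≡ just Z → r k ∉ Y ⊎ r j ∉ Z
        apart-done⁺ a j∈ k∈ j≢k eqj eqk with cases eqj | cases eqk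
        ... | inj₁ (refl , refl) | inj₁ (refl , refl) = contradiction refl j≢k
        ... | inj₁ (refl , refl) | inj₂ (_ , eqk′) =
          inj₂ (apart-pending a k∈ j∈ (j≢k ∘ sym) eqk′ i∈T′)
        ... | inj₂ (_ , eqj′) | inj₁ (refl , refl) = inj₁ (apart-pending a j∈ k∈ j≢k eqj′ i∈T′)
        ... | inj₂ (_ , eqj′) | inj₂ (_ , eqk′)    = apart-done a j∈ k∈ j≢k eqj′ eqk′

      invariant⁺ : RunInvariant G rank T Stale s⁺
      invariant⁺ = record
        { ordered    = ordered⁺
        ; partition  = partition⁺
        ; grows      = grows⁺
        ; singletons = λ v → trans (cong (λ M → M v) (metaAt-old ℕ.z≤n)) (singletons v)
        ; closed     = closed⁺
        ; B⇒node     = B⇒node⁺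
        ; edges      = edges⁺
        ; Y⇒live     = Y⇒live⁺
        ; live⇒Y     = live⇒Y⁺
        ; assigned   = assigned⁺ }

-- Correctness of the loop

module _ (G : MCP) {rank : Terminal G → ℕ} (rank-injective : Injective _≡_ _≡_ rank)
         {T : Subset (MCP.#T G)} where
  open MCP G
  open Weighted (weight {G})

  module _ (s : State G) where
    open State s

    remaining : List (Terminal G)
    remaining = filter (_∈? T′) (allFin #T)

    remaining⁺ : ∀ {k} → k ∈ T′ → k ∈ˡ remaining
    remaining⁺ k∈ = ∈-filter⁺ (_∈? T′) (∈-allFin _) k∈

    remaining⁻ : ∀ {k} → k ∈ˡ remaining → k ∈ T′
    remaining⁻ k∈ = proj₂ (∈-filter⁻ (_∈? T′) {xs = allFin #T} k∈)

    as-deep? : ∀ m → Decidable (λ k → depth G 𝒞 (r m) ℚ.≤ depth G 𝒞 (r k))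
    as-deep? m k = depth G 𝒞 (r m) ℚ.≤? depth G 𝒞 (r k)

    -- Among the deepest terminals the one of smallest rank will do, because domination implies a
    -- smaller rank.
    selectable-exists : Ordered G rank T′ 𝒞 → Nonempty T′ → ∃ (Selectable G s rank)
    selectable-exists ord (j , j∈)
      with m , m∈ , deepest ← least {R = λ j k → depth G 𝒞 (r k) ℚ.≤ depth G 𝒞 (r j)}
             (λ p q → ℚ.≤-trans q p) ℚ.≤-refl remaining (remaining⁺ j∈)
             (λ _ _ → ℚ.≤-total _ _)
      with i , i∈ , smallest ← least {R = λ j k → rank j ℕ.≤ rank k} ℕ.≤-trans ℕ.≤-refl
             (filter (as-deep? m) remaining) (∈-filter⁺ (as-deep? m) m∈ ℚ.≤-refl)
             (λ _ _ → ℕ.≤-total _ _)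
      with i∈′ , m≤i ← ∈-filter⁻ (as-deep? m) {xs = remaining} i∈ =
      i , (remaining⁻ i∈′ , λ k∈ → ℚ.≤-trans (deepest (remaining⁺ k∈)) m≤i) ,
      λ (k∈ , k-deepest) dom → ℕ.<⇒≱ (Ordered.dominates⇒rank< ord rank-injective dom)
        (smallest (∈-filter⁺ (as-deep? m) (remaining⁺ k∈) (k-deepest (remaining⁻ m∈))))

  progress : ∀ {B s} → RunInvariant G rank T B s → Nonempty (State.T′ s) → ∃ (Iteration G rank s)
  progress {s = s} inv ne = continue (update G s i (proj₁ cut-i) (proj₁ chain)) ,
    proceed (proj₂ selected) (proj₂ cut-i) (proj₂ chain)
    where
    selected : ∃ (Selectable G s rank)
    selected = selectable-exists s (RunInvariant.ordered inv) ne
    i : Terminal G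
    i = proj₁ selected
    cut-i : ∃ (NewCut G s i)
    cut-i = Selected.newCut G rank-injective inv (proj₂ selected)
    chain : ∃ (IsChain G rank (State.𝒞 s) (r i))
    chain = chain-exists G (RunInvariant.ordered inv) rank-injective (r i)

  -- `B` varies along with the state, as each iteration passes from `B` to `Stale`; `n` bounds the
  -- number of iterations left.
  loop-produces : ∀ {P : IntegralFamily G → Set} →
    (∀ {B s} → RunInvariant G rank T B s → Empty (State.T′ s) → P (State.𝒜 s)) →
    ∀ n {B s} → ∣ State.T′ s ∣ ℕ.≤ n → RunInvariant G rank T B s → LoopProduces G rank P s
  loop-produces final n {s = s} size inv with nonempty? (State.T′ s)
  ... | no  empty = halt empty (final inv empty)
  loop-produces final zero size inv | yes (j , j∈) =
    ⊥-elim (ℕ.<⇒≱ (ℕ.≤-<-trans ℕ.z≤n (x∈p⇒∣p-x∣<∣p∣ j∈)) size)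
  loop-produces final (suc n) {s = s} size inv | yes ne = loop (progress inv ne) λ where
      (abort sel _ r∈U) → ⊥-elim (Selected.no-abort G rank-injective inv sel r∈U refl)
      (proceed sel new chain) → _ , refl , loop-produces final n
        (ℕ.≤-pred (ℕ.≤-trans (x∈p⇒∣p-x∣<∣p∣ (proj₁ (proj₁ sel))) size))
        (Selected.Transition.invariant⁺ G rank-injective inv sel new chain)

-- From the fractional family to the invariant, and from the invariant to the output

module _ (G : MCP) {T : Subset (MCP.#T G)} {𝒞 : Family G}
         (feasible : FractionallyFeasible G T 𝒞 (MCP.cap G)) where
  open MCP G
  open FractionallyFeasible feasible
  open Weighted (weight {G})

  output-feasible : ∀ {rank B s} → RunInvariant G rank T B s → Empty (State.T′ s) →
                    IntegrallyFeasible G (λ e → cap e ℕ.+ 3) (State.𝒜 s)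
  output-feasible {s = s} inv empty = record
    { terminals = λ i → mk⇔ (λ (X , eq) → Equivalence.to (terminals i) (assigned∈T eq))
        λ i∈S → [ (λ i∈T′ → ⊥-elim (empty (_ , i∈T′))) , (λ p → p) ]′
          (total (Equivalence.from (terminals i) i∈S))
    ; isCut     = isCut
    ; r∈side    = r∈side
    ; separated = apart-done
    ; capacity  = λ e → bound e (edges e) }
    where
    open RunInvariant inv
    open Assigned assigned
    open State s
    bound : ∀ e → EdgeInvariant G _ T _ s e → integralLoad G 𝒜 e ℕ.≤ cap e ℕ.+ 3
    bound e (live _ (unturned d A≤ _)) = ℕ.≤-trans (ℕ.m≤m+n _ (suc d)) (ℕ.≤-trans A≤ (ℕ.m≤m+n _ 3))
    bound e (live _ (once _ _ A≤)) = ℕ.≤-trans A≤ (ℕ.m≤m+n _ 3)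
    bound e (live _ (twice _ _ _ A≤ _ _)) = ℕ.≤-trans A≤ (ℕ.+-monoʳ-≤ (cap e) (ℕ.s≤s ℕ.z≤n))
    bound e (live _ (thrice _ _ _ A≤ _ _ _)) =
      ℕ.≤-trans A≤ (ℕ.+-monoʳ-≤ (cap e) (ℕ.s≤s (ℕ.s≤s ℕ.z≤n)))
    bound e (merged _ A≤) = ℕ.≤-trans A≤ (ℕ.+-monoʳ-≤ (cap e) (ℕ.s≤s (ℕ.s≤s ℕ.z≤n)))
    bound e (locked _ _ _ A≤) = A≤

  module _ {𝒞⁰ : Family G} {rank : Terminal G → ℕ} (pre : Preprocessed G T 𝒞 𝒞⁰ rank) where
    module Pre = Preprocessed pre
    open Laminar G Pre.fractionalLaminar
    open IsFractionalLaminar Pre.fractionalLaminar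

    module Before = Laminar G fractionalLaminar

    -- Outermost cuts that meet are nested; the strict inclusion in the wrong direction would
    -- reverse the ranks by `rank-consistent`.
    outermost-nested : ∀ {C D v} → C ∈ˡ 𝒞⁰ → D ∈ˡ 𝒞⁰ → rank (owner C) ℕ.< rank (owner D) →
      v ∈ side C → v ∈ side D →
      ∃₂ λ P Q → Outermost G 𝒞⁰ (owner C) P × Outermost G 𝒞⁰ (owner D) Q × P ⊆ Q
    outermost-nested C∈ D∈ C<D v∈C v∈D
      with P , P∈ , Pi , maxP ← outermost (owner∈T C∈)
         | Q , Q∈ , Qj , maxQ ← outermost (owner∈T D∈)
      with ⊆-or-⊂ (nested P∈ Q∈ (maxP C∈ refl v∈C) (maxQ D∈ refl v∈D))
    ... | inj₁ P⊆Q = _ , _ , outermost⇒Outermost P∈ Pi maxP , outermost⇒Outermost Q∈ Qj maxQ , P⊆Q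
    ... | inj₂ Q⊂P = ⊥-elim (ℕ.<-asym C<D (Pre.rank-consistent (owner∈T D∈) (owner∈T C∈)
      (outermost⇒Outermost Q∈ Qj maxQ) (outermost⇒Outermost P∈ Pi maxP) Q⊂P))

    initially-ordered : Ordered G rank T 𝒞⁰
    initially-ordered = record
      { fractionalLaminar = Pre.fractionalLaminar
      ; weight>0  = Pre.weight>0
      ; inclusion = inclusion
      ; extends   = extends }
      where
      inclusion : ∀ {C D} → C ∈ˡ 𝒞⁰ → D ∈ˡ 𝒞⁰ → rank (owner C) ℕ.< rank (owner D) →
                  r (owner C) ∈ side D → r (owner D) ∈ side C → side C ⊆ side D
      inclusion C∈ D∈ C<D rC∈D rD∈C
        with P , Q , oP , oQ , P⊆Q ← outermost-nested C∈ D∈ C<D (r∈side C∈) rC∈D =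
        Pre.inclusion C∈ D∈ (P , Q , oP , oQ , tie (⊆⇒⊂⊎≡ P⊆Q))
          (x∈p∩q⁺ (r∈side C∈ , rC∈D)) (x∈p∩q⁺ (rD∈C , r∈side D∈))
        where
        tie : ∀ {P Q} → P ⊂ Q ⊎ P ≡ Q → P ⊂ Q ⊎ (P ≡ Q × rank _ ℕ.< rank _)
        tie (inj₁ P⊂Q) = inj₁ P⊂Q
        tie (inj₂ P≡Q) = inj₂ (P≡Q , C<D)

      extends : ∀ {C D v} → C ∈ˡ 𝒞⁰ → D ∈ˡ 𝒞⁰ → rank (owner C) ℕ.< rank (owner D) →
                v ∈ side C → v ∈ side D →
                ∃ λ D′ → D′ ∈ˡ 𝒞⁰ × owner D′ ≡ owner D × side C ⊆ side D′
      extends C∈ D∈ C<D v∈C v∈D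
        with P , Q , oP , oQ , P⊆Q ← outermost-nested C∈ D∈ C<D v∈C v∈D
        with D′ , D′∈ , D′j , refl ← Outermost-cut G oQ =
        D′ , D′∈ , D′j , λ x∈ → P⊆Q (Outermost-⊆ G oP C∈ refl x∈)

    load-preserved : ∀ e → load G 𝒞⁰ e ≡ load G 𝒞 e
    load-preserved e = μ-fibres _≡?_ side {𝒞⁰} {𝒞} Pre.reassigned (λ X → e ∈? δ G X)

    ⊆before : ∀ {C} → C ∈ˡ 𝒞⁰ → side C ⊆ ⋃ (map side (ownedBy G (owner C) 𝒞))
    ⊆before {C} C∈ x∈
      with P , P∈ , Pi , maxP ← outermost (owner∈T C∈)
         | Q , Q∈ , Qi , maxQ ← Before.outermost (owner∈T C∈) =
      ∈-⋃⁺ (∈-map⁺ side (∈-filter⁺ (owned? G (owner C)) Q∈ Qi))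
        (Pre.shrinks (owner∈T C∈) (outermost⇒Outermost P∈ Pi maxP)
          (Before.outermost⇒Outermost Q∈ Qi maxQ) (maxP C∈ refl x∈))

    s₀ : State G
    s₀ = initial G T 𝒞⁰

    initial-invariant : RunInvariant G rank T (λ _ _ → Empty.⊥) s₀
    initial-invariant = record
      { ordered    = initially-ordered
      ; partition  = λ _ → record { self = x∈⁅x⁆ ; same = λ u∈ → cong ⁅_⁆ (x∈⁅y⁆⇒x≡y _ u∈) }
      ; grows      = λ _ _ _ x∈ → x∈
      ; singletons = λ _ → refl
      ; closed     = λ C∈ u∈ v∈C → subst (_∈ _) (sym (x∈⁅y⁆⇒x≡y _ u∈)) v∈C
      ; B⇒node     = λ ()
      ; edges      = edges
      ; Y⇒live     = λ e∈ → ⊥-elim (∉⊥ e∈)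
      ; live⇒Y     = λ {e} _ full → contradiction
          (subst (cap e ℕ.+ 2 ℕ.≤_) (unloaded e) full)
          (ℕ.<⇒≱ (ℕ.<-≤-trans (cap>0 e) (ℕ.m≤m+n (cap e) 2)))
      ; assigned   = record
        { T′⊆T          = λ i∈ → i∈
        ; total         = inj₁
        ; pending       = λ _ → refl
        ; assigned∈T    = λ ()
        ; isCut         = λ ()
        ; r∈side        = λ ()
        ; apart         = apart
        ; apart-pending = λ _ _ _ _ ()
        ; apart-done    = λ _ _ _ _ () } }
      where
      unloaded : ∀ e → integralLoad G (State.𝒜 s₀) e ≡ 0
      unloaded e = cong length (filter-none
        (λ i → Maybe.dec (λ X → e ∈? δ G X) (State.𝒜 s₀ i)) {allFin #T} (All.tabulate λ _ ()))

      edges : ∀ e → EdgeInvariant G rank T (λ _ _ → Empty.⊥) s₀ e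
      edges e with ⁅ proj₁ (ends e) ⁆ ≡? ⁅ proj₂ (ends e) ⁆
      -- Initially this happens only for loops.
      ... | yes eq = merged eq (subst (ℕ._≤ cap e ℕ.+ 2) (sym (unloaded e)) ℕ.z≤n)
      ... | no  p≢q = live p≢q (start (cap e) refl (cap>0 e))
        where
        start : ∀ c → cap e ≡ c → 0 ℕ.< c → Phase G rank T (λ _ _ → Empty.⊥) s₀ e
        -- The initial slack is the whole capacity, which is positive and hence of the form `suc d`.
        start (suc d) eq _ = unturned d
          (ℕ.≤-reflexive (trans (cong (ℕ._+ suc d) (unloaded e)) (sym eq)))
          (subst₂ ℚ._≤_ (sym (load-preserved e))
            (trans (sym (fromℕ≡ (cap e))) (cong fromℕ eq)) (capacity e))

      apart : ∀ a {i j} → i ∈ S a → j ∈ S a → i ≢ j →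
              (∀ {C} → C ∈ˡ 𝒞⁰ → owner C ≡ i → r j ∉ side C) ⊎
              (∀ {C} → C ∈ˡ 𝒞⁰ → owner C ≡ j → r i ∉ side C)
      apart a i∈ j∈ i≢j with separated a i∈ j∈ i≢j
      ... | inj₁ rj∉ = inj₁ λ { C∈ refl rj∈ → rj∉ (⊆before C∈ rj∈) }
      ... | inj₂ ri∉ = inj₂ λ { C∈ refl ri∈ → ri∉ (⊆before C∈ ri∈) }

    round2-correct : LoopProduces G rank (IntegrallyFeasible G (λ e → cap e ℕ.+ 3)) s₀
    round2-correct =
      loop-produces G Pre.rank-injective output-feasible ∣ T ∣ ℕ.≤-refl initial-invariant

lemma4 : (G : MCP) (T : Subset (MCP.#T G)) (𝒞 : Family G) →
    FractionallyFeasible G T 𝒞 (MCP.cap G) →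
    Round2Produces G T 𝒞 (IntegrallyFeasible G (λ e → MCP.cap G e + 3))
lemma4 G T 𝒞 feasible =
  Preprocessing.preprocessed-exists G (FractionallyFeasible.fractionalLaminar feasible) ,
  round2-correct G feasible
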